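{- Let $G$ be a connected $\{1,3\}$-graph. Then the period of the Ehrhart quasi-polynomial $L^{\mathcal{P}}_G(t)$ is at most $2$ if $G$ is a tree or a cubic graph, and it is equal to $4$ otherwise.
   Context: A $\{1,3\}$-graph is a finite graph (loops and parallel edges allowed, a loop contributing $2$ to the degree) in which every node has degree $1$ or $3$; degree-$1$ nodes are leaves, degree-$3$ nodes are internal nodes; a cubic graph is one in which every node has degree 3. Let $E$ be the edge set. For each internal node $v$ let $a,b,c$ be the three edges incident with $v$, listed with multiplicity (a loop at $v$ is listed twice). The polytope $\mathcal{P}_G\subset\mathbb{R}^E$ is the set of $w$ satisfying, for every internal node $v$, $w_a\le w_b+w_c$, $w_b\le w_a+w_c$, $w_c\le w_a+w_b$, $w_a+w_b+w_c\le 1$, together with $0\le w_e\le \frac12$ for every edge $e$ that alone forms a connected component. For an integer $t\ge0$, $L^{\mathcal{P}}_G(t)=|t\mathcal{P}_G\cap\mathbb{Z}^E|$; this is a quasi-polynomial in $t$, i.e. there are polynomials $p_0,\dots,p_{\alpha-1}$ with $L^{\mathcal{P}}_G(t)=p_j(t)$ whenever $t\equiv j\pmod\alpha$, and the least such $\alpha$ is its period. -}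

module Defs where

open import Data.Nat as ℕ using (ℕ; zero; suc; _<_; _≤_; _%_)
open import Data.Integer as ℤ using (ℤ; +_; _≤ᵇ_)
open import Data.Rational as ℚ using (ℚ; 0ℚ)
open import Data.Fin using (Fin; zero; suc; inject₁; fromℕ; _≟_)
open import Data.Vec using (Vec; lookup)
open import Data.List using (List; []; _∷_; _++_; concatMap; length; map; foldr)
open import Data.List.Base using (allFin)
open import Data.Bool using (Bool; true; false; if_then_else_; _∧_; T)
open import Data.Product using (Σ; _×_; _,_; proj₁; proj₂)
open import Data.Sum using (_⊎_)
open import Data.Empty using (⊥)
open import Relation.Nullary using (¬_)
open import Relation.Nullary.Decidable using (⌊_⌋)
open import Relation.Binary.PropositionalEquality using (_≡_)
open import Function.Bundles using (_↔_)
open import Function.Definitions using (Injective)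

-- Finite multigraphs (loops and parallel edges allowed).
-- Nodes are Fin nV, edges are Fin nE; each edge has two ends.
-- An edge e is a loop iff both ends coincide.

allᵇ : {A : Set} → (A → Bool) → List A → Bool
allᵇ p = foldr (λ x b → p x ∧ b) true

record Graph : Set where
  field
    nV   : ℕ
    nE   : ℕ
    ends : Fin nE → Fin nV × Fin nV

module _ (G : Graph) where
  open Graph G

  -- the edges incident with v, listed with multiplicity
  -- (a loop at v is listed twice)
  incident : Fin nV → List (Fin nE)
  incident v = concatMap
    (λ e → (if ⌊ proj₁ (ends e) ≟ v ⌋ then e ∷ [] else [])
        ++ (if ⌊ proj₂ (ends e) ≟ v ⌋ then e ∷ [] else []))
    (allFin nE)

  degree : Fin nV → ℕ
  degree v = length (incident v)

  Is13Graph : Set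
  Is13Graph = ∀ v → degree v ≡ 1 ⊎ degree v ≡ 3

  Cubic : Set
  Cubic = ∀ v → degree v ≡ 3

  Joins : Fin nE → Fin nV → Fin nV → Set
  Joins e x y = (ends e ≡ (x , y)) ⊎ (ends e ≡ (y , x))

  data Reach : Fin nV → Fin nV → Set where
    here : ∀ {v} → Reach v v
    step : ∀ {u w v} (e : Fin nE) → Joins e u w → Reach w v → Reach u v

  Connected : Set
  Connected = ∀ u v → Reach u v

  -- a cycle of length k+1: distinct edges es 0..k, distinct vertices
  -- vs 0..k, with vs (k+1) = vs 0, and edge es i joining vs i and vs (i+1).
  -- (A loop is a cycle of length 1, two parallel edges a cycle of length 2.)
  record Cycle : Set where
    field
      k      : ℕ
      es     : Fin (suc k) → Fin nE
      vs     : Fin (suc (suc k)) → Fin nV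
      closed : vs (fromℕ (suc k)) ≡ vs zero
      joins  : ∀ i → Joins (es i) (vs (inject₁ i)) (vs (suc i))
      es-inj : Injective _≡_ _≡_ es
      vs-inj : Injective _≡_ _≡_ (λ i → vs (inject₁ i))

  IsTree : Set
  IsTree = Connected × ¬ Cycle

  -- edge e alone forms a connected component: every edge incident with
  -- an end of e is e itself
  isolatedᵇ : Fin nE → Bool
  isolatedᵇ e = allᵇ (λ e' → ⌊ e' ≟ e ⌋)
                    (incident (proj₁ (ends e)) ++ incident (proj₂ (ends e)))

  -- membership of an integer vector w in t·P_G
  -- (the defining inequalities of P_G, each scaled by t)

  nodeOKᵇ : ℕ → Vec ℤ nE → Fin nV → Bool
  nodeOKᵇ t w v with incident v
  ... | a ∷ b ∷ c ∷ [] =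
        (wa ≤ᵇ wb ℤ.+ wc) ∧ (wb ≤ᵇ wa ℤ.+ wc) ∧ (wc ≤ᵇ wa ℤ.+ wb)
        ∧ (wa ℤ.+ wb ℤ.+ wc ≤ᵇ + t)
    where
      wa = lookup w a
      wb = lookup w b
      wc = lookup w c
  ... | _ = true

  edgeOKᵇ : ℕ → Vec ℤ nE → Fin nE → Bool
  edgeOKᵇ t w e =
    if isolatedᵇ e
    then ((+ 0 ≤ᵇ lookup w e) ∧ ((lookup w e ℤ.+ lookup w e) ≤ᵇ + t))
    else true

  inTPᵇ : ℕ → Vec ℤ nE → Bool
  inTPᵇ t w = allᵇ (nodeOKᵇ t w) (allFin nV) ∧ allᵇ (edgeOKᵇ t w) (allFin nE)

  LatticePts : ℕ → Set
  LatticePts t = Σ (Vec ℤ nE) (λ w → T (inTPᵇ t w))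

  EhrhartCount : ℕ → ℕ → Set
  EhrhartCount t k = LatticePts t ↔ Fin k

Poly : Set
Poly = List ℚ

evalPoly : Poly → ℚ → ℚ
evalPoly []       x = 0ℚ
evalPoly (c ∷ cs) x = c ℚ.+ x ℚ.* evalPoly cs x

ℕtoℚ : ℕ → ℚ
ℕtoℚ n = + n ℚ./ 1

HasQuasiPolyPeriod : Graph → ℕ → Set
HasQuasiPolyPeriod G zero    = ⊥
HasQuasiPolyPeriod G (suc β) =
  Σ (Fin (suc β) → Poly) λ p →
    ∀ (t : ℕ) → Σ ℕ λ k →
      EhrhartCount G t k × (evalPoly (p (Data.Fin.fromℕ< (ℕ.m%n<n t (suc β)))) (ℕtoℚ t) ≡ ℕtoℚ k)
  where import Data.Nat.DivMod as ℕ

Period : Graph → ℕ → Set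
Period G α = HasQuasiPolyPeriod G α × (∀ β → β < α → ¬ HasQuasiPolyPeriod G β)

{-# OPTIONS --safe #-}
module Submission where

-- Fix t, let m = ⌊t/2⌋, and let N(a, b, c) ∈ {0, 1} indicate that a, b, c satisfy the
-- inequalities of a node.  These are the structure constants of a commutative associative
-- algebra with basis e₀, …, eₘ, orthonormal for the functional ε that reads off the
-- coefficient of e₀.  Hence the edges of G can be contracted one at a time, and the number
-- of lattice points is ε(Ωⁿ θᵍ), where Ω = Σ eₐ, θ = Σ eₐ², n is the number of leaves and g
-- the cycle rank.
--
-- For t odd, Ω is the inverse of 2 - K with K = eₘ, and θ = Ω V with V = (2m + 3) / (2 + K).
-- Partial fractions leave powers of Ω and of V; their coefficients solve second-order
-- difference equations, so that ε is polynomial in m.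
--
-- For t even, 2θ = (m + 1) Ω + W + Π with Ω W = 0 and Π = Σ (-1)ᵃ eₐ.  Powers of Ω and W are
-- treated as before, every element acts on Π by a scalar, and Π Ω is Π or 0 according to
-- the parity of m.  The parity drops out if n = 0 or g = 0; otherwise the values for even
-- and odd m differ by (1 - 2⁻ᵍ) (m + 1)ᵍ⁻¹.

open import Defs
open import Data.Nat using (ℕ; zero; suc; _≤_; _<_; z≤n; s≤s)
import Data.Nat as ℕ
import Data.Nat.Properties as ℕ
open import Data.Integer using (ℤ)
import Data.Integer as ℤ
import Data.Integer.Properties as ℤ
open import Data.Rational using (ℚ; 0ℚ; 1ℚ)
import Data.Rational as ℚ
import Data.Rational.Properties as ℚ
import Data.Rational.Unnormalised as ℚᵘ
import Data.Rational.Unnormalised.Properties as ℚᵘ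
open import Data.Product using (Σ; _×_; _,_; proj₁; proj₂)
open import Data.Sum using (_⊎_; inj₁; inj₂; [_,_]′)
open import Data.Empty using (⊥-elim)
open import Data.List using (List; []; _∷_)
open import Data.Maybe using (Maybe; just; nothing)
open import Relation.Nullary using (¬_; Dec; yes; no)
open import Relation.Binary.PropositionalEquality using (_≡_; _≢_; refl; sym; trans; cong; cong₂; subst; module ≡-Reasoning)
open import Algebra.Bundles using (CommutativeRing; CommutativeMonoid)
open import Algebra.Structures using (IsCommutativeRing)
import Algebra.Solver.Ring as RingSolver
import Algebra.Solver.Ring.AlmostCommutativeRing as ACR
open import Data.Nat.Tactic.RingSolver using () renaming (solve to nat-solve; solve-∀ to nat-solve-∀)
open import Function using (_∘_)
open import Relation.Nullary.Decidable using (_×-dec_; _⊎-dec_)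
open import Level using (0ℓ)

-- The algebra is the integer-spin part of the Verlinde algebra of SU(2) at level t. Its characters
-- would express the count as a trigonometric sum, in which polynomial dependence on m is invisible.
-- The proof stays over ℚ and uses no eigenvalues: multiplication by 2 - K, 2 + K or, for t even, 4
-- - e₀ - e₁ is minus a second difference, once the labels are placed on a line in such a way that
-- the reflection of labels hidden in K and in eₘ becomes a change of sign (up to a shift by 2 for
-- K). Dividing by such an element means solving a difference equation with one boundary condition.
-- Central factorials are the basis for this: they have a parity, and the second difference merely
-- shifts their index, so the coefficients of the solutions remain polynomial in m. On the side of
-- the graph, a connected graph contracts to a single block. It carries no Ω exactly if the graph is
-- cubic and no θ exactly if it is a tree, which is the case distinction of the theorem. The parity
-- of m enters through one scalar, the action of Ω on the line spanned by Π.

infixl 6 _+_ _-_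
infixl 7 _*_
infix  8 -_
infix  9 #_

-- The operations of ℚ are kept opaque, since unfolding them to normalised
-- fractions makes conversion checking explode.
opaque
  _+_ _*_ : ℚ → ℚ → ℚ
  _+_ = ℚ._+_
  _*_ = ℚ._*_

  -_ : ℚ → ℚ
  -_ = ℚ.-_

  ι : ℤ → ℚ
  ι i = i ℚ./ 1

#_ : ℕ → ℚ
# n = ι (ℤ.+ n)

opaque
  unfolding _+_

  isCommutativeRing : IsCommutativeRing _≡_ _+_ _*_ -_ 0ℚ 1ℚ
  isCommutativeRing = ℚ.+-*-isCommutativeRing

  private
    ι≃ : ∀ i → ℚ.toℚᵘ (ι i) ℚᵘ.≃ ℚᵘ.mkℚᵘ i 0
    ι≃ i = ℚ.toℚᵘ-fromℚᵘ (ℚᵘ.mkℚᵘ i 0)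

  ι-+ : ∀ i j → ι (i ℤ.+ j) ≡ ι i + ι j
  ι-+ i j = ℚ.toℚᵘ-injective (ℚᵘ.≃-trans (ι≃ (i ℤ.+ j)) (ℚᵘ.≃-trans (ℚᵘ.*≡* (cong₂ ℤ._*_ (cong₂ ℤ._+_ (sym (ℤ.*-identityʳ i)) (sym (ℤ.*-identityʳ j))) refl)) (ℚᵘ.≃-sym (ℚᵘ.≃-trans (ℚ.toℚᵘ-homo-+ (ι i) (ι j)) (ℚᵘ.+-cong (ι≃ i) (ι≃ j))))))

  ι-* : ∀ i j → ι (i ℤ.* j) ≡ ι i * ι j
  ι-* i j = ℚ.toℚᵘ-injective (ℚᵘ.≃-trans (ι≃ (i ℤ.* j)) (ℚᵘ.≃-sym (ℚᵘ.≃-trans (ℚ.toℚᵘ-homo-* (ι i) (ι j)) (ℚᵘ.*-cong (ι≃ i) (ι≃ j)))))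

  ι-neg : ∀ i → ι (ℤ.- i) ≡ - ι i
  ι-neg i = ℚ.toℚᵘ-injective (ℚᵘ.≃-trans (ι≃ (ℤ.- i)) (ℚᵘ.≃-sym (ℚᵘ.≃-trans (ℚ.toℚᵘ-homo‿- (ι i)) (ℚᵘ.-‿cong (ι≃ i)))))

  ι-0 : ι (ℤ.+ 0) ≡ 0ℚ
  ι-0 = refl

  ι-1 : ι (ℤ.+ 1) ≡ 1ℚ
  ι-1 = refl

  ι-injective : ∀ i j → ι i ≡ ι j → i ≡ j
  ι-injective i j eq with ℚᵘ.≃-trans (ℚᵘ.≃-sym (ι≃ i)) (ℚᵘ.≃-trans (ℚᵘ.≃-reflexive (cong ℚ.toℚᵘ eq)) (ι≃ j))
  ... | ℚᵘ.*≡* e = trans (sym (ℤ.*-identityʳ i)) (trans e (ℤ.*-identityʳ j))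

  inverse : ∀ q → q ≢ 0ℚ → Σ ℚ λ r → q * r ≡ 1ℚ
  inverse q q≢0 = (ℚ.1/ q) {{ℚ.≢-nonZero q≢0}} , ℚ.*-inverseʳ q {{ℚ.≢-nonZero q≢0}}

  evalPoly-∷ : ∀ c cs x → evalPoly (c ∷ cs) x ≡ c + x * evalPoly cs x
  evalPoly-∷ c cs x = refl

  ℕtoℚ≡ι : ∀ n → ℕtoℚ n ≡ # n
  ℕtoℚ≡ι n = refl

_-_ : ℚ → ℚ → ℚ
x - y = x + - y

ℚ-ring : CommutativeRing _ _
ℚ-ring = record { isCommutativeRing = isCommutativeRing }

open IsCommutativeRing isCommutativeRing using (+-identityˡ; +-identityʳ; *-identityˡ; *-identityʳ; +-comm; +-assoc; *-comm; *-assoc; distribˡ; distribʳ; zeroˡ; zeroʳ; -‿inverseʳ)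

private
  ℚ-almost = ACR.fromCommutativeRing ℚ-ring

  ι-morphism : ACR._-Raw-AlmostCommutative⟶_ ℤ.+-*-rawRing ℚ-almost
  ι-morphism = record { ⟦_⟧ = ι ; +-homo = ι-+ ; *-homo = ι-* ; -‿homo = ι-neg ; 0-homo = ι-0 ; 1-homo = ι-1 }

  ι-≟ : ∀ i j → Maybe (ι i ≡ ι j)
  ι-≟ i j with i ℤ.≟ j
  ... | yes i≡j = just (cong ι i≡j)
  ... | no  _   = nothing

-- Coefficients are integers, so literals `# k` are normalised. The constants `0ℚ` and `1ℚ` are not
-- literals for this solver; `ι-0` and `ι-1` translate them.
module Ring = RingSolver ℤ.+-*-rawRing ℚ-almost ι-morphism ι-≟
open Ring using (solve; _:=_; _:+_; _:*_; _:-_; :-_; con; Polynomial)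

:#_ : ∀ {n} → ℕ → Polynomial n
:# k = con (ℤ.+ k)
infix 9 :#_

#-+ : ∀ m n → # (m ℕ.+ n) ≡ # m + # n
#-+ m n = ι-+ (ℤ.+ m) (ℤ.+ n)

#-* : ∀ m n → # (m ℕ.* n) ≡ # m * # n
#-* m n = trans (cong ι (ℤ.pos-* m n)) (ι-* (ℤ.+ m) (ℤ.+ n))

#-suc : ∀ n → # (suc n) ≡ # 1 + # n
#-suc = #-+ 1

#-injective : ∀ {m n} → # m ≡ # n → m ≡ n
#-injective eq = ℤ.+-injective (ι-injective _ _ eq)



-- Powers, finite sums and indicators

infixr 8 _^_
_^_ : ℚ → ℕ → ℚ
x ^ zero  = 1ℚ
x ^ suc n = x * x ^ n

private variable
  P Q : Set

opaque
  ∑ : ℕ → (ℕ → ℚ) → ℚ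
  ∑ zero    f = 0ℚ
  ∑ (suc n) f = f 0 + ∑ n (f ∘ suc)

  ∑-0 : ∀ f → ∑ 0 f ≡ 0ℚ
  ∑-0 f = refl

  ∑-suc : ∀ n f → ∑ (suc n) f ≡ f 0 + ∑ n (f ∘ suc)
  ∑-suc n f = refl

  ∑-cong : ∀ n {f g : ℕ → ℚ} → (∀ i → i < n → f i ≡ g i) → ∑ n f ≡ ∑ n g
  ∑-cong zero    eq = refl
  ∑-cong (suc n) eq = cong₂ _+_ (eq 0 (s≤s z≤n)) (∑-cong n λ i i<n → eq (suc i) (s≤s i<n))

  ∑-zero : ∀ n {f : ℕ → ℚ} → (∀ i → i < n → f i ≡ 0ℚ) → ∑ n f ≡ 0ℚ
  ∑-zero zero    eq = refl
  ∑-zero (suc n) eq = trans (cong₂ _+_ (eq 0 (s≤s z≤n)) (∑-zero n λ i i<n → eq (suc i) (s≤s i<n))) (+-identityˡ 0ℚ)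

  ∑-+ : ∀ n (f g : ℕ → ℚ) → ∑ n (λ i → f i + g i) ≡ ∑ n f + ∑ n g
  ∑-+ zero    f g = sym (+-identityˡ 0ℚ)
  ∑-+ (suc n) f g = trans (cong (f 0 + g 0 +_) (∑-+ n (f ∘ suc) (g ∘ suc)))
    (solve 4 (λ a b c d → a :+ b :+ (c :+ d) := a :+ c :+ (b :+ d)) refl (f 0) (g 0) _ _)

  ∑-*ˡ : ∀ n c (f : ℕ → ℚ) → ∑ n (λ i → c * f i) ≡ c * ∑ n f
  ∑-*ˡ zero    c f = sym (zeroʳ c)
  ∑-*ˡ (suc n) c f = trans (cong (c * f 0 +_) (∑-*ˡ n c (f ∘ suc))) (sym (distribˡ c _ _))

  ∑-*ʳ : ∀ n c (f : ℕ → ℚ) → ∑ n (λ i → f i * c) ≡ ∑ n f * c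
  ∑-*ʳ n c f = trans (∑-cong n λ i _ → *-comm (f i) c) (trans (∑-*ˡ n c f) (*-comm c _))

  ∑-swap : ∀ m n (f : ℕ → ℕ → ℚ) → ∑ m (λ i → ∑ n (f i)) ≡ ∑ n (λ j → ∑ m (λ i → f i j))
  ∑-swap zero    n f = sym (∑-zero n λ _ _ → refl)
  ∑-swap (suc m) n f = trans (cong (∑ n (f 0) +_) (∑-swap m n (f ∘ suc))) (sym (∑-+ n (f 0) _))

𝟙 : Dec P → ℚ
𝟙 (yes _) = 1ℚ
𝟙 (no _)  = 0ℚ

𝟙-yes : (d : Dec P) → P → 𝟙 d ≡ 1ℚ
𝟙-yes (yes _) p = refl
𝟙-yes (no ¬p) p = ⊥-elim (¬p p)

𝟙-no : (d : Dec P) → ¬ P → 𝟙 d ≡ 0ℚ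
𝟙-no (yes p) ¬p = ⊥-elim (¬p p)
𝟙-no (no _)  ¬p = refl

𝟙-cong : (P → Q) → (Q → P) → (d : Dec P) (e : Dec Q) → 𝟙 d ≡ 𝟙 e
𝟙-cong f g (yes p) e = sym (𝟙-yes e (f p))
𝟙-cong f g (no ¬p) e = sym (𝟙-no e (¬p ∘ g))

𝟙-× : (d : Dec P) (e : Dec Q) → 𝟙 d * 𝟙 e ≡ 𝟙 (d ×-dec e)
𝟙-× (yes p) (yes q) = *-identityˡ 1ℚ
𝟙-× (yes p) (no ¬q) = *-identityˡ 0ℚ
𝟙-× (no ¬p) e       = zeroˡ (𝟙 e)

δ : ℕ → ℕ → ℚ
δ i j = 𝟙 (i ℕ.≟ j)

δ-refl : ∀ i → δ i i ≡ 1ℚ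
δ-refl i = 𝟙-yes (i ℕ.≟ i) refl

δ-≢ : ∀ {i j} → i ≢ j → δ i j ≡ 0ℚ
δ-≢ {i} {j} = 𝟙-no (i ℕ.≟ j)

δ-suc : ∀ i j → δ (suc i) (suc j) ≡ δ i j
δ-suc i j = 𝟙-cong ℕ.suc-injective (cong suc) (suc i ℕ.≟ suc j) (i ℕ.≟ j)

opaque
  unfolding ∑

  ∑-δ : ∀ n i (f : ℕ → ℚ) → i < n → ∑ n (λ j → δ i j * f j) ≡ f i
  ∑-δ (suc n) zero f i<n = trans
    (cong₂ _+_ (*-identityˡ (f 0)) (∑-zero n λ j _ → zeroˡ (f (suc j))))
    (+-identityʳ (f 0))
  ∑-δ (suc n) (suc i) f (s≤s i<n) = trans
    (cong₂ _+_ (zeroˡ (f 0)) (trans (∑-cong n λ j _ → cong (_* f (suc j)) (δ-suc i j)) (∑-δ n i (f ∘ suc) i<n)))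
    (+-identityˡ (f (suc i)))

  ∑-interval : ∀ n l u → u < n → ∑ n (λ i → 𝟙 (l ℕ.≤? i ×-dec i ℕ.≤? u)) ≡ # (suc u ℕ.∸ l)
  ∑-interval (suc n) zero zero u<n = trans (cong (_ +_) (∑-zero n λ i _ → 𝟙-no (0 ℕ.≤? suc i ×-dec suc i ℕ.≤? 0) λ { (_ , ()) })) (trans (+-identityʳ _) (sym ι-1))
  ∑-interval (suc n) zero (suc u) (s≤s u<n) = trans
    (cong (_ +_) (trans (∑-cong n λ i _ → 𝟙-cong (λ { (_ , s≤s q) → z≤n , q }) (λ { (_ , q) → z≤n , s≤s q }) (0 ℕ.≤? suc i ×-dec suc i ℕ.≤? suc u) (0 ℕ.≤? i ×-dec i ℕ.≤? u)) (∑-interval n zero u u<n)))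
    (trans (cong (_+ # (suc u)) (sym ι-1)) (sym (#-suc (suc u))))
  ∑-interval (suc n) (suc l) zero u<n = trans
    (cong₂ _+_ refl (∑-zero n λ i _ → 𝟙-no (suc l ℕ.≤? suc i ×-dec suc i ℕ.≤? 0) λ { (_ , ()) }))
    (trans (+-identityˡ 0ℚ) (trans (sym ι-0) (cong #_ (sym (ℕ.0∸n≡0 l)))))
  ∑-interval (suc n) (suc l) (suc u) (s≤s u<n) = trans
    (cong (_ +_) (trans (∑-cong n λ i _ → 𝟙-cong (λ { (s≤s p , s≤s q) → p , q }) (λ { (p , q) → s≤s p , s≤s q }) (suc l ℕ.≤? suc i ×-dec suc i ℕ.≤? suc u) (l ℕ.≤? i ×-dec i ℕ.≤? u)) (∑-interval n l u u<n)))
    (+-identityˡ _)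

-- Fusion rules

Tri : ℕ → ℕ → ℕ → ℕ → Set
Tri t a b c = a ≤ b ℕ.+ c × b ≤ a ℕ.+ c × c ≤ a ℕ.+ b × a ℕ.+ b ℕ.+ c ≤ t

tri? : ∀ t a b c → Dec (Tri t a b c)
tri? t a b c = a ℕ.≤? b ℕ.+ c ×-dec b ℕ.≤? a ℕ.+ c ×-dec c ℕ.≤? a ℕ.+ b ×-dec a ℕ.+ b ℕ.+ c ℕ.≤? t

≤-cast : ∀ {x x′ y y′} → x ≤ y → x ≡ x′ → y ≡ y′ → x′ ≤ y′
≤-cast p refl refl = p

≤-cancel : ∀ r {x x′ y y′} → x ≤ y → x ≡ r ℕ.+ x′ → y ≡ r ℕ.+ y′ → x′ ≤ y′
≤-cancel r p refl refl = ℕ.+-cancelˡ-≤ r _ _ p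

+-monoʳ : ∀ r {x y} → x ≤ y → r ℕ.+ x ≤ r ℕ.+ y
+-monoʳ r = ℕ.+-monoʳ-≤ r

Tri-swap₁₂ : ∀ t a b c → Tri t a b c → Tri t b a c
Tri-swap₁₂ t a b c (p , q , r , s) = q , p , ℕ.≤-trans r (ℕ.≤-reflexive (ℕ.+-comm a b)) , ≤-cast s (cong (ℕ._+ c) (ℕ.+-comm a b)) refl

Tri-swap₂₃ : ∀ t a b c → Tri t a b c → Tri t a c b
Tri-swap₂₃ t a b c (p , q , r , s) = ≤-cast p refl (ℕ.+-comm b c) , r , q , ≤-cast s (nat-solve (a ∷ b ∷ c ∷ [])) refl

module Fusion (t : ℕ) where

  private
    lower upper : ℕ → ℕ → ℕ
    lower x y = ℕ.∣ x - y ∣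
    upper x y = (x ℕ.+ y) ℕ.⊓ (t ℕ.∸ (x ℕ.+ y))

    Tri⇒interval : ∀ a b {e} → Tri t a b e → lower a b ≤ e × e ≤ upper a b
    Tri⇒interval a b {e} (p , q , r , s) = ∣-∣≤ (ℕ.≤-total a b) , ℕ.⊓-glb r (ℕ.m+n≤o⇒m≤o∸n e (≤-cast s (ℕ.+-comm (a ℕ.+ b) e) refl))
      where
      ∣-∣≤ : a ≤ b ⊎ b ≤ a → ℕ.∣ a - b ∣ ≤ e
      ∣-∣≤ (inj₁ a≤b) = ≤-cast (ℕ.m≤n+o⇒m∸n≤o b a q) (sym (ℕ.m≤n⇒∣m-n∣≡n∸m a≤b)) refl
      ∣-∣≤ (inj₂ b≤a) = ≤-cast (ℕ.m≤n+o⇒m∸n≤o a b p) (sym (trans (ℕ.∣-∣-comm a b) (ℕ.m≤n⇒∣m-n∣≡n∸m b≤a))) refl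

    interval⇒Tri : ∀ a b {e} → a ℕ.+ b ≤ t → lower a b ≤ e × e ≤ upper a b → Tri t a b e
    interval⇒Tri a b {e} a+b≤t (p , q) =
      ℕ.≤-trans (ℕ.m≤n+∣m-n∣ a b) (+-monoʳ b p) ,
      ℕ.≤-trans (ℕ.m≤n+∣m-n∣ b a) (+-monoʳ a (≤-cast p (ℕ.∣-∣-comm a b) refl)) ,
      ℕ.≤-trans q (ℕ.m⊓n≤m _ _) ,
      ≤-cast (ℕ.m≤o∸n⇒m+n≤o e a+b≤t (ℕ.≤-trans q (ℕ.m⊓n≤n _ _))) (ℕ.+-comm e (a ℕ.+ b)) refl

    -- Lower bounds x - y, y - x of an interval against its upper bounds z + w,
    -- t - (z + w), all shifted by k, with the subtractions cleared.
    Fits : ℕ → ℕ → ℕ → ℕ → ℕ → Set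
    Fits k x y z w = x ℕ.+ k ≤ y ℕ.+ (z ℕ.+ w) × y ℕ.+ k ≤ x ℕ.+ (z ℕ.+ w)
                   × x ℕ.+ k ℕ.+ (z ℕ.+ w) ≤ y ℕ.+ t × y ℕ.+ k ℕ.+ (z ℕ.+ w) ≤ x ℕ.+ t

    Fits⇒≤ : ∀ {k} x y z w → Fits k x y z w → lower x y ℕ.+ k ≤ upper z w
    Fits⇒≤ {k} x y z w (p , q , r , s) with ℕ.≤-total x y
    ... | inj₁ x≤y = ℕ.⊓-glb (shift q) (ℕ.m+n≤o⇒m≤o∸n _ (≤-cast (shift (≤-cast s (ℕ.+-assoc y k _) refl)) (sym (ℕ.+-assoc ∣xy∣ k (z ℕ.+ w))) refl))
      where
      ∣xy∣ = ℕ.∣ x - y ∣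
      shift : ∀ {j u} → y ℕ.+ j ≤ x ℕ.+ u → ∣xy∣ ℕ.+ j ≤ u
      shift {j} le = ≤-cancel x le (trans (cong (ℕ._+ j) (sym (ℕ.m+[n∸m]≡n x≤y))) (trans (ℕ.+-assoc x _ j) (cong (λ v → x ℕ.+ (v ℕ.+ j)) (sym (ℕ.m≤n⇒∣m-n∣≡n∸m x≤y))))) refl
    ... | inj₂ y≤x = ℕ.⊓-glb (shift p) (ℕ.m+n≤o⇒m≤o∸n _ (≤-cast (shift (≤-cast r (ℕ.+-assoc x k _) refl)) (sym (ℕ.+-assoc ∣xy∣ k (z ℕ.+ w))) refl))
      where
      ∣xy∣ = ℕ.∣ x - y ∣
      shift : ∀ {j u} → x ℕ.+ j ≤ y ℕ.+ u → ∣xy∣ ℕ.+ j ≤ u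
      shift {j} le = ≤-cancel y le (trans (cong (ℕ._+ j) (sym (ℕ.m+[n∸m]≡n y≤x))) (trans (ℕ.+-assoc y _ j) (cong (λ v → y ℕ.+ (v ℕ.+ j)) (sym (trans (ℕ.∣-∣-comm x y) (ℕ.m≤n⇒∣m-n∣≡n∸m y≤x)))))) refl

    ≤⇒Fits : ∀ {k} x y z w → z ℕ.+ w ≤ t → lower x y ℕ.+ k ≤ upper z w → Fits k x y z w
    ≤⇒Fits {k} x y z w z+w≤t le = go₁ x≤ , go₁ y≤ , go₂ x≤ , go₂ y≤
      where
      d = ℕ.∣ x - y ∣
      x≤ = ℕ.m≤n+∣m-n∣ x y
      y≤ : y ≤ x ℕ.+ d
      y≤ = ≤-cast (ℕ.m≤n+∣m-n∣ y x) refl (cong (x ℕ.+_) (ℕ.∣-∣-comm y x))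
      go₁ : ∀ {u v} → u ≤ v ℕ.+ d → u ℕ.+ k ≤ v ℕ.+ (z ℕ.+ w)
      go₁ {u} {v} u≤ = ℕ.≤-trans (ℕ.+-monoˡ-≤ k u≤) (≤-cast (+-monoʳ v (ℕ.≤-trans le (ℕ.m⊓n≤m _ _))) (sym (ℕ.+-assoc v d k)) refl)
      reassoc : ∀ v d k s → v ℕ.+ (d ℕ.+ k ℕ.+ s) ≡ v ℕ.+ d ℕ.+ k ℕ.+ s
      reassoc = nat-solve-∀
      go₂ : ∀ {u v} → u ≤ v ℕ.+ d → u ℕ.+ k ℕ.+ (z ℕ.+ w) ≤ v ℕ.+ t
      go₂ {u} {v} u≤ = ℕ.≤-trans (ℕ.+-monoˡ-≤ (z ℕ.+ w) (ℕ.+-monoˡ-≤ k u≤))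
        (≤-cast (+-monoʳ v (ℕ.m≤o∸n⇒m+n≤o (d ℕ.+ k) z+w≤t (ℕ.≤-trans le (ℕ.m⊓n≤n _ _)))) (reassoc v d k (z ℕ.+ w)) refl)

    -- Comparing the bounds of a pair with each other splits into one condition per label; therefore
    -- these conditions survive a change of pairing.
    Half : ℕ → ℕ → Set
    Half k x = k ≤ x ℕ.+ x × k ℕ.+ (x ℕ.+ x) ≤ t

    Fits⇒Half : ∀ {k} x y → Fits k x y x y → Half k x × Half k y
    Fits⇒Half {k} x y (p , q , r , s) =
      (≤-cancel y q refl (nat-solve (x ∷ y ∷ [])) , ≤-cancel y r (nat-solve (x ∷ y ∷ k ∷ [])) refl) ,
      (≤-cancel x p refl (nat-solve (x ∷ y ∷ [])) , ≤-cancel x s (nat-solve (x ∷ y ∷ k ∷ [])) refl)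

    Half⇒Fits : ∀ {k} x y → Half k x → Half k y → Fits k x y x y
    Half⇒Fits {k} x y (p , q) (r , s) =
      ≤-cast (+-monoʳ x r) refl (nat-solve (x ∷ y ∷ [])) , ≤-cast (+-monoʳ y p) refl (nat-solve (x ∷ y ∷ [])) ,
      ≤-cast (+-monoʳ y q) (nat-solve (x ∷ y ∷ k ∷ [])) refl , ≤-cast (+-monoʳ x s) (nat-solve (x ∷ y ∷ k ∷ [])) refl

    lo hi : ℕ → ℕ → ℕ → ℕ → ℕ
    lo a b c d = lower a b ℕ.⊔ lower c d
    hi a b c d = upper a b ℕ.⊓ upper c d

    -- The differences between the upper and the lower bounds of the interval of
    -- admissible e are 2x, t - 2x, s - 2x and t - s + 2x for x = a, b, c, d and
    -- s = a + b + c + d: a set that does not depend on the pairing.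
    lo+k≤hi : ∀ {a b c d} k → a ℕ.+ b ≤ t → c ℕ.+ d ≤ t → lo a b c d ℕ.+ k ≤ hi a b c d → lo b c a d ℕ.+ k ≤ hi b c a d
    lo+k≤hi {a} {b} {c} {d} k a+b≤t c+d≤t le =
      ≤-cast (ℕ.⊔-lub
        (ℕ.⊓-glb (Fits⇒≤ b c b c (Half⇒Fits b c halfb halfc)) (Fits⇒≤ b c a d
          (≤-cast p₂ refl (nat-solve (a ∷ c ∷ d ∷ [])) , ≤-cast q₁ refl (nat-solve (a ∷ b ∷ d ∷ [])) ,
           ≤-cast q₄ (nat-solve (a ∷ b ∷ d ∷ k ∷ [])) refl , ≤-cast p₃ (nat-solve (a ∷ c ∷ d ∷ k ∷ [])) refl)))
        (ℕ.⊓-glb (Fits⇒≤ a d b c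
          (≤-cast p₁ refl (nat-solve (b ∷ c ∷ d ∷ [])) , ≤-cast q₂ refl (nat-solve (a ∷ b ∷ c ∷ [])) ,
           ≤-cast q₃ (nat-solve (a ∷ b ∷ c ∷ k ∷ [])) refl , ≤-cast p₄ (nat-solve (b ∷ c ∷ d ∷ k ∷ [])) refl)) (Fits⇒≤ a d a d (Half⇒Fits a d halfa halfd)))) (sym (ℕ.+-distribʳ-⊔ k (lower b c) (lower a d))) refl
      where
      le₁ : lower a b ℕ.+ k ≤ hi a b c d
      le₁ = ℕ.≤-trans (ℕ.+-monoˡ-≤ k (ℕ.m≤m⊔n (lower a b) (lower c d))) le
      le₂ : lower c d ℕ.+ k ≤ hi a b c d
      le₂ = ℕ.≤-trans (ℕ.+-monoˡ-≤ k (ℕ.m≤n⊔m (lower a b) (lower c d))) le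
      self₁ = Fits⇒Half a b (≤⇒Fits a b a b a+b≤t (ℕ.≤-trans le₁ (ℕ.m⊓n≤m _ _)))
      self₂ = Fits⇒Half c d (≤⇒Fits c d c d c+d≤t (ℕ.≤-trans le₂ (ℕ.m⊓n≤n _ _)))
      halfa = proj₁ self₁
      halfb = proj₂ self₁
      halfc = proj₁ self₂
      halfd = proj₂ self₂
      abcd : Fits k a b c d
      abcd = ≤⇒Fits a b c d c+d≤t (ℕ.≤-trans le₁ (ℕ.m⊓n≤n _ _))
      cdab : Fits k c d a b
      cdab = ≤⇒Fits c d a b a+b≤t (ℕ.≤-trans le₂ (ℕ.m⊓n≤m _ _))
      p₁ = proj₁ abcd
      p₂ = proj₁ (proj₂ abcd)
      p₃ = proj₁ (proj₂ (proj₂ abcd))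
      p₄ = proj₂ (proj₂ (proj₂ abcd))
      q₁ = proj₁ cdab
      q₂ = proj₁ (proj₂ cdab)
      q₃ = proj₁ (proj₂ (proj₂ cdab))
      q₄ = proj₂ (proj₂ (proj₂ cdab))

    -- The size of the interval from l to u is the number of k with l + k ≤ u.
    size-≤ : ∀ {l u l′ u′} → (∀ k → l ℕ.+ k ≤ u → l′ ℕ.+ k ≤ u′) → suc u ℕ.∸ l ≤ suc u′ ℕ.∸ l′
    size-≤ {l} {u} {l′} {u′} f with l ℕ.≤? u
    ... | yes l≤u = ≤-cast (ℕ.m+n≤o⇒m≤o∸n (suc (u ℕ.∸ l)) (s≤s (≤-cast (f (u ℕ.∸ l) (ℕ.≤-reflexive (ℕ.m+[n∸m]≡n l≤u))) (ℕ.+-comm l′ _) refl))) (sym (ℕ.+-∸-assoc 1 l≤u)) refl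
    ... | no  l≰u = ≤-cast z≤n (sym (ℕ.m≤n⇒m∸n≡0 (ℕ.≰⇒> l≰u))) refl

  N : ℕ → ℕ → ℕ → ℚ
  N a b c = 𝟙 (tri? t a b c)

  N-swap₁₂ : ∀ a b c → N a b c ≡ N b a c
  N-swap₁₂ a b c = 𝟙-cong (Tri-swap₁₂ t a b c) (Tri-swap₁₂ t b a c) (tri? t a b c) (tri? t b a c)

  N-swap₂₃ : ∀ a b c → N a b c ≡ N a c b
  N-swap₂₃ a b c = 𝟙-cong (Tri-swap₂₃ t a b c) (Tri-swap₂₃ t a c b) (tri? t a b c) (tri? t a c b)

  module _ (m : ℕ) (2m≤t : m ℕ.+ m ≤ t) (t≤2m+1 : t ≤ suc (m ℕ.+ m)) where

    private
      +≤t : ∀ {a b} → a ≤ m → b ≤ m → a ℕ.+ b ≤ t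
      +≤t a≤m b≤m = ℕ.≤-trans (ℕ.+-mono-≤ a≤m b≤m) 2m≤t

      half≤m : ∀ {e} → e ℕ.+ e ≤ t → e ≤ m
      half≤m {e} 2e≤t with e ℕ.≤? m
      ... | yes e≤m = e≤m
      ... | no  e≰m = ⊥-elim (ℕ.<-irrefl refl (ℕ.≤-trans (ℕ.≤-trans (ℕ.≤-reflexive (cong suc (sym (ℕ.+-suc m m)))) (ℕ.+-mono-≤ (ℕ.≰⇒> e≰m) (ℕ.≰⇒> e≰m))) (ℕ.≤-trans 2e≤t t≤2m+1)))

      -- The two bounds a + b and t - (a + b) add up to t, so the smaller is at most t / 2. A sum
      -- over labels up to m thus sees the whole interval.
      hi≤m : ∀ {a b c d} → a ≤ m → b ≤ m → hi a b c d ≤ m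
      hi≤m {a} {b} {c} {d} a≤m b≤m = half≤m (ℕ.m≤o∸n⇒m+n≤o h h≤t (ℕ.≤-trans h≤₂ (ℕ.∸-monoʳ-≤ t h≤₁)))
        where
        h = hi a b c d
        h≤₁ : h ≤ a ℕ.+ b
        h≤₁ = ℕ.≤-trans (ℕ.m⊓n≤m _ _) (ℕ.m⊓n≤m _ _)
        h≤₂ : h ≤ t ℕ.∸ (a ℕ.+ b)
        h≤₂ = ℕ.≤-trans (ℕ.m⊓n≤m _ _) (ℕ.m⊓n≤n _ _)
        h≤t = ℕ.≤-trans h≤₁ (+≤t a≤m b≤m)

      ∑-N*N : ∀ {a b c d} → a ≤ m → b ≤ m → c ≤ m → d ≤ m → ∑ (suc m) (λ e → N a b e * N c d e) ≡ # (suc (hi a b c d) ℕ.∸ lo a b c d)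
      ∑-N*N {a} {b} {c} {d} a≤m b≤m c≤m d≤m = trans
        (∑-cong (suc m) λ e _ → trans (𝟙-× (tri? t a b e) (tri? t c d e))
          (𝟙-cong
            (λ { (p , q) → let (l₁ , u₁) = Tri⇒interval a b p; (l₂ , u₂) = Tri⇒interval c d q in ℕ.⊔-lub l₁ l₂ , ℕ.⊓-glb u₁ u₂ })
            (λ { (l , u) →
              interval⇒Tri a b (+≤t a≤m b≤m) (ℕ.≤-trans (ℕ.m≤m⊔n (lower a b) (lower c d)) l , ℕ.≤-trans u (ℕ.m⊓n≤m _ _)) ,
              interval⇒Tri c d (+≤t c≤m d≤m) (ℕ.≤-trans (ℕ.m≤n⊔m (lower a b) (lower c d)) l , ℕ.≤-trans u (ℕ.m⊓n≤n _ _)) })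
            (tri? t a b e ×-dec tri? t c d e) (lo a b c d ℕ.≤? e ×-dec e ℕ.≤? hi a b c d)))
        (∑-interval (suc m) (lo a b c d) (hi a b c d) (s≤s (hi≤m {a} {b} {c} {d} a≤m b≤m)))

    N-associative : ∀ {a b c d} → a ≤ m → b ≤ m → c ≤ m → d ≤ m →
      ∑ (suc m) (λ e → N a b e * N c d e) ≡ ∑ (suc m) (λ e → N b c e * N a d e)
    N-associative {a} {b} {c} {d} a≤m b≤m c≤m d≤m = trans (∑-N*N a≤m b≤m c≤m d≤m)
      (trans (cong #_ (ℕ.≤-antisym
        (size-≤ {lo a b c d} {hi a b c d} {lo b c a d} {hi b c a d} λ k → lo+k≤hi {a} {b} {c} {d} k (+≤t a≤m b≤m) (+≤t c≤m d≤m))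
        -- The change of pairing rotates a, b, c and has order three, so two further rotations give
        -- the reverse inequality.
        (size-≤ {lo b c a d} {hi b c a d} {lo a b c d} {hi a b c d} λ k le → (lo+k≤hi {c} {a} {b} {d} k (+≤t c≤m a≤m) (+≤t b≤m d≤m) (lo+k≤hi {b} {c} {a} {d} k (+≤t b≤m c≤m) (+≤t a≤m d≤m) le)))))
        (sym (∑-N*N b≤m c≤m a≤m d≤m)))

-- Polynomial functions

IsPoly : (ℚ → ℚ) → Set
IsPoly f = Σ Poly λ p → ∀ x → evalPoly p x ≡ f x

poly-ext : ∀ {f g} → (∀ x → f x ≡ g x) → IsPoly f → IsPoly g
poly-ext f≗g (p , eq) = p , λ x → trans (eq x) (f≗g x)

poly-const : ∀ c → IsPoly (λ _ → c)
poly-const c = c ∷ [] , λ x → trans (evalPoly-∷ c [] x) (trans (cong (c +_) (zeroʳ x)) (+-identityʳ c))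

poly-id : IsPoly (λ x → x)
poly-id = 0ℚ ∷ 1ℚ ∷ [] , λ x → trans (evalPoly-∷ 0ℚ (1ℚ ∷ []) x)
  (trans (+-identityˡ _) (trans (cong (x *_) (proj₂ (poly-const 1ℚ) x)) (*-identityʳ x)))

private
  addPoly : Poly → Poly → Poly
  addPoly []      q       = q
  addPoly (a ∷ p) []      = a ∷ p
  addPoly (a ∷ p) (b ∷ q) = a + b ∷ addPoly p q

  eval-add : ∀ p q x → evalPoly (addPoly p q) x ≡ evalPoly p x + evalPoly q x
  eval-add []      q       x = sym (+-identityˡ _)
  eval-add (a ∷ p) []      x = sym (+-identityʳ _)
  eval-add (a ∷ p) (b ∷ q) x = begin
    evalPoly (a + b ∷ addPoly p q) x                     ≡⟨ evalPoly-∷ (a + b) (addPoly p q) x ⟩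
    a + b + x * evalPoly (addPoly p q) x                 ≡⟨ cong (λ e → a + b + x * e) (eval-add p q x) ⟩
    a + b + x * (evalPoly p x + evalPoly q x)            ≡⟨ solve 5 (λ a b x p q → a :+ b :+ x :* (p :+ q) := (a :+ x :* p) :+ (b :+ x :* q)) refl a b x _ _ ⟩
    (a + x * evalPoly p x) + (b + x * evalPoly q x)      ≡⟨ cong₂ _+_ (evalPoly-∷ a p x) (evalPoly-∷ b q x) ⟨
    evalPoly (a ∷ p) x + evalPoly (b ∷ q) x              ∎
    where open ≡-Reasoning

poly-+ : ∀ {f g} → IsPoly f → IsPoly g → IsPoly (λ x → f x + g x)
poly-+ (p , fp) (q , gq) = addPoly p q , λ x → trans (eval-add p q x) (cong₂ _+_ (fp x) (gq x))

private
  scalePoly : ∀ {f} c → IsPoly f → IsPoly (λ x → c * f x)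
  scalePoly c (p , eq) = map-c p , λ x → trans (go p x) (cong (c *_) (eq x))
    where
    map-c : Poly → Poly
    map-c []      = []
    map-c (a ∷ p) = c * a ∷ map-c p
    go : ∀ p x → evalPoly (map-c p) x ≡ c * evalPoly p x
    go []      x = sym (zeroʳ c)
    go (a ∷ p) x = trans (evalPoly-∷ (c * a) (map-c p) x) (trans (cong (λ e → c * a + x * e) (go p x))
      (trans (solve 4 (λ c a x e → c :* a :+ x :* (c :* e) := c :* (a :+ x :* e)) refl c a x _) (cong (c *_) (sym (evalPoly-∷ a p x)))))

  shiftPoly : ∀ {f} → IsPoly f → IsPoly (λ x → x * f x)
  shiftPoly (p , eq) = 0ℚ ∷ p , λ x → trans (evalPoly-∷ 0ℚ p x) (trans (+-identityˡ _) (cong (x *_) (eq x)))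

poly-* : ∀ {f g} → IsPoly f → IsPoly g → IsPoly (λ x → f x * g x)
poly-* {f} {g} (p , fp) gq = poly-ext (λ x → cong (_* g x) (fp x)) (go p)
  where
  go : ∀ p → IsPoly (λ x → evalPoly p x * g x)
  go []      = poly-ext (λ x → sym (zeroˡ _)) (poly-const 0ℚ)
  go (a ∷ p) = poly-ext
    (λ x → trans (solve 4 (λ a x e y → a :* y :+ x :* (e :* y) := (a :+ x :* e) :* y) refl a x (evalPoly p x) (g x)) (cong (_* g x) (sym (evalPoly-∷ a p x))))
    (poly-+ (scalePoly a gq) (shiftPoly (go p)))

poly-∘ : ∀ {f g} → IsPoly f → IsPoly g → IsPoly (λ x → f (g x))
poly-∘ {f} {g} (p , fp) gq = poly-ext (λ x → fp (g x)) (go p)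
  where
  go : ∀ p → IsPoly (λ x → evalPoly p (g x))
  go []      = poly-const 0ℚ
  go (a ∷ p) = poly-ext (λ x → sym (evalPoly-∷ a p (g x))) (poly-+ (poly-const a) (poly-* gq (go p)))

poly-neg : ∀ {f} → IsPoly f → IsPoly (λ x → - f x)
poly-neg {f} fp = poly-ext (λ x → solve 1 (λ y → (:- :# 1) :* y := :- y) refl (f x)) (poly-* (poly-const (- # 1)) fp)

*-zeroʳ : ∀ x {y} → y ≡ 0ℚ → x * y ≡ 0ℚ
*-zeroʳ x refl = zeroʳ x

#suc≢0 : ∀ n → # (suc n) ≢ 0ℚ
#suc≢0 n eq with #-injective (trans eq (sym ι-0))
... | ()

-- The inverse of n + 1, which makes it total: `recip 1` is one half, `recip 3` one quarter.
recip : ℕ → ℚ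
recip n = proj₁ (inverse (# (suc n)) (#suc≢0 n))

*-recip : ∀ n → # (suc n) * recip n ≡ 1ℚ
*-recip n = proj₂ (inverse (# (suc n)) (#suc≢0 n))

*-cancel : ∀ {c x y} → c ≢ 0ℚ → c * x ≡ c * y → x ≡ y
*-cancel {c} {x} {y} c≢0 eq = trans (sym (undo x)) (trans (cong (r *_) eq) (undo y))
  where
  r = proj₁ (inverse c c≢0)
  undo : ∀ x → r * (c * x) ≡ x
  undo x = trans (solve 3 (λ r c x → r :* (c :* x) := c :* r :* x) refl r c x) (trans (cong (_* x) (proj₂ (inverse c c≢0))) (*-identityˡ x))

-- Central second differences with step 2

Δ² : (ℚ → ℚ) → ℚ → ℚ
Δ² Φ X = Φ (X + # 2) + Φ (X - # 2) - # 2 * Φ X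

-- A seed of the central factorials G₀ (X² - ν₀²) (X² - (ν₀ + 2)²) ⋯ of a fixed parity:
-- either ν₀ = 0 and G₀ = 1, or ν₀ = 1 and G₀ is proportional to X.
record Seed : Set where
  field
    ν₀       : ℕ
    s        : ℚ
    G₀       : ℚ → ℚ
    s²       : s * s ≡ 1ℚ
    poly     : IsPoly G₀
    parity   : ∀ X → G₀ (- X) ≡ s * G₀ X
    harmonic : ∀ X → Δ² G₀ X ≡ 0ℚ
    euler    : ∀ X → X * (G₀ (X + # 2) - G₀ (X - # 2)) ≡ # 4 * # ν₀ * G₀ X
    ν₀∈01    : # ν₀ * (# ν₀ - # 1) ≡ 0ℚ

module CentralFactorial (seed : Seed) where

  open Seed seed

  -- Two roles at once: `ν k` is the degree of `G k`, and ± `ν k` are the roots added next.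
  ν : ℕ → ℕ
  ν zero    = ν₀
  ν (suc k) = 2 ℕ.+ ν k

  G : ℕ → ℚ → ℚ
  G zero    = G₀
  G (suc k) X = (X * X - # (ν k) * # (ν k)) * G k X

  private
    -- For Φ of degree n, `Inv₁` is the lowering rule for Δ², multiplied by the last factor so that
    -- the predecessor of Φ is not mentioned. `Inv₂` is a discrete form of Euler's identity X Φ′ = n
    -- Φ with a correction in Δ²Φ. Neither passes from n to n + 2 without the other.
    Inv₁ Inv₂ : ℚ → (ℚ → ℚ) → Set
    Inv₁ n Φ = ∀ X → (X * X - (n - # 2) * (n - # 2)) * Δ² Φ X ≡ # 4 * n * (n - # 1) * Φ X
    Inv₂ n Φ = ∀ X → X * (Φ (X + # 2) - Φ (X - # 2)) ≡ # 4 * n * Φ X + (n - # 2) * Δ² Φ X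

    -- The product rule for Δ² leaves a second and a first difference of Φ; one invariant eliminates
    -- each.
    Δ²-step : ∀ n Φ → Inv₁ n Φ → Inv₂ n Φ → ∀ X →
      Δ² (λ Y → (Y * Y - n * n) * Φ Y) X ≡ # 4 * (n + # 1) * (n + # 2) * Φ X
    Δ²-step n Φ inv₁ inv₂ X = begin
      Δ² (λ Y → (Y * Y - n * n) * Φ Y) X
        ≡⟨ solve 5 (λ X n p q g →
             let D = p :+ q :- :# 2 :* g in
             ((X :+ :# 2) :* (X :+ :# 2) :- n :* n) :* p :+ ((X :- :# 2) :* (X :- :# 2) :- n :* n) :* q :- :# 2 :* ((X :* X :- n :* n) :* g)
             := (X :* X :- (n :- :# 2) :* (n :- :# 2)) :* D :+ :# 4 :* (X :* (p :- q)) :+ ((n :- :# 2) :* (n :- :# 2) :* D :+ :# 4 :* D :+ :# 8 :* g :- n :* n :* D))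
           refl X n (Φ (X + # 2)) (Φ (X - # 2)) (Φ X) ⟩
      (X * X - (n - # 2) * (n - # 2)) * D + # 4 * (X * (Φ (X + # 2) - Φ (X - # 2))) + rest
        ≡⟨ cong₂ (λ a b → a + # 4 * b + rest) (inv₁ X) (inv₂ X) ⟩
      # 4 * n * (n - # 1) * Φ X + # 4 * (# 4 * n * Φ X + (n - # 2) * D) + rest
        ≡⟨ solve 3 (λ n g D → :# 4 :* n :* (n :- :# 1) :* g :+ :# 4 :* (:# 4 :* n :* g :+ (n :- :# 2) :* D) :+ ((n :- :# 2) :* (n :- :# 2) :* D :+ :# 4 :* D :+ :# 8 :* g :- n :* n :* D)
             := :# 4 :* (n :+ :# 1) :* (n :+ :# 2) :* g) refl n (Φ X) D ⟩
      # 4 * (n + # 1) * (n + # 2) * Φ X ∎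
      where
      open ≡-Reasoning
      D = Δ² Φ X
      rest = (n - # 2) * (n - # 2) * D + # 4 * D + # 8 * Φ X - n * n * D

    inv₁-step : ∀ n Φ → Inv₁ n Φ → Inv₂ n Φ → Inv₁ (# 2 + n) (λ Y → (Y * Y - n * n) * Φ Y)
    inv₁-step n Φ inv₁ inv₂ X = trans
      (cong ((X * X - (# 2 + n - # 2) * (# 2 + n - # 2)) *_) (Δ²-step n Φ inv₁ inv₂ X))
      (solve 3 (λ X n g → (X :* X :- (:# 2 :+ n :- :# 2) :* (:# 2 :+ n :- :# 2)) :* (:# 4 :* (n :+ :# 1) :* (n :+ :# 2) :* g)
        := :# 4 :* (:# 2 :+ n) :* (:# 2 :+ n :- :# 1) :* ((X :* X :- n :* n) :* g)) refl X n (Φ X))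

    inv₂-step : ∀ n Φ → Inv₁ n Φ → Inv₂ n Φ → Inv₂ (# 2 + n) (λ Y → (Y * Y - n * n) * Φ Y)
    inv₂-step n Φ inv₁ inv₂ X = begin
      X * (((X + # 2) * (X + # 2) - n * n) * Φ (X + # 2) - ((X - # 2) * (X - # 2) - n * n) * Φ (X - # 2))
        ≡⟨ solve 5 (λ X n p q g →
             let D = p :+ q :- :# 2 :* g in
             X :* (((X :+ :# 2) :* (X :+ :# 2) :- n :* n) :* p :- ((X :- :# 2) :* (X :- :# 2) :- n :* n) :* q)
             := (X :* X :+ :# 4 :- n :* n) :* (X :* (p :- q)) :+ :# 4 :* X :* X :* (D :+ :# 2 :* g))
           refl X n (Φ (X + # 2)) (Φ (X - # 2)) (Φ X) ⟩
      (X * X + # 4 - n * n) * (X * (Φ (X + # 2) - Φ (X - # 2))) + # 4 * X * X * (D + # 2 * Φ X)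
        ≡⟨ cong (λ b → (X * X + # 4 - n * n) * b + # 4 * X * X * (D + # 2 * Φ X)) (inv₂ X) ⟩
      (X * X + # 4 - n * n) * (# 4 * n * Φ X + (n - # 2) * D) + # 4 * X * X * (D + # 2 * Φ X)
        ≡⟨ solve 4 (λ X n g D → (X :* X :+ :# 4 :- n :* n) :* (:# 4 :* n :* g :+ (n :- :# 2) :* D) :+ :# 4 :* X :* X :* (D :+ :# 2 :* g)
             := (n :+ :# 2) :* ((X :* X :- (n :- :# 2) :* (n :- :# 2)) :* D) :+ ((X :* X :+ :# 4 :- n :* n) :* (:# 4 :* n :* g) :+ :# 8 :* X :* X :* g))
           refl X n (Φ X) D ⟩
      (n + # 2) * ((X * X - (n - # 2) * (n - # 2)) * D) + rest
        ≡⟨ cong (λ a → (n + # 2) * a + rest) (inv₁ X) ⟩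
      (n + # 2) * (# 4 * n * (n - # 1) * Φ X) + rest
        ≡⟨ solve 3 (λ X n g → (n :+ :# 2) :* (:# 4 :* n :* (n :- :# 1) :* g) :+ ((X :* X :+ :# 4 :- n :* n) :* (:# 4 :* n :* g) :+ :# 8 :* X :* X :* g)
             := :# 4 :* (:# 2 :+ n) :* ((X :* X :- n :* n) :* g) :+ (:# 2 :+ n :- :# 2) :* (:# 4 :* (n :+ :# 1) :* (n :+ :# 2) :* g))
           refl X n (Φ X) ⟩
      # 4 * (# 2 + n) * ((X * X - n * n) * Φ X) + (# 2 + n - # 2) * (# 4 * (n + # 1) * (n + # 2) * Φ X)
        ≡⟨ cong (λ d → # 4 * (# 2 + n) * ((X * X - n * n) * Φ X) + (# 2 + n - # 2) * d) (Δ²-step n Φ inv₁ inv₂ X) ⟨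
      # 4 * (# 2 + n) * ((X * X - n * n) * Φ X) + (# 2 + n - # 2) * Δ² (λ Y → (Y * Y - n * n) * Φ Y) X ∎
      where
      open ≡-Reasoning
      D = Δ² Φ X
      rest = (X * X + # 4 - n * n) * (# 4 * n * Φ X) + # 8 * X * X * Φ X

    invs : ∀ k → Inv₁ (# (ν k)) (G k) × Inv₂ (# (ν k)) (G k)
    invs zero = (λ X → trans (*-zeroʳ (X * X - (# ν₀ - # 2) * (# ν₀ - # 2)) (harmonic X)) (sym (trans (cong (_* G₀ X) (trans (*-assoc (# 4) _ _) (trans (cong (# 4 *_) ν₀∈01) (zeroʳ (# 4))))) (zeroˡ (G₀ X)))))
      , (λ X → trans (euler X) (sym (trans (cong (# 4 * # ν₀ * G₀ X +_) (*-zeroʳ (# ν₀ - # 2) (harmonic X))) (+-identityʳ _))))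
    invs (suc k) with invs k
    ... | inv₁ , inv₂ = subst (λ n → Inv₁ n (G (suc k))) (sym (#-+ 2 (ν k))) (inv₁-step (# (ν k)) (G k) inv₁ inv₂)
                      , subst (λ n → Inv₂ n (G (suc k))) (sym (#-+ 2 (ν k))) (inv₂-step (# (ν k)) (G k) inv₁ inv₂)

    -- `recip` inverts a successor, hence the predecessor of 4 (ν + 1) (ν + 2).
    weight : ℕ → ℕ
    weight k = ℕ.pred (4 ℕ.* (suc (ν k) ℕ.* suc (suc (ν k))))

    κ : ℕ → ℚ
    κ k = recip (weight k)

    *κ : ∀ k → # 4 * (# (ν k) + # 1) * (# (ν k) + # 2) * κ k ≡ 1ℚ
    *κ k = trans (cong (_* κ k) (sym (trans (trans (#-* 4 _) (cong (# 4 *_) (trans (#-* (suc (ν k)) _) (cong₂ _*_ (#-+ 1 (ν k)) (#-+ 2 (ν k))))))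
      (solve 1 (λ n → :# 4 :* ((:# 1 :+ n) :* (:# 2 :+ n)) := :# 4 :* (n :+ :# 1) :* (n :+ :# 2)) refl (# (ν k)))))) (*-recip (weight k))

  Δ²-G : ∀ k X → Δ² (G (suc k)) X ≡ # 4 * (# (ν k) + # 1) * (# (ν k) + # 2) * G k X
  Δ²-G k = Δ²-step (# (ν k)) (G k) (proj₁ (invs k)) (proj₂ (invs k))

  G-parity : ∀ k X → G k (- X) ≡ s * G k X
  G-parity zero    X = parity X
  G-parity (suc k) X = trans (cong (((- X) * (- X) - # (ν k) * # (ν k)) *_) (G-parity k X))
    (solve 4 (λ X n s g → ((:- X) :* (:- X) :- n :* n) :* (s :* g) := s :* ((X :* X :- n :* n) :* g)) refl X (# (ν k)) s (G k X))

  G-poly : ∀ k → IsPoly (G k)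
  G-poly zero    = poly
  G-poly (suc k) = poly-* (poly-+ (poly-* poly-id poly-id) (poly-const _)) (G-poly k)

  -- A list of coefficients c₀, c₁, … depending polynomially on a parameter μ
  -- represents the function Σ cⱼ(μ) G(k + j) of X.
  Coeffs : Set
  Coeffs = List (Σ (ℚ → ℚ) IsPoly)

  ev : ℕ → Coeffs → ℚ → ℚ → ℚ
  ev k []             μ X = 0ℚ
  ev k ((c , _) ∷ cs) μ X = c μ * G k X + ev (suc k) cs μ X

  ev-poly : ∀ k cs {y} → IsPoly y → IsPoly (λ μ → ev k cs μ (y μ))
  ev-poly k []             y = poly-const 0ℚ
  ev-poly k ((c , p) ∷ cs) y = poly-+ (poly-* p (poly-∘ (G-poly k) y)) (ev-poly (suc k) cs y)

  ev-parity : ∀ k cs μ X → ev k cs μ (- X) ≡ s * ev k cs μ X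
  ev-parity k []             μ X = sym (zeroʳ s)
  ev-parity k ((c , p) ∷ cs) μ X = trans (cong₂ _+_ (cong (c μ *_) (G-parity k X)) (ev-parity (suc k) cs μ X))
    (solve 4 (λ s c g e → c :* (s :* g) :+ s :* e := s :* (c :* g :+ e)) refl s (c μ) (G k X) _)

  -- Raising every index by one undoes the lowering rule up to its factor; the sign is that of the
  -- operator -Δ².
  antidiff : ℕ → Coeffs → Coeffs
  antidiff k []             = []
  antidiff k ((c , p) ∷ cs) = ((λ μ → - κ k * c μ) , poly-* (poly-const (- κ k)) p) ∷ antidiff (suc k) cs

  scale : Σ (ℚ → ℚ) IsPoly → Coeffs → Coeffs
  scale d []                    = []
  scale (d , q) ((c , p) ∷ cs) = ((λ μ → d μ * c μ) , poly-* q p) ∷ scale (d , q) cs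

  ev-scale : ∀ d k cs μ X → ev k (scale d cs) μ X ≡ proj₁ d μ * ev k cs μ X
  ev-scale d k []             μ X = sym (zeroʳ _)
  ev-scale d k ((c , p) ∷ cs) μ X = trans (cong (proj₁ d μ * c μ * G k X +_) (ev-scale d (suc k) cs μ X))
    (solve 4 (λ d c g e → d :* c :* g :+ d :* e := d :* (c :* g :+ e)) refl (proj₁ d μ) (c μ) (G k X) _)

  Δ²-antidiff : ∀ k cs μ X → Δ² (ev (suc k) (antidiff k cs) μ) X ≡ - ev k cs μ X
  Δ²-antidiff k []             μ X = subst (λ z → z + z - # 2 * z ≡ - z) ι-0 (solve 0 (con ℤ.0ℤ :+ con ℤ.0ℤ :- :# 2 :* con ℤ.0ℤ := :- con ℤ.0ℤ) refl)
  Δ²-antidiff k ((c , p) ∷ cs) μ X = begin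
    Δ² (λ Y → - κ k * c μ * G (suc k) Y + E Y) X
      ≡⟨ solve 7 (λ a p q g p′ q′ g′ → (a :* p :+ p′) :+ (a :* q :+ q′) :- :# 2 :* (a :* g :+ g′) := a :* (p :+ q :- :# 2 :* g) :+ (p′ :+ q′ :- :# 2 :* g′)) refl
         (- κ k * c μ) (G (suc k) (X + # 2)) (G (suc k) (X - # 2)) (G (suc k) X) (E (X + # 2)) (E (X - # 2)) (E X) ⟩
    - κ k * c μ * Δ² (G (suc k)) X + Δ² E X
      ≡⟨ cong₂ (λ a b → - κ k * c μ * a + b) (Δ²-G k X) (Δ²-antidiff (suc k) cs μ X) ⟩
    - κ k * c μ * (w * G k X) + - ev (suc k) cs μ X
      ≡⟨ solve 5 (λ K c w g e → :- K :* c :* (w :* g) :+ :- e := :- (w :* K :* (c :* g) :+ e)) refl (κ k) (c μ) w (G k X) _ ⟩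
    - (w * κ k * (c μ * G k X) + ev (suc k) cs μ X)
      ≡⟨ cong (λ a → - (a + ev (suc k) cs μ X)) (trans (cong (_* (c μ * G k X)) (*κ k)) (*-identityˡ _)) ⟩
    - (c μ * G k X + ev (suc k) cs μ X) ∎
    where
    open ≡-Reasoning
    E = ev (suc (suc k)) (antidiff (suc k) cs) μ
    w = # 4 * (# (ν k) + # 1) * (# (ν k) + # 2)

  -- Iterated solution of -Δ²F′ = (u · ∂G₀) F with ∂F′ = 0, for the boundary
  -- functional ∂Φ = Φ(x₀ - 2) + b Φ(x₀).  With -Δ²H = F the solution is
  -- u (∂G₀ · H - ∂H · G₀), so that no division by ∂G₀ is needed.
  module Boundary (u b : ℚ) (x₀ : ℚ → ℚ) (x₀-poly : IsPoly x₀) where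

    ∂ : (ℚ → ℚ) → ℚ → ℚ
    ∂ Φ μ = Φ (x₀ μ - # 2) + b * Φ (x₀ μ)

    private
      ∂-poly : ∀ (Φ : ℚ → ℚ → ℚ) → (∀ {y} → IsPoly y → IsPoly (λ μ → Φ μ (y μ))) → IsPoly (λ μ → ∂ (Φ μ) μ)
      ∂-poly Φ Φ-poly = poly-+ (Φ-poly (poly-+ x₀-poly (poly-const _))) (poly-* (poly-const b) (Φ-poly x₀-poly))

      H : Coeffs → ℚ → ℚ → ℚ
      H cs = ev 1 (antidiff 0 cs)

      -- The coefficient of `G₀` can be chosen freely because `G₀` is harmonic; the choice makes the
      -- boundary functional vanish.
      next : Coeffs → Coeffs
      next cs = ((λ μ → - (u * ∂ (H cs μ) μ)) , poly-neg (poly-* (poly-const u) (∂-poly (H cs) (ev-poly 1 (antidiff 0 cs)))))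
        ∷ scale ((λ μ → u * ∂ G₀ μ) , poly-* (poly-const u) (∂-poly (λ _ → G₀) (poly-∘ poly))) (antidiff 0 cs)

      ev-next : ∀ cs μ X → ev 0 (next cs) μ X ≡ - (u * ∂ (H cs μ) μ) * G₀ X + u * ∂ G₀ μ * H cs μ X
      ev-next cs μ X = cong (- (u * ∂ (H cs μ) μ) * G₀ X +_) (ev-scale ((λ μ → u * ∂ G₀ μ) , _) 1 (antidiff 0 cs) μ X)

      coeffs : ℕ → Coeffs
      coeffs zero    = ((λ _ → 1ℚ) , poly-const 1ℚ) ∷ []
      coeffs (suc n) = next (coeffs n)

    family : ℕ → ℚ → ℚ → ℚ
    family n = ev 0 (coeffs n)

    family-zero : ∀ μ X → family 0 μ X ≡ G₀ X
    family-zero μ X = trans (+-identityʳ _) (*-identityˡ _)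

    family-poly : ∀ n {y} → IsPoly y → IsPoly (λ μ → family n μ (y μ))
    family-poly n = ev-poly 0 (coeffs n)

    family-parity : ∀ n μ X → family n μ (- X) ≡ s * family n μ X
    family-parity n = ev-parity 0 (coeffs n)

    Δ²-family : ∀ n μ X → Δ² (family (suc n) μ) X ≡ - (u * ∂ G₀ μ * family n μ X)
    Δ²-family n μ X = begin
      Δ² (family (suc n) μ) X
        ≡⟨ cong₂ _+_ (cong₂ _+_ (ev-next cs μ _) (ev-next cs μ _)) (cong (λ e → - (# 2 * e)) (ev-next cs μ X)) ⟩
      Δ² (λ Y → a * G₀ Y + d * h Y) X
        ≡⟨ solve 8 (λ a d p q g p′ q′ g′ → (a :* p :+ d :* p′) :+ (a :* q :+ d :* q′) :- :# 2 :* (a :* g :+ d :* g′) := a :* (p :+ q :- :# 2 :* g) :+ d :* (p′ :+ q′ :- :# 2 :* g′)) refl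
          a d (G₀ (X + # 2)) (G₀ (X - # 2)) (G₀ X) (h (X + # 2)) (h (X - # 2)) (h X) ⟩
      a * Δ² G₀ X + d * Δ² h X
        ≡⟨ cong₂ (λ x y → a * x + d * y) (harmonic X) (Δ²-antidiff 0 cs μ X) ⟩
      a * 0ℚ + d * - family n μ X
        ≡⟨ trans (cong (_+ d * - family n μ X) (zeroʳ a)) (trans (+-identityˡ _) (solve 2 (λ d f → d :* :- f := :- (d :* f)) refl d _)) ⟩
      - (d * family n μ X) ∎
      where
      open ≡-Reasoning
      cs = coeffs n
      h = H cs μ
      a = - (u * ∂ h μ)
      d = u * ∂ G₀ μ

    ∂-family : ∀ n μ → ∂ (family (suc n) μ) μ ≡ 0ℚ
    ∂-family n μ = trans (cong₂ (λ x y → x + b * y) (ev-next cs μ _) (ev-next cs μ _)) (trans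
      (solve 6 (λ u b p q p′ q′ →
        let bg = p :+ b :* q ; bh = p′ :+ b :* q′ in
        (:- (u :* bh) :* p :+ u :* bg :* p′) :+ b :* (:- (u :* bh) :* q :+ u :* bg :* q′) := con ℤ.0ℤ) refl
        u b (G₀ (x₀ μ - # 2)) (G₀ (x₀ μ)) (H cs μ (x₀ μ - # 2)) (H cs μ (x₀ μ))) ι-0)
      where cs = coeffs n

-- The fusion algebra

module FusionAlgebra (t m : ℕ) (2m≤t : m ℕ.+ m ≤ t) (t≤2m+1 : t ≤ suc (m ℕ.+ m)) where

  open Fusion t public

  infix  4 _≈_
  infixl 7 _∙_
  infixr 8 _·_
  infixl 6 _⊞_

  -- Elements are coefficient vectors; only the entries up to m are meaningful.
  _≈_ : (ℕ → ℚ) → (ℕ → ℚ) → Set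
  f ≈ g = ∀ a → a ≤ m → f a ≡ g a

  S : (ℕ → ℚ) → ℚ
  S = ∑ (suc m)

  S-cong : ∀ {f g} → f ≈ g → S f ≡ S g
  S-cong eq = ∑-cong (suc m) λ { a (s≤s a≤m) → eq a a≤m }

  S-δ : ∀ {i} f → i ≤ m → S (λ j → δ i j * f j) ≡ f i
  S-δ {i} f i≤m = ∑-δ (suc m) i f (s≤s i≤m)

  _∙_ : (ℕ → ℚ) → (ℕ → ℚ) → ℕ → ℚ
  (f ∙ g) c = S λ a → S λ b → f a * (g b * N a b c)

  _·_ : ℚ → (ℕ → ℚ) → ℕ → ℚ
  (r · f) a = r * f a

  _⊞_ : (ℕ → ℚ) → (ℕ → ℚ) → ℕ → ℚ
  (f ⊞ g) a = f a + g a

  ε : (ℕ → ℚ) → ℚ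
  ε f = f 0

  𝟘 : ℕ → ℚ
  𝟘 _ = 0ℚ

  ≈-refl : ∀ {f} → f ≈ f
  ≈-refl a _ = refl

  ≈-sym : ∀ {f g} → f ≈ g → g ≈ f
  ≈-sym p a a≤m = sym (p a a≤m)

  ≈-trans : ∀ {f g h} → f ≈ g → g ≈ h → f ≈ h
  ≈-trans p q a a≤m = trans (p a a≤m) (q a a≤m)

  ⊞-cong : ∀ {f f′ g g′} → f ≈ f′ → g ≈ g′ → f ⊞ g ≈ f′ ⊞ g′
  ⊞-cong p q a a≤m = cong₂ _+_ (p a a≤m) (q a a≤m)

  ·-cong : ∀ {r f f′} → f ≈ f′ → r · f ≈ r · f′
  ·-cong {r} p a a≤m = cong (r *_) (p a a≤m)

  ∙-cong : ∀ {f f′ g g′} → f ≈ f′ → g ≈ g′ → f ∙ g ≈ f′ ∙ g′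
  ∙-cong p q c _ = S-cong λ a a≤m → S-cong λ b b≤m → cong₂ _*_ (p a a≤m) (cong (_* N a b c) (q b b≤m))

  ∙-comm : ∀ f g → f ∙ g ≈ g ∙ f
  ∙-comm f g c _ = trans (∑-swap (suc m) (suc m) _)
    (S-cong λ b _ → S-cong λ a _ → trans (cong (λ n → f a * (g b * n)) (N-swap₁₂ a b c))
      (solve 3 (λ x y n → x :* (y :* n) := y :* (x :* n)) refl (f a) (g b) (N b a c)))

  ∙-assoc : ∀ f g h → (f ∙ g) ∙ h ≈ f ∙ (g ∙ h)
  ∙-assoc f g h d d≤m = begin
    (S λ e → S λ c → (f ∙ g) e * (h c * N e c d))
      ≡⟨ (S-cong λ e _ → S-cong λ c _ → trans (sym (∑-*ʳ (suc m) _ _)) (S-cong λ a _ → sym (∑-*ʳ (suc m) _ _))) ⟩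
    (S λ e → S λ c → S λ a → S λ b → L a b c e)
      ≡⟨ trans (S-cong λ e _ → swap) swap ⟩
    (S λ a → S λ e → S λ c → S λ b → L a b c e)
      ≡⟨ (S-cong λ a _ → trans (S-cong λ e _ → swap) (trans swap (S-cong λ b _ → swap))) ⟩
    (S λ a → S λ b → S λ c → S λ e → L a b c e)
      ≡⟨ (S-cong λ a a≤m → S-cong λ b b≤m → S-cong λ c c≤m → core a a≤m b b≤m c c≤m) ⟩
    (S λ a → S λ b → S λ c → S λ e → R a b c e)
      ≡⟨ (S-cong λ a _ → sym (trans swap (S-cong λ b _ → swap))) ⟩
    (S λ a → S λ e → S λ b → S λ c → R a b c e)
      ≡⟨ (S-cong λ a _ → S-cong λ e _ → sym (trans (cong (f a *_) (trans (sym (∑-*ʳ (suc m) _ _)) (S-cong λ b _ → sym (∑-*ʳ (suc m) _ _)))) (trans (sym (∑-*ˡ (suc m) _ _)) (S-cong λ b _ → sym (∑-*ˡ (suc m) _ _))))) ⟩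
    (S λ a → S λ e → f a * ((g ∙ h) e * N a e d)) ∎
    where
    open ≡-Reasoning
    swap : ∀ {F} → S (λ i → S (F i)) ≡ S (λ j → S (λ i → F i j))
    swap {F} = ∑-swap (suc m) (suc m) F
    L R : ℕ → ℕ → ℕ → ℕ → ℚ
    L a b c e = f a * (g b * N a b e) * (h c * N e c d)
    R a b c e = f a * (g b * (h c * N b c e) * N a e d)
    core : ∀ a → a ≤ m → ∀ b → b ≤ m → ∀ c → c ≤ m → S (L a b c) ≡ S (R a b c)
    core a a≤m b b≤m c c≤m = begin
      S (L a b c)
        ≡⟨ (S-cong λ e _ → trans (cong (λ n → f a * (g b * N a b e) * (h c * n)) (trans (N-swap₁₂ e c d) (N-swap₂₃ c e d)))
            (solve 5 (λ x y z n k → x :* (y :* n) :* (z :* k) := x :* y :* z :* (n :* k)) refl (f a) (g b) (h c) (N a b e) (N c d e))) ⟩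
      (S λ e → k * (N a b e * N c d e))  ≡⟨ ∑-*ˡ (suc m) k _ ⟩
      k * S (λ e → N a b e * N c d e)    ≡⟨ cong (k *_) (N-associative m 2m≤t t≤2m+1 a≤m b≤m c≤m d≤m) ⟩
      k * S (λ e → N b c e * N a d e)    ≡⟨ ∑-*ˡ (suc m) k _ ⟨
      (S λ e → k * (N b c e * N a d e))
        ≡⟨ (S-cong λ e _ → trans (solve 5 (λ x y z n k → x :* y :* z :* (n :* k) := x :* (y :* (z :* n) :* k)) refl (f a) (g b) (h c) (N b c e) (N a d e))
            (cong (λ n → f a * (g b * (h c * N b c e) * n)) (N-swap₂₃ a d e))) ⟩
      S (R a b c) ∎
      where k = f a * g b * h c

  private
    a+b≤t : ∀ {a b} → a ≤ m → b ≤ m → a ℕ.+ b ≤ t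
    a+b≤t a≤m b≤m = ℕ.≤-trans (ℕ.+-mono-≤ a≤m b≤m) 2m≤t

  N-0 : ∀ {a b} → a ≤ m → b ≤ m → N a b 0 ≡ δ a b
  N-0 {a} {b} a≤m b≤m = 𝟙-cong
    (λ { (p , q , _) → ℕ.≤-antisym (≤-cast p refl (ℕ.+-identityʳ b)) (≤-cast q refl (ℕ.+-identityʳ a)) })
    (λ { refl → ℕ.m≤m+n a 0 , ℕ.m≤m+n a 0 , z≤n , ≤-cast (a+b≤t a≤m a≤m) (sym (ℕ.+-identityʳ _)) refl })
    (tri? t a b 0) (a ℕ.≟ b)

  δ∙ : ∀ {i} f c → i ≤ m → (δ i ∙ f) c ≡ S λ b → f b * N i b c
  δ∙ {i} f c i≤m = trans (S-cong λ a _ → ∑-*ˡ (suc m) (δ i a) _) (S-δ (λ a → S λ b → f b * N a b c) i≤m)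

  ∙-identityˡ : ∀ f → δ 0 ∙ f ≈ f
  ∙-identityˡ f c c≤m = trans (δ∙ f c z≤n) (trans
    (S-cong λ b b≤m → trans (cong (f b *_) (trans (N-swap₁₂ 0 b c) (trans (N-swap₂₃ b 0 c) (trans (N-0 b≤m c≤m) (δ-sym b c))))) (*-comm (f b) _))
    (S-δ f c≤m))
    where
    δ-sym : ∀ i j → δ i j ≡ δ j i
    δ-sym i j = 𝟙-cong sym sym (i ℕ.≟ j) (j ℕ.≟ i)

  commutativeMonoid : CommutativeMonoid 0ℓ 0ℓ
  commutativeMonoid = record
    { Carrier = ℕ → ℚ ; _≈_ = _≈_ ; _∙_ = _∙_ ; ε = δ 0
    ; isCommutativeMonoid = record
      { isMonoid = record
        { isSemigroup = record
          { isMagma = record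
            { isEquivalence = record { refl = ≈-refl ; sym = ≈-sym ; trans = ≈-trans }
            ; ∙-cong = ∙-cong }
          ; assoc = ∙-assoc }
        ; identity = ∙-identityˡ , λ f → ≈-trans (∙-comm f (δ 0)) (∙-identityˡ f) }
      ; comm = ∙-comm } }

  ε-∙ : ∀ f g → ε (f ∙ g) ≡ S λ a → f a * g a
  ε-∙ f g = S-cong λ a a≤m → trans
    (S-cong λ b b≤m → trans (cong (λ n → f a * (g b * n)) (N-0 a≤m b≤m)) (solve 3 (λ x y d → x :* (y :* d) := d :* (x :* y)) refl (f a) (g b) (δ a b)))
    (S-δ (λ b → f a * g b) a≤m)

  θ Ω : ℕ → ℚ
  θ c = S λ i → N i i c
  Ω _ = 1ℚ

  ε-∙δ : ∀ f {i} → i ≤ m → ε (f ∙ δ i) ≡ f i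
  ε-∙δ f {i} i≤m = trans (ε-∙ f (δ i)) (trans (S-cong λ a _ → *-comm (f a) _) (S-δ f i≤m))

  -- Parseval's identity for the orthonormal basis: summing over the label of an edge between two
  -- parts multiplies their elements.
  contract : ∀ f g → S (λ i → ε (f ∙ δ i) * ε (g ∙ δ i)) ≡ ε (f ∙ g)
  contract f g = trans (S-cong λ i i≤m → cong₂ _*_ (ε-∙δ f i≤m) (ε-∙δ g i≤m)) (sym (ε-∙ f g))

  δ∙δ : ∀ {i j} c → i ≤ m → j ≤ m → (δ i ∙ δ j) c ≡ N i j c
  δ∙δ {i} {j} c i≤m j≤m = trans (δ∙ (δ j) c i≤m) (S-δ (λ b → N i b c) j≤m)

  -- An edge with both ends in the same part inserts the sum of the squares of the basis elements,
  -- which is θ.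
  contract-loop : ∀ f → S (λ i → ε (f ∙ (δ i ∙ δ i))) ≡ ε (f ∙ θ)
  contract-loop f = trans
    (S-cong λ i i≤m → trans (ε-∙ f (δ i ∙ δ i)) (S-cong λ a _ → cong (f a *_) (δ∙δ a i≤m i≤m)))
    (trans (∑-swap (suc m) (suc m) _) (trans (S-cong λ a _ → ∑-*ˡ (suc m) (f a) _) (sym (ε-∙ f θ))))

  ·-∙ : ∀ r f g → (r · f) ∙ g ≈ r · (f ∙ g)
  ·-∙ r f g c _ = trans
    (S-cong λ a _ → trans (S-cong λ b _ → *-assoc r (f a) _) (∑-*ˡ (suc m) r _))
    (∑-*ˡ (suc m) r _)

  ⊞-∙ : ∀ f g h → (f ⊞ g) ∙ h ≈ f ∙ h ⊞ g ∙ h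
  ⊞-∙ f g h c _ = trans
    (S-cong λ a _ → trans (S-cong λ b _ → distribʳ (h b * N a b c) (f a) (g a)) (∑-+ (suc m) _ _))
    (∑-+ (suc m) _ _)

  ∙-· : ∀ r f g → f ∙ (r · g) ≈ r · (f ∙ g)
  ∙-· r f g = ≈-trans (∙-comm f (r · g)) (≈-trans (·-∙ r g f) (·-cong (∙-comm g f)))

  ∙-⊞ : ∀ f g h → f ∙ (g ⊞ h) ≈ f ∙ g ⊞ f ∙ h
  ∙-⊞ f g h = ≈-trans (∙-comm f (g ⊞ h)) (≈-trans (⊞-∙ g h f) (⊞-cong (∙-comm g f) (∙-comm h f)))

  pow : (ℕ → ℚ) → ℕ → ℕ → ℚ
  pow f zero    = δ 0
  pow f (suc n) = f ∙ pow f n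

  ∙-left-comm : ∀ f g h → f ∙ (g ∙ h) ≈ g ∙ (f ∙ h)
  ∙-left-comm f g h = ≈-trans (≈-sym (∙-assoc f g h)) (≈-trans (∙-cong (∙-comm f g) ≈-refl) (∙-assoc g f h))

  𝟘-∙ : ∀ f → 𝟘 ∙ f ≈ 𝟘
  𝟘-∙ f c _ = trans (S-cong λ a _ → trans (S-cong λ b _ → zeroˡ _) (∑-zero (suc m) λ _ _ → refl)) (∑-zero (suc m) λ _ _ → refl)

  -- If y ∙ g = d U, then y ∙ F′ = (u d) F determines F′ as g ∙ F, because
  -- multiplying by g turns y into the element d U, which acts as u d on F′.
  divide : ∀ {y U g F F′ u d} → u ≢ 0ℚ → d ≢ 0ℚ → y ∙ g ≈ d · U → U ∙ F′ ≈ u · F′ → y ∙ F′ ≈ (u * d) · F → F′ ≈ g ∙ F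
  divide {y} {U} {g} {F} {F′} {u} {d} u≢0 d≢0 yg UF′ yF′ c c≤m = *-cancel u≢0 (*-cancel d≢0 (begin
    d * (u * F′ c)           ≡⟨ cong (d *_) (UF′ c c≤m) ⟨
    d * (U ∙ F′) c           ≡⟨ ·-∙ d U F′ c c≤m ⟨
    ((d · U) ∙ F′) c         ≡⟨ ∙-cong (≈-trans (≈-sym yg) (∙-comm y g)) ≈-refl c c≤m ⟩
    ((g ∙ y) ∙ F′) c         ≡⟨ ∙-assoc g y F′ c c≤m ⟩
    (g ∙ (y ∙ F′)) c         ≡⟨ ∙-cong ≈-refl yF′ c c≤m ⟩
    (g ∙ ((u * d) · F)) c    ≡⟨ ∙-· (u * d) g F c c≤m ⟩
    u * d * (g ∙ F) c        ≡⟨ solve 3 (λ u d x → u :* d :* x := d :* (u :* x)) refl u d _ ⟩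
    d * (u * (g ∙ F) c)      ∎))
    where open ≡-Reasoning

  ∙-interchange : ∀ f g h k → (f ∙ g) ∙ (h ∙ k) ≈ (f ∙ h) ∙ (g ∙ k)
  ∙-interchange f g h k = ≈-trans (∙-assoc f g (h ∙ k)) (≈-trans (∙-cong ≈-refl (∙-left-comm g h k)) (≈-sym (∙-assoc f h (g ∙ k))))

  ∙-identityʳ : ∀ f → f ∙ δ 0 ≈ f
  ∙-identityʳ f = ≈-trans (∙-comm f (δ 0)) (∙-identityˡ f)

  pow-cong : ∀ {f g} n → f ≈ g → pow f n ≈ pow g n
  pow-cong zero    p = ≈-refl
  pow-cong (suc n) p = ∙-cong p (pow-cong n p)

  pow-+ : ∀ f a b → pow f (a ℕ.+ b) ≈ pow f a ∙ pow f b
  pow-+ f zero    b = ≈-sym (∙-identityˡ _)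
  pow-+ f (suc a) b = ≈-trans (∙-cong ≈-refl (pow-+ f a b)) (≈-sym (∙-assoc f (pow f a) (pow f b)))

  pow-∙ : ∀ f g n → pow (f ∙ g) n ≈ pow f n ∙ pow g n
  pow-∙ f g zero    = ≈-sym (∙-identityˡ _)
  pow-∙ f g (suc n) = ≈-trans (∙-cong ≈-refl (pow-∙ f g n)) (∙-interchange f g (pow f n) (pow g n))

  pow-· : ∀ r f n → pow (r · f) n ≈ (r ^ n) · pow f n
  pow-· r f zero    a _ = sym (*-identityˡ _)
  pow-· r f (suc n) = ≈-trans (·-∙ r f (pow (r · f) n)) (≈-trans (·-cong (≈-trans (∙-cong ≈-refl (pow-· r f n)) (∙-· (r ^ n) f (pow f n))))
    (λ a _ → sym (*-assoc r (r ^ n) _)))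

𝟙-⊎ : ∀ {P Q R : Set} → (P → Q ⊎ R) → (Q → P) → (R → P) → ¬ (Q × R) → (p : Dec P) (q : Dec Q) (r : Dec R) → 𝟙 p ≡ 𝟙 q + 𝟙 r
𝟙-⊎ f g h ¬qr p (yes q) (yes r) = ⊥-elim (¬qr (q , r))
𝟙-⊎ f g h ¬qr p (yes q) (no ¬r) = trans (𝟙-yes p (g q)) (sym (+-identityʳ 1ℚ))
𝟙-⊎ f g h ¬qr p (no ¬q) (yes r) = trans (𝟙-yes p (h r)) (sym (+-identityˡ 1ℚ))
𝟙-⊎ f g h ¬qr p (no ¬q) (no ¬r) = trans (𝟙-no p (λ x → [ ¬q , ¬r ]′ (f x))) (sym (+-identityˡ 0ℚ))

#-∸ : ∀ {m n} → n ≤ m → # (m ℕ.∸ n) ≡ # m - # n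
#-∸ {m} {n} n≤m = trans (solve 2 (λ x y → x := x :+ y :- y) refl (# (m ℕ.∸ n)) (# n))
  (cong (_- # n) (trans (sym (#-+ (m ℕ.∸ n) n)) (cong #_ (ℕ.m∸n+n≡m n≤m))))

halve : ∀ c → Σ ℕ λ d → c ≡ d ℕ.+ d ⊎ c ≡ suc (d ℕ.+ d)
halve zero = 0 , inj₁ refl
halve (suc c) with halve c
... | d , inj₁ refl = d , inj₂ refl
... | d , inj₂ refl = suc d , inj₁ (cong suc (sym (ℕ.+-suc d d)))

double-≤ : ∀ {x y} → x ℕ.+ x ≤ suc (y ℕ.+ y) → x ≤ y
double-≤ {x} {y} le with x ℕ.≤? y
... | yes x≤y = x≤y
... | no  x≰y = ⊥-elim (ℕ.<-irrefl refl (ℕ.≤-trans (≤-cast (ℕ.+-mono-≤ (ℕ.≰⇒> x≰y) (ℕ.≰⇒> x≰y)) (cong suc (ℕ.+-suc y y)) refl) le))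

double-≤′ : ∀ {x y} → x ℕ.+ x ≤ y ℕ.+ y → x ≤ y
double-≤′ le = double-≤ (ℕ.m≤n⇒m≤1+n le)

double-< : ∀ {x y} → suc (x ℕ.+ x) ≤ y ℕ.+ y → suc x ≤ y
double-< {x} {y} le = double-≤ (≤-cast (s≤s le) (cong suc (sym (ℕ.+-suc x x))) refl)

double-mono : ∀ {x y} → x ≤ y → x ℕ.+ x ≤ y ℕ.+ y
double-mono p = ℕ.+-mono-≤ p p

regroup : ∀ i d → i ℕ.+ i ℕ.+ (d ℕ.+ d) ≡ (i ℕ.+ d) ℕ.+ (i ℕ.+ d)
regroup = nat-solve-∀

regroup-suc : ∀ i d → i ℕ.+ i ℕ.+ suc (d ℕ.+ d) ≡ suc ((i ℕ.+ d) ℕ.+ (i ℕ.+ d))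
regroup-suc = nat-solve-∀

-- The sign in -X makes the odd seed equal to the elements V and W that occur in θ, and its boundary
-- value positive.
evenSeed oddSeed : Seed
evenSeed = record
  { ν₀ = 0 ; s = 1ℚ ; G₀ = λ _ → 1ℚ
  ; s² = *-identityˡ 1ℚ
  ; poly = poly-const 1ℚ
  ; parity = λ _ → sym (*-identityˡ 1ℚ)
  ; harmonic = λ _ → trans (solve 1 (λ x → x :+ x :- :# 2 :* x := con ℤ.0ℤ) refl 1ℚ) ι-0
  ; euler = λ X → trans (cong (X *_) (-‿inverseʳ 1ℚ)) (trans (zeroʳ X) (sym (trans (cong (_* 1ℚ) (trans (cong (# 4 *_) ι-0) (zeroʳ (# 4)))) (zeroˡ 1ℚ))))
  ; ν₀∈01 = trans (cong (_* (# 0 - # 1)) ι-0) (zeroˡ _) }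
oddSeed = record
  { ν₀ = 1 ; s = - # 1 ; G₀ = λ X → - X
  ; s² = trans (solve 0 ((:- :# 1) :* (:- :# 1) := :# 1) refl) ι-1
  ; poly = poly-neg poly-id
  ; parity = λ X → solve 1 (λ X → :- (:- X) := (:- :# 1) :* (:- X)) refl X
  ; harmonic = λ X → trans (solve 1 (λ X → :- (X :+ :# 2) :+ :- (X :- :# 2) :- :# 2 :* (:- X) := con ℤ.0ℤ) refl X) ι-0
  ; euler = λ X → solve 1 (λ X → X :* (:- (X :+ :# 2) :- (:- (X :- :# 2))) := :# 4 :* :# 1 :* (:- X)) refl X
  ; ν₀∈01 = trans (cong (# 1 *_) (-‿inverseʳ (# 1))) (zeroʳ (# 1)) }

-- The position of label 0 for t odd and for t even, extended from μ = m to rational μ so that it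
-- can be substituted into polynomials.
oddStart evenStart : ℚ → ℚ
oddStart μ = - (# 2 * μ) - # 1
evenStart μ = - μ

oddStart-poly : IsPoly oddStart
oddStart-poly = poly-+ (poly-neg (poly-* (poly-const _) poly-id)) (poly-const _)

evenStart-poly : IsPoly evenStart
evenStart-poly = poly-neg poly-id

1ℚ≢0ℚ : 1ℚ ≢ 0ℚ
1ℚ≢0ℚ e = #suc≢0 0 (trans ι-1 e)

-- Odd t

module OddLevel (m : ℕ) where

  open FusionAlgebra (suc (m ℕ.+ m)) m (ℕ.n≤1+n _) ℕ.≤-refl public

  -- Spin 1/2 times the simple current, which brings it back to integer spin: multiplication by K
  -- combines the adjacency of a path with a reflection of the labels.
  K : ℕ → ℚ
  K = δ m

  private
    N-K : ∀ {b c} → b ≤ m → c ≤ m → N m b c ≡ δ (b ℕ.+ c) m + δ (b ℕ.+ c) (suc m)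
    N-K {b} {c} b≤m c≤m = 𝟙-⊎ to
      (λ e → ℕ.≤-reflexive (sym e) , b≤ , c≤ , le (ℕ.m≤n⇒m≤1+n (ℕ.≤-reflexive e)))
      (λ e → ℕ.≤-trans (ℕ.n≤1+n m) (ℕ.≤-reflexive (sym e)) , b≤ , c≤ , le (ℕ.≤-reflexive e))
      (λ { (p , q) → ℕ.1+n≢n (trans (sym q) p) })
      (tri? _ m b c) (b ℕ.+ c ℕ.≟ m) (b ℕ.+ c ℕ.≟ suc m)
      where
      b≤ = ℕ.≤-trans b≤m (ℕ.m≤m+n m c)
      c≤ = ℕ.≤-trans c≤m (ℕ.m≤m+n m b)
      le : b ℕ.+ c ≤ suc m → m ℕ.+ b ℕ.+ c ≤ suc (m ℕ.+ m)
      le p = ≤-cast (+-monoʳ m p) (sym (ℕ.+-assoc m b c)) (ℕ.+-suc m m)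
      to : Tri _ m b c → b ℕ.+ c ≡ m ⊎ b ℕ.+ c ≡ suc m
      to (p , _ , _ , q) with ℕ.m≤n⇒m<n∨m≡n p
      ... | inj₂ e = inj₁ (sym e)
      ... | inj₁ m< = inj₂ (ℕ.≤-antisym (≤-cancel m q (ℕ.+-assoc m b c) (sym (ℕ.+-suc m m))) m<)

    pick : ∀ f c k → c ≤ k → k ℕ.∸ c ≤ m → S (λ b → f b * δ (b ℕ.+ c) k) ≡ f (k ℕ.∸ c)
    pick f c k c≤k k∸c≤m = trans (S-cong λ b _ → trans (cong (f b *_) (𝟙-cong
        (λ e → trans (cong (ℕ._∸ c) (sym e)) (ℕ.m+n∸n≡m b c)) (λ e → trans (cong (ℕ._+ c) (sym e)) (ℕ.m∸n+n≡m c≤k)) (b ℕ.+ c ℕ.≟ k) (k ℕ.∸ c ℕ.≟ b))) (*-comm (f b) _))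
      (S-δ f k∸c≤m)

    K∙-split : ∀ f c → c ≤ m → (K ∙ f) c ≡ f (m ℕ.∸ c) + S (λ b → f b * δ (b ℕ.+ c) (suc m))
    K∙-split f c c≤m = trans (δ∙ f c ℕ.≤-refl) (trans
      (S-cong λ b b≤m → trans (cong (f b *_) (N-K b≤m c≤m)) (distribˡ (f b) _ _))
      (trans (∑-+ (suc m) _ _) (cong (_+ S (λ b → f b * δ (b ℕ.+ c) (suc m))) (pick f c m c≤m (ℕ.m∸n≤m m c)))))

  K∙-zero : ∀ f → (K ∙ f) 0 ≡ f m
  K∙-zero f = trans (K∙-split f 0 z≤n) (trans
    (cong (f m +_) (∑-zero (suc m) λ { b (s≤s b≤m) → trans (cong (f b *_) (δ-≢ λ e → ℕ.<-irrefl (trans (sym (ℕ.+-identityʳ b)) e) (s≤s b≤m))) (zeroʳ (f b)) }))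
    (+-identityʳ (f m)))

  K∙-suc : ∀ f c → suc c ≤ m → (K ∙ f) (suc c) ≡ f (m ℕ.∸ suc c) + f (m ℕ.∸ c)
  K∙-suc f c c<m = trans (K∙-split f (suc c) c<m) (cong (f (m ℕ.∸ suc c) +_) (pick f (suc c) (suc m) (ℕ.m≤n⇒m≤1+n c<m) (ℕ.m∸n≤m m c)))

  -- Centred so that the labels m - c and m - c + 1 met by K lie at the negatives of `pt c + 2` and
  -- `pt c - 2`. Parity thus turns K into a sum over neighbours at distance 2, although consecutive
  -- labels are 4 apart.
  pt : ℕ → ℚ
  pt a = # 4 * # a - # 2 * # m - # 1

  pt-0 : pt 0 ≡ oddStart (# m)
  pt-0 = solve 1 (λ m → :# 4 :* :# 0 :- :# 2 :* m :- :# 1 := :- (:# 2 :* m) :- :# 1) refl (# m)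

  -- The value at the neighbour that label 0 lacks. The null second summand keeps this
  -- definitionally equal to the functional of `Boundary` with b = 0.
  ∂ : (ℚ → ℚ) → ℚ
  ∂ Φ = Φ (oddStart (# m) - # 2) + 0ℚ * Φ (oddStart (# m))

  module _ {Φ : ℚ → ℚ} {s : ℚ} (parity : ∀ X → Φ (- X) ≡ s * Φ X) (s² : s * s ≡ 1ℚ) where

    private
      f : ℕ → ℚ
      f a = Φ (pt a)

      reflect₊ : ∀ c → c ≤ m → f (m ℕ.∸ c) ≡ s * Φ (pt c + # 2)
      reflect₊ c c≤m = trans (cong Φ (trans (cong (λ z → # 4 * z - # 2 * # m - # 1) (#-∸ c≤m))
        (solve 2 (λ m c → :# 4 :* (m :- c) :- :# 2 :* m :- :# 1 := :- (:# 4 :* c :- :# 2 :* m :- :# 1 :+ :# 2)) refl (# m) (# c)))) (parity (pt c + # 2))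

      reflect₋ : ∀ c → c ≤ m → f (m ℕ.∸ c) ≡ s * Φ (pt (suc c) - # 2)
      reflect₋ c c≤m = trans (cong Φ (trans (cong (λ z → # 4 * z - # 2 * # m - # 1) (#-∸ c≤m))
        (trans (solve 2 (λ m c → :# 4 :* (m :- c) :- :# 2 :* m :- :# 1 := :- (:# 4 :* (:# 1 :+ c) :- :# 2 :* m :- :# 1 :- :# 2)) refl (# m) (# c))
          (cong (λ z → - (# 4 * z - # 2 * # m - # 1 - # 2)) (sym (#-suc c)))))) (parity (pt (suc c) - # 2))

      K∙f : ∀ c → c ≤ m → (K ∙ f) c ≡ s * (Φ (pt c + # 2) + Φ (pt c - # 2) - δ 0 c * ∂ Φ)
      K∙f zero c≤m = trans (K∙-zero f) (trans (reflect₊ 0 z≤n) (cong (s *_) (sym (trans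
        (cong₂ (λ x y → Φ (pt 0 + # 2) + Φ (x - # 2) - y) pt-0 (trans (*-identityˡ (∂ Φ)) (trans (cong (Φ (oddStart (# m) - # 2) +_) (zeroˡ _)) (+-identityʳ _))))
        (solve 2 (λ p q → p :+ q :- q := p) refl (Φ (pt 0 + # 2)) (Φ (oddStart (# m) - # 2)))))))
      K∙f (suc c) c<m = trans (K∙-suc f c c<m) (trans (cong₂ _+_ (reflect₊ (suc c) c<m) (reflect₋ c (ℕ.<⇒≤ c<m)))
        (trans (solve 4 (λ s p q d → s :* p :+ s :* q := s :* (p :+ q :- con ℤ.0ℤ :* d)) refl s (Φ (pt (suc c) + # 2)) (Φ (pt (suc c) - # 2)) (∂ Φ))
          (cong (λ z → s * (Φ (pt (suc c) + # 2) + Φ (pt (suc c) - # 2) - z * ∂ Φ)) ι-0)))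

    -- By parity, s K adds the values at the two neighbours and so completes -Δ². Only label 0 lacks
    -- a neighbour, which accounts for the term in e₀.
    Y∙ : ((# 2 · δ 0) ⊞ (- s) · K) ∙ f ≈ (λ c → - Δ² Φ (pt c) + ∂ Φ * δ 0 c)
    Y∙ c c≤m = begin
      (((# 2 · δ 0) ⊞ (- s) · K) ∙ f) c  ≡⟨ ⊞-∙ (# 2 · δ 0) ((- s) · K) f c c≤m ⟩
      ((# 2 · δ 0) ∙ f) c + (((- s) · K) ∙ f) c
        ≡⟨ cong₂ _+_ (trans (·-∙ (# 2) (δ 0) f c c≤m) (cong (# 2 *_) (∙-identityˡ f c c≤m))) (trans (·-∙ (- s) K f c c≤m) (cong ((- s) *_) (K∙f c c≤m))) ⟩
      # 2 * Φ X + (- s) * (s * (Φ₊ + Φ₋ - δ 0 c * ∂ Φ))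
        ≡⟨ solve 6 (λ g s p q e d → :# 2 :* g :+ :- s :* (s :* (p :+ q :- e :* d)) := :# 2 :* g :- s :* s :* (p :+ q :- e :* d)) refl (Φ X) s Φ₊ Φ₋ (δ 0 c) (∂ Φ) ⟩
      # 2 * Φ X - s * s * (Φ₊ + Φ₋ - δ 0 c * ∂ Φ)
        ≡⟨ cong (λ z → # 2 * Φ X - z) (trans (cong (_* (Φ₊ + Φ₋ - δ 0 c * ∂ Φ)) s²) (*-identityˡ _)) ⟩
      # 2 * Φ X - (Φ₊ + Φ₋ - δ 0 c * ∂ Φ)
        ≡⟨ solve 5 (λ g p q e d → :# 2 :* g :- (p :+ q :- e :* d) := :- (p :+ q :- :# 2 :* g) :+ d :* e) refl (Φ X) Φ₊ Φ₋ (δ 0 c) (∂ Φ) ⟩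
      - Δ² Φ X + ∂ Φ * δ 0 c ∎
      where
      open ≡-Reasoning
      X = pt c
      Φ₊ = Φ (X + # 2)
      Φ₋ = Φ (X - # 2)

  module Powers (seed : Seed) where
    open Seed seed
    open CentralFactorial seed
    open Boundary 1ℚ 0ℚ oddStart oddStart-poly hiding (∂)

    g₀ : ℕ → ℚ
    g₀ a = G₀ (pt a)

    Y∙g₀ : ((# 2 · δ 0) ⊞ (- s) · K) ∙ g₀ ≈ ∂ G₀ · δ 0
    Y∙g₀ c c≤m = trans (Y∙ parity s² c c≤m) (trans (cong (λ z → - z + ∂ G₀ * δ 0 c) (trans (harmonic (pt c)) (sym ι-0)))
      (solve 1 (λ x → :- con ℤ.0ℤ :+ x := x) refl (∂ G₀ * δ 0 c)))

    -- Up to the scalar `∂ G₀`, the element 2 - s K is inverse to `g₀`. One more factor `g₀`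
    -- therefore means one more difference equation with vanishing boundary value, which is how
    -- `family` was built.
    family≈pow : ∂ G₀ ≢ 0ℚ → ∀ n → (λ a → family n (# m) (pt a)) ≈ pow g₀ (suc n)
    family≈pow ∂≢0 zero    a a≤m = trans (family-zero (# m) (pt a)) (sym (≈-trans (∙-comm _ (δ 0)) (∙-identityˡ _) a a≤m))
    family≈pow ∂≢0 (suc n) = ≈-trans
      (divide {U = δ 0} 1ℚ≢0ℚ ∂≢0 Y∙g₀
        (λ c c≤m → trans (∙-identityˡ _ c c≤m) (sym (*-identityˡ _)))
        (λ c c≤m → trans (Y∙ (family-parity (suc n) (# m)) s² c c≤m)
          (trans (cong₂ (λ x y → - x + y * δ 0 c) (Δ²-family n (# m) (pt c)) (∂-family n (# m)))
            (trans (cong (- (- (1ℚ * ∂ G₀ * family n (# m) (pt c))) +_) (zeroˡ (δ 0 c)))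
              (trans (+-identityʳ _) (solve 1 (λ x → :- (:- x) := x) refl _))))))
      (∙-cong ≈-refl (family≈pow ∂≢0 n))

  V : ℕ → ℚ
  V a = - pt a

  private
    ∂-odd : ∂ (λ X → - X) ≡ # 2 * # m + # 3
    ∂-odd = trans (cong (λ z → - (oddStart (# m) - # 2) + z * - oddStart (# m)) (sym ι-0))
      (solve 1 (λ m → :- (:- (:# 2 :* m) :- :# 1 :- :# 2) :+ con ℤ.0ℤ :* (:- (:- (:# 2 :* m) :- :# 1)) := :# 2 :* m :+ :# 3) refl (# m))

    ∂-even : ∂ (λ _ → 1ℚ) ≡ 1ℚ
    ∂-even = trans (cong (1ℚ +_) (zeroˡ 1ℚ)) (+-identityʳ 1ℚ)

    ∂-odd≢0 : ∂ (λ X → - X) ≢ 0ℚ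
    ∂-odd≢0 e = #suc≢0 (2 ℕ.+ 2 ℕ.* m) (trans (trans (#-+ 3 (2 ℕ.* m)) (trans (cong (# 3 +_) (#-* 2 m)) (+-comm _ _))) (trans (sym ∂-odd) e))

    ∂-even≢0 : ∂ (λ _ → 1ℚ) ≢ 0ℚ
    ∂-even≢0 e = 1ℚ≢0ℚ (trans (sym ∂-even) e)

  module Ω-powers = Powers evenSeed
  module V-powers = Powers oddSeed

  Ω-family : ∀ n → (λ a → CentralFactorial.Boundary.family evenSeed 1ℚ 0ℚ oddStart oddStart-poly n (# m) (pt a)) ≈ pow Ω (suc n)
  Ω-family = Ω-powers.family≈pow ∂-even≢0

  V-family : ∀ n → (λ a → CentralFactorial.Boundary.family oddSeed 1ℚ 0ℚ oddStart oddStart-poly n (# m) (pt a)) ≈ pow V (suc n)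
  V-family = V-powers.family≈pow ∂-odd≢0

  -- Ω and V invert 2 - K and (2 + K) / (2m + 3), so this is a partial fraction decomposition.
  4ΩV : # 4 · (Ω ∙ V) ≈ (# 2 * # m + # 3) · Ω ⊞ V
  4ΩV c c≤m = begin
    # 4 * (Ω ∙ V) c
      ≡⟨ cong (# 4 *_) (∙-identityˡ (Ω ∙ V) c c≤m) ⟨
    # 4 * (δ 0 ∙ (Ω ∙ V)) c
      ≡⟨ ·-∙ (# 4) (δ 0) (Ω ∙ V) c c≤m ⟨
    ((# 4 · δ 0) ∙ (Ω ∙ V)) c
      ≡⟨ ∙-cong (λ a _ → trans (solve 2 (λ d k → :# 4 :* d := (:# 2 :* d :+ :- :# 1 :* k) :+ (:# 2 :* d :+ :- (:- :# 1) :* k)) refl (δ 0 a) (K a))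
            (cong (λ z → (# 2 * δ 0 a + - z * K a) + Y₋ a) ι-1)) ≈-refl c c≤m ⟩
    ((Y₊ ⊞ Y₋) ∙ (Ω ∙ V)) c
      ≡⟨ ⊞-∙ Y₊ Y₋ (Ω ∙ V) c c≤m ⟩
    (Y₊ ∙ (Ω ∙ V)) c + (Y₋ ∙ (Ω ∙ V)) c
      ≡⟨ cong₂ _+_ (trans (sym (∙-assoc Y₊ Ω V c c≤m)) (trans (∙-cong Ω-powers.Y∙g₀ ≈-refl c c≤m) (trans (·-∙ _ (δ 0) V c c≤m) (cong₂ _*_ ∂-even (∙-identityˡ V c c≤m)))))
                   (trans (∙-left-comm Y₋ Ω V c c≤m) (trans (∙-cong ≈-refl V-powers.Y∙g₀ c c≤m) (trans (∙-· _ Ω (δ 0) c c≤m) (cong₂ _*_ ∂-odd (≈-trans (∙-comm Ω (δ 0)) (∙-identityˡ Ω) c c≤m))))) ⟩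
    1ℚ * V c + (# 2 * # m + # 3) * Ω c
      ≡⟨ trans (cong (_+ (# 2 * # m + # 3) * Ω c) (*-identityˡ (V c))) (+-comm (V c) _) ⟩
    (# 2 * # m + # 3) * Ω c + V c ∎
    where
    open ≡-Reasoning
    Y₊ Y₋ : ℕ → ℚ
    Y₊ = (# 2 · δ 0) ⊞ (- 1ℚ) · K
    Y₋ = (# 2 · δ 0) ⊞ (- (- # 1)) · K

  -- The conditions on i reduce to c ≤ 2i and 2i + c ≤ t. Halving them depends on the parity of c,
  -- but as t is odd both cases leave m + 1 - c values.
  θ-value : ∀ c → c ≤ m → θ c ≡ # (suc m ℕ.∸ c)
  θ-value c c≤m with halve c
  ... | d , inj₁ refl = trans
    (S-cong λ i _ → 𝟙-cong
      (λ { (_ , _ , p , q) → double-≤′ p , ℕ.m+n≤o⇒m≤o∸n i (double-≤ {i ℕ.+ d} {m} (≤-cast q (regroup i d) refl)) })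
      (λ { (p , q) → ℕ.m≤m+n i c , ℕ.m≤m+n i c , double-mono p , ≤-cast (ℕ.m≤n⇒m≤1+n (double-mono (ℕ.m≤o∸n⇒m+n≤o i d≤m q))) (sym (regroup i d)) refl })
      (tri? _ i i c) (d ℕ.≤? i ×-dec i ℕ.≤? m ℕ.∸ d))
    (trans (∑-interval (suc m) d (m ℕ.∸ d) (s≤s (ℕ.m∸n≤m m d))) (cong #_ (trans (cong (ℕ._∸ d) (sym (ℕ.+-∸-assoc 1 d≤m))) (ℕ.∸-+-assoc (suc m) d d))))
    where d≤m = ℕ.≤-trans (ℕ.m≤m+n d d) c≤m
  ... | d , inj₂ refl = trans
    (S-cong λ i _ → 𝟙-cong
      (λ { (_ , _ , p , q) → double-< p , ℕ.m+n≤o⇒m≤o∸n i (double-≤′ {i ℕ.+ d} {m} (≤-cancel 1 q (regroup-suc i d) refl)) })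
      (λ { (p , q) → ℕ.m≤m+n i c , ℕ.m≤m+n i c , ℕ.≤-trans (s≤s (ℕ.+-monoʳ-≤ d (ℕ.n≤1+n d))) (double-mono p) , ≤-cast (s≤s (double-mono (ℕ.m≤o∸n⇒m+n≤o i d≤m q))) (sym (regroup-suc i d)) refl })
      (tri? _ i i c) (suc d ℕ.≤? i ×-dec i ℕ.≤? m ℕ.∸ d))
    (trans (∑-interval (suc m) (suc d) (m ℕ.∸ d) (s≤s (ℕ.m∸n≤m m d))) (cong #_ (ℕ.∸-+-assoc m d d)))
    where d≤m = ℕ.≤-trans (ℕ.m≤m+n d d) (ℕ.<⇒≤ c≤m)

  θ≈ΩV : θ ≈ Ω ∙ V
  θ≈ΩV c c≤m = *-cancel (#suc≢0 3) (trans (cong (# 4 *_) (trans (θ-value c c≤m) (trans (#-∸ (ℕ.m≤n⇒m≤1+n c≤m)) (cong (_- # c) (#-suc m)))))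
    (trans (trans (solve 2 (λ m c → :# 4 :* (:# 1 :+ m :- c) := (:# 2 :* m :+ :# 3) :* :# 1 :+ :- (:# 4 :* c :- :# 2 :* m :- :# 1)) refl (# m) (# c)) (cong (λ z → (# 2 * # m + # 3) * z + V c) ι-1)) (sym (4ΩV c c≤m))))

PolyValue : (ℕ → ℚ) → Set
PolyValue F = Σ (ℚ → ℚ) λ f → IsPoly f × (∀ m → F m ≡ f (# m))

-- `4ΩV` trades a product ΩV for Ω or V alone and so lowers one exponent, down to pure powers, where
-- `family` applies.
oddΩV : ∀ i j → PolyValue λ m → let open OddLevel m in ε (pow Ω i ∙ pow V j)
oddΩV zero zero = (λ _ → 1ℚ) , poly-const 1ℚ , λ m → OddLevel.∙-identityˡ m (δ 0) 0 z≤n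
oddΩV zero (suc n) = _ , CentralFactorial.Boundary.family-poly oddSeed 1ℚ 0ℚ oddStart oddStart-poly n oddStart-poly ,
  λ m → let open OddLevel m in
    trans (∙-identityˡ (pow V (suc n)) 0 z≤n) (trans (sym (V-family n 0 z≤n)) (cong (CentralFactorial.Boundary.family oddSeed 1ℚ 0ℚ oddStart oddStart-poly n (# m)) pt-0))
oddΩV (suc n) zero = _ , CentralFactorial.Boundary.family-poly evenSeed 1ℚ 0ℚ oddStart oddStart-poly n oddStart-poly ,
  λ m → let open OddLevel m in
    trans (∙-identityʳ (pow Ω (suc n)) 0 z≤n) (trans (sym (Ω-family n 0 z≤n)) (cong (CentralFactorial.Boundary.family evenSeed 1ℚ 0ℚ oddStart oddStart-poly n (# m)) pt-0))
oddΩV (suc i) (suc j) with oddΩV (suc i) j | oddΩV i (suc j)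
... | f₁ , p₁ , eq₁ | f₂ , p₂ , eq₂ =
  (λ μ → recip 3 * ((# 2 * μ + # 3) * f₁ μ + f₂ μ)) ,
  poly-* (poly-const _) (poly-+ (poly-* (poly-+ (poly-* (poly-const _) poly-id) (poly-const _)) p₁) p₂) ,
  λ m → let open OddLevel m ; open ≡-Reasoning ; A = pow Ω i ; B = pow V j ; M = # 2 * # m + # 3 in begin
    ((Ω ∙ A) ∙ (V ∙ B)) 0                    ≡⟨ ∙-interchange Ω A V B 0 z≤n ⟩
    ((Ω ∙ V) ∙ (A ∙ B)) 0                    ≡⟨ *-identityˡ _ ⟨
    1ℚ * ((Ω ∙ V) ∙ (A ∙ B)) 0               ≡⟨ cong (_* ((Ω ∙ V) ∙ (A ∙ B)) 0) (trans (*-comm (recip 3) (# 4)) (*-recip 3)) ⟨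
    recip 3 * # 4 * ((Ω ∙ V) ∙ (A ∙ B)) 0    ≡⟨ *-assoc (recip 3) (# 4) _ ⟩
    recip 3 * (# 4 * ((Ω ∙ V) ∙ (A ∙ B)) 0)  ≡⟨ cong (recip 3 *_) (begin
      # 4 * ((Ω ∙ V) ∙ (A ∙ B)) 0              ≡⟨ ·-∙ (# 4) (Ω ∙ V) (A ∙ B) 0 z≤n ⟨
      ((# 4 · (Ω ∙ V)) ∙ (A ∙ B)) 0            ≡⟨ ∙-cong 4ΩV ≈-refl 0 z≤n ⟩
      ((M · Ω ⊞ V) ∙ (A ∙ B)) 0                ≡⟨ ⊞-∙ (M · Ω) V (A ∙ B) 0 z≤n ⟩
      ((M · Ω) ∙ (A ∙ B)) 0 + (V ∙ (A ∙ B)) 0  ≡⟨ cong₂ _+_ (trans (·-∙ M Ω (A ∙ B) 0 z≤n) (cong (M *_) (trans (sym (∙-assoc Ω A B 0 z≤n)) (eq₁ m)))) (trans (∙-left-comm V A B 0 z≤n) (eq₂ m)) ⟩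
      M * f₁ (# m) + f₂ (# m)                  ∎) ⟩
    recip 3 * (M * f₁ (# m) + f₂ (# m)) ∎

oddCount : ∀ n g → PolyValue λ m → let open OddLevel m in ε (pow Ω n ∙ pow θ g)
oddCount n g with oddΩV (n ℕ.+ g) g
... | f , p , eq = f , p , λ m → let open OddLevel m in
  trans (≈-trans (∙-cong ≈-refl (≈-trans (pow-cong g θ≈ΩV) (pow-∙ Ω V g))) (≈-trans (≈-sym (∙-assoc (pow Ω n) (pow Ω g) (pow V g))) (∙-cong (≈-sym (pow-+ Ω n g)) ≈-refl)) 0 z≤n) (eq m)

-- Even t

sgn : ℕ → ℚ
sgn zero    = 1ℚ
sgn (suc n) = - sgn n

sgn-cancel : ∀ c → sgn c + sgn (suc c) ≡ 0ℚ
sgn-cancel c = -‿inverseʳ (sgn c)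

sgn² : ∀ c → sgn c * sgn c ≡ 1ℚ
sgn² zero    = *-identityˡ 1ℚ
sgn² (suc c) = trans (solve 1 (λ x → (:- x) :* (:- x) := x :* x) refl (sgn c)) (sgn² c)

sgn-double : ∀ d → sgn (d ℕ.+ d) ≡ 1ℚ
sgn-double zero    = refl
sgn-double (suc d) = trans (cong (λ z → - sgn z) (ℕ.+-suc d d)) (trans (solve 1 (λ x → :- (:- x) := x) refl (sgn (d ℕ.+ d))) (sgn-double d))

module EvenLevel (m : ℕ) where

  open FusionAlgebra (m ℕ.+ m) m ℕ.≤-refl (ℕ.n≤1+n _) public

  J : ℕ → ℚ
  J = δ m

  J∙ : ∀ f c → c ≤ m → (J ∙ f) c ≡ f (m ℕ.∸ c)
  J∙ f c c≤m = trans (δ∙ f c ℕ.≤-refl) (trans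
    (S-cong λ b b≤m → trans (cong (f b *_) (𝟙-cong
      (λ { (p , _ , _ , q) → trans (cong (ℕ._∸ c) (ℕ.≤-antisym p (≤-cancel m q (ℕ.+-assoc m b c) refl))) (ℕ.m+n∸n≡m b c) })
      (λ e → let e′ = trans (cong (ℕ._+ c) (sym e)) (ℕ.m∸n+n≡m c≤m) in
        ℕ.≤-reflexive (sym e′) , ℕ.≤-trans b≤m (ℕ.m≤m+n m c) , ℕ.≤-trans c≤m (ℕ.m≤m+n m b) , ≤-cast (+-monoʳ m (ℕ.≤-reflexive e′)) (sym (ℕ.+-assoc m b c)) refl)
      (tri? _ m b c) (m ℕ.∸ c ℕ.≟ b))) (*-comm (f b) _))
    (S-δ f (ℕ.m∸n≤m m c)))

  -- The element e₀ + e₁, with the convention e₁ = - e₀ for m = 0.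
  E : ℕ → ℚ
  E = 𝟙 (1 ℕ.≤? m) · (δ 0 ⊞ δ 1)

  -- The two halves of the action of E, which at an inner label c gives f (c - 1) + 2 f c + f (c +
  -- 1), the squared adjacency of spin 1/2. A pair that leaves the range counts as zero.
  below above : (ℕ → ℚ) → ℕ → ℚ
  below f zero    = 0ℚ
  below f (suc c) = f c + f (suc c)
  above f c = 𝟙 (suc c ℕ.≤? m) * (f c + f (suc c))

  above-yes : ∀ f {c} → suc c ≤ m → above f c ≡ f c + f (suc c)
  above-yes f {c} c<m = trans (cong (_* (f c + f (suc c))) (𝟙-yes (suc c ℕ.≤? m) c<m)) (*-identityˡ _)

  above-no : ∀ f {c} → ¬ suc c ≤ m → above f c ≡ 0ℚ
  above-no f {c} c≮m = trans (cong (_* (f c + f (suc c))) (𝟙-no (suc c ℕ.≤? m) c≮m)) (zeroˡ _)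

  private
    e₁∙ : 1 ≤ m → ∀ f c → c ≤ m → (δ 0 ∙ f) c + (δ 1 ∙ f) c ≡ below f c + above f c
    e₁∙ 1≤m f zero c≤m = trans (cong₂ _+_ (∙-identityˡ f 0 z≤n) (trans (δ∙ f 0 1≤m) (trans (S-cong λ b b≤m → trans (cong (f b *_) (N-0 1≤m b≤m)) (*-comm (f b) _)) (S-δ f 1≤m)))) (sym (trans (+-identityˡ _) (above-yes f 1≤m)))
    e₁∙ 1≤m f (suc c) c<m with ℕ.m≤n⇒m<n∨m≡n c<m
    ... | inj₁ c+2≤m = trans (cong₂ _+_ (∙-identityˡ f (suc c) c<m) (trans (δ∙ f (suc c) 1≤m) (trans
        (S-cong λ b b≤m → trans (cong (f b *_) (split b)) (solve 4 (λ x p q r → x :* (p :+ (q :+ r)) := p :* x :+ (q :* x :+ r :* x)) refl (f b) (δ c b) (δ (suc c) b) (δ (suc (suc c)) b)))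
        (trans (∑-+ (suc m) _ _) (cong₂ _+_ (S-δ f (ℕ.<⇒≤ c<m)) (trans (∑-+ (suc m) _ _) (cong₂ _+_ (S-δ f c<m) (S-δ f c+2≤m))))))))
        (trans (solve 3 (λ x y z → y :+ (x :+ (y :+ z)) := x :+ y :+ (y :+ z)) refl (f c) (f (suc c)) (f (suc (suc c)))) (cong (f c + f (suc c) +_) (sym (above-yes f c+2≤m))))
      where
      near : ∀ b → c ≤ b → b ≤ suc (suc c) → c ≡ b ⊎ (suc c ≡ b ⊎ suc (suc c) ≡ b)
      near b p q with ℕ.m≤n⇒m<n∨m≡n p
      ... | inj₂ e = inj₁ e
      ... | inj₁ p′ with ℕ.m≤n⇒m<n∨m≡n p′
      ...   | inj₂ e = inj₂ (inj₁ e)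
      ...   | inj₁ p″ = inj₂ (inj₂ (ℕ.≤-antisym p″ q))
      tri : ∀ b → c ≤ b → b ≤ suc (suc c) → Tri (m ℕ.+ m) 1 b (suc c)
      tri b p q = ℕ.≤-trans (s≤s z≤n) (ℕ.m≤n+m (suc c) b) , q , s≤s p ,
        ℕ.≤-trans (s≤s (ℕ.+-monoˡ-≤ (suc c) q)) (≤-cast (ℕ.+-mono-≤ c+2≤m c+2≤m) (cong (suc ∘ suc) (ℕ.+-suc c (suc c))) refl)
      c≤c+2 = ℕ.≤-trans (ℕ.n≤1+n c) (ℕ.n≤1+n (suc c))
      split : ∀ b → N 1 b (suc c) ≡ δ c b + (δ (suc c) b + δ (suc (suc c)) b)
      split b = trans (𝟙-⊎ {Q = c ≡ b} {R = suc c ≡ b ⊎ suc (suc c) ≡ b}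
        (λ { (_ , q , s≤s p , _) → near b p q })
        (λ { refl → tri b ℕ.≤-refl c≤c+2 })
        (λ { (inj₁ refl) → tri b (ℕ.n≤1+n c) (ℕ.n≤1+n (suc c)) ; (inj₂ refl) → tri b c≤c+2 ℕ.≤-refl })
        (λ { (refl , inj₁ e) → ℕ.1+n≢n e ; (refl , inj₂ e) → ℕ.<⇒≢ (ℕ.n≤1+n (suc b)) (sym e) })
        (tri? _ 1 b (suc c)) (c ℕ.≟ b) (suc c ℕ.≟ b ⊎-dec suc (suc c) ℕ.≟ b))
        (cong (δ c b +_) (𝟙-⊎ (λ z → z) inj₁ inj₂ (λ { (refl , e) → ℕ.1+n≢n e }) (suc c ℕ.≟ b ⊎-dec suc (suc c) ℕ.≟ b) (suc c ℕ.≟ b) (suc (suc c) ℕ.≟ b)))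
    -- At the top label m = c + 1 the bound on the sum excludes b = m, and b = c alone remains.
    ... | inj₂ c+1≡m = trans (cong₂ _+_ (∙-identityˡ f (suc c) c<m) (trans (δ∙ f (suc c) 1≤m) (trans
        (S-cong λ b b≤m → trans (cong (f b *_) (𝟙-cong (to b) from (tri? _ 1 b (suc c)) (c ℕ.≟ b))) (*-comm (f b) _)) (S-δ f (ℕ.<⇒≤ c<m)))))
        (trans (+-comm (f (suc c)) (f c)) (sym (trans (cong (f c + f (suc c) +_) (above-no f c+2≰m)) (+-identityʳ _))))
      where
      m≤c+1 : m ≤ suc c
      m≤c+1 = ℕ.≤-reflexive (sym c+1≡m)
      c+2≰m : ¬ suc (suc c) ≤ m
      c+2≰m p = ℕ.<-irrefl refl (ℕ.≤-trans p m≤c+1)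
      to : ∀ b → Tri (m ℕ.+ m) 1 b (suc c) → c ≡ b
      to b (_ , _ , s≤s p , q) = ℕ.≤-antisym p (ℕ.≤-pred (ℕ.+-cancelʳ-≤ (suc c) (suc b) (suc c) (ℕ.≤-trans q (ℕ.+-mono-≤ m≤c+1 m≤c+1))))
      from : ∀ {b} → c ≡ b → Tri (m ℕ.+ m) 1 b (suc c)
      from refl = ℕ.≤-trans (s≤s z≤n) (ℕ.m≤n+m (suc c) c) , ℕ.≤-trans (ℕ.n≤1+n c) (ℕ.n≤1+n (suc c)) , ℕ.≤-refl , ℕ.+-mono-≤ c<m c<m

  E∙ : ∀ f c → c ≤ m → (E ∙ f) c ≡ below f c + above f c
  E∙ f c c≤m = trans (·-∙ _ (δ 0 ⊞ δ 1) f c c≤m) (trans (cong (𝟙 (1 ℕ.≤? m) *_) (⊞-∙ (δ 0) (δ 1) f c c≤m)) (go (1 ℕ.≤? m)))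
    where
    below-no : ∀ c → c ≤ m → ¬ 1 ≤ m → below f c ≡ 0ℚ
    below-no zero    _   _   = refl
    below-no (suc _) c≤m 1≰m = ⊥-elim (1≰m (ℕ.≤-trans (s≤s z≤n) c≤m))
    go : (d : Dec (1 ≤ m)) → 𝟙 d * ((δ 0 ∙ f) c + (δ 1 ∙ f) c) ≡ below f c + above f c
    go (yes 1≤m) = trans (*-identityˡ _) (e₁∙ 1≤m f c c≤m)
    go (no 1≰m)  = trans (zeroˡ _) (sym (trans (cong₂ _+_ (below-no c c≤m 1≰m) (above-no f (λ p → 1≰m (ℕ.≤-trans (s≤s z≤n) p)))) (+-identityˡ 0ℚ)))

  -- Since E is the square of spin 1/2, this is the even counterpart of (2 - K) (2 + K): both seeds
  -- solve equations for the same element, and the action of J tells them apart.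
  y : ℕ → ℚ
  y = # 4 · δ 0 ⊞ (- # 1) · E

  y∙ : ∀ f c → c ≤ m → (y ∙ f) c ≡ # 4 * f c - (below f c + above f c)
  y∙ f c c≤m = trans (⊞-∙ (# 4 · δ 0) ((- # 1) · E) f c c≤m) (trans
    (cong₂ _+_ (trans (·-∙ (# 4) (δ 0) f c c≤m) (cong (# 4 *_) (∙-identityˡ f c c≤m))) (trans (·-∙ (- # 1) E f c c≤m) (cong ((- # 1) *_) (E∙ f c c≤m))))
    (solve 2 (λ x z → :# 4 :* x :+ (:- :# 1) :* z := :# 4 :* x :- z) refl (f c) (below f c + above f c)))

  pt : ℕ → ℚ
  pt a = # 2 * # a - # m

  pt-0 : pt 0 ≡ evenStart (# m)
  pt-0 = solve 1 (λ m → :# 2 :* :# 0 :- m := :- m) refl (# m)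

  pt-m : pt m ≡ - evenStart (# m)
  pt-m = solve 1 (λ m → :# 2 :* m :- m := :- (:- m)) refl (# m)

  pt-suc : ∀ c → pt (suc c) ≡ pt c + # 2
  pt-suc c = trans (cong (λ z → # 2 * z - # m) (#-suc c)) (solve 2 (λ c m → :# 2 :* (:# 1 :+ c) :- m := :# 2 :* c :- m :+ :# 2) refl (# c) (# m))

  ∂ : (ℚ → ℚ) → ℚ
  ∂ Φ = Φ (evenStart (# m) - # 2) + 1ℚ * Φ (evenStart (# m))

  module _ {Φ : ℚ → ℚ} {s : ℚ} (parity : ∀ X → Φ (- X) ≡ s * Φ X) where

    private
      f : ℕ → ℚ
      f a = Φ (pt a)

      x₀ = evenStart (# m)

      ∂≡ : ∂ Φ ≡ Φ (x₀ - # 2) + Φ x₀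
      ∂≡ = cong (Φ (x₀ - # 2) +_) (*-identityˡ (Φ x₀))

      below-f : ∀ c → below f c ≡ Φ (pt c - # 2) + Φ (pt c) - δ 0 c * ∂ Φ
      below-f zero = sym (trans (cong₂ (λ x z → Φ (x - # 2) + Φ x - z) pt-0 (trans (*-identityˡ (∂ Φ)) ∂≡)) (-‿inverseʳ _))
      below-f (suc c) = trans (cong (λ x → Φ x + Φ (pt (suc c))) (trans (solve 1 (λ x → x := x :+ :# 2 :- :# 2) refl (pt c)) (cong (_- # 2) (sym (pt-suc c)))))
        (trans (solve 2 (λ x d → x := x :- con ℤ.0ℤ :* d) refl _ (∂ Φ)) (cong (λ z → Φ (pt (suc c) - # 2) + Φ (pt (suc c)) - z * ∂ Φ) ι-0))

      above-f : ∀ c → c ≤ m → above f c ≡ Φ (pt c) + Φ (pt c + # 2) - δ m c * (s * ∂ Φ)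
      above-f c c≤m with ℕ.m≤n⇒m<n∨m≡n c≤m
      ... | inj₁ c<m = trans (above-yes f c<m) (trans (cong (λ x → Φ (pt c) + Φ x) (pt-suc c))
        (trans (solve 2 (λ x d → x := x :- con ℤ.0ℤ :* d) refl _ (s * ∂ Φ)) (cong (λ z → Φ (pt c) + Φ (pt c + # 2) - z * (s * ∂ Φ)) (trans ι-0 (sym (δ-≢ (λ e → ℕ.<⇒≢ c<m (sym e))))))))
      ... | inj₂ refl = trans (above-no f (ℕ.<-irrefl refl)) (sym (trans
        (cong₂ (λ x z → x - z * (s * ∂ Φ))
          (cong₂ _+_ (trans (cong Φ pt-m) (parity x₀)) (trans (cong Φ (trans (cong (_+ # 2) pt-m) (solve 1 (λ x → :- x :+ :# 2 := :- (x :- :# 2)) refl x₀))) (parity (x₀ - # 2))))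
          (δ-refl m))
        (trans (cong (λ d → s * Φ x₀ + s * Φ (x₀ - # 2) - 1ℚ * (s * d)) ∂≡)
          (trans (cong (λ z → s * Φ x₀ + s * Φ (x₀ - # 2) - z * (s * (Φ (x₀ - # 2) + Φ x₀))) (sym ι-1))
            (trans (solve 3 (λ s p q → s :* q :+ s :* p :- :# 1 :* (s :* (p :+ q)) := con ℤ.0ℤ) refl s (Φ (x₀ - # 2)) (Φ x₀)) ι-0)))))

    -- Label 0 lacks the pair below it and label m the pair above it. Their values are `∂ Φ` and, by
    -- parity, s times `∂ Φ`, whence the factor e₀ + s J.
    y∙Φ : y ∙ f ≈ (λ c → - Δ² Φ (pt c) + ∂ Φ * (δ 0 ⊞ s · J) c)
    y∙Φ c c≤m = trans (y∙ f c c≤m) (trans (cong₂ (λ p q → # 4 * f c - (p + q)) (below-f c) (above-f c c≤m))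
      (solve 7 (λ g p q d e s b → :# 4 :* g :- ((q :+ g :- d :* b) :+ (g :+ p :- e :* (s :* b))) := :- (p :+ q :- :# 2 :* g) :+ b :* (d :+ s :* e)) refl
        (f c) (Φ (pt c + # 2)) (Φ (pt c - # 2)) (δ 0 c) (J c) s (∂ Φ)))

    J∙Φ : J ∙ f ≈ s · f
    J∙Φ c c≤m = trans (J∙ f c c≤m) (trans (cong Φ (trans (cong (λ z → # 2 * z - # m) (#-∸ c≤m)) (solve 2 (λ m c → :# 2 :* (m :- c) :- m := :- (:# 2 :* c :- m)) refl (# m) (# c)))) (parity (pt c)))

  module Powers (seed : Seed) where
    open Seed seed
    open CentralFactorial seed
    open Boundary (# 2) 1ℚ evenStart evenStart-poly hiding (∂)

    g₀ : ℕ → ℚ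
    g₀ a = G₀ (pt a)

    y∙g₀ : y ∙ g₀ ≈ ∂ G₀ · (δ 0 ⊞ s · J)
    y∙g₀ c c≤m = trans (y∙Φ parity c c≤m) (trans (cong (λ z → - z + ∂ G₀ * (δ 0 ⊞ s · J) c) (trans (harmonic (pt c)) (sym ι-0)))
      (solve 1 (λ x → :- con ℤ.0ℤ :+ x := x) refl (∂ G₀ * (δ 0 ⊞ s · J) c)))

    J∙g₀ : J ∙ g₀ ≈ s · g₀
    J∙g₀ = J∙Φ parity

    family≈pow : ∂ G₀ ≢ 0ℚ → ∀ n → (λ a → family n (# m) (pt a)) ≈ pow g₀ (suc n)
    family≈pow ∂≢0 zero    a a≤m = trans (family-zero (# m) (pt a)) (sym (∙-identityʳ _ a a≤m))
    family≈pow ∂≢0 (suc n) = ≈-trans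
      (divide {U = δ 0 ⊞ s · J} (#suc≢0 1) ∂≢0 y∙g₀ U∙F′
        (λ c c≤m → trans (y∙Φ (family-parity (suc n) (# m)) c c≤m)
          (trans (cong₂ (λ x z → - x + z * (δ 0 ⊞ s · J) c) (Δ²-family n (# m) (pt c)) (∂-family n (# m)))
            (trans (cong (- (- (# 2 * ∂ G₀ * family n (# m) (pt c))) +_) (zeroˡ ((δ 0 ⊞ s · J) c)))
              (trans (+-identityʳ _) (solve 1 (λ x → :- (:- x) := x) refl _))))))
      (∙-cong ≈-refl (family≈pow ∂≢0 n))
      where
      F′ : ℕ → ℚ
      F′ a = family (suc n) (# m) (pt a)
      -- J acts on functions of parity s as s, and s² = 1. This is the source of the parameter u = 2
      -- of `Boundary`, against u = 1 for t odd.
      U∙F′ : (δ 0 ⊞ s · J) ∙ F′ ≈ # 2 · F′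
      U∙F′ c c≤m = trans (⊞-∙ (δ 0) (s · J) F′ c c≤m) (trans
        (cong₂ _+_ (∙-identityˡ F′ c c≤m) (trans (·-∙ s J F′ c c≤m) (trans (cong (s *_) (J∙Φ (family-parity (suc n) (# m)) c c≤m))
          (trans (sym (*-assoc s s (F′ c))) (trans (cong (_* F′ c) (trans s² (sym ι-1))) refl)))))
        (solve 1 (λ x → x :+ :# 1 :* x := :# 2 :* x) refl (F′ c)))

∑-neg : ∀ n f → ∑ n (λ i → - f i) ≡ - ∑ n f
∑-neg n f = trans (∑-cong n λ i _ → solve 1 (λ x → :- x := :- :# 1 :* x) refl (f i)) (trans (∑-*ˡ n (- # 1) f) (solve 1 (λ x → :- :# 1 :* x := :- x) refl _))

∑-sgn-suc : ∀ n → ∑ (suc n) sgn ≡ 1ℚ - ∑ n sgn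
∑-sgn-suc n = trans (∑-suc n sgn) (cong (1ℚ +_) (∑-neg n sgn))

∑-sgn-even : ∀ n → ∑ (n ℕ.+ n) sgn ≡ 0ℚ
∑-sgn-odd  : ∀ n → ∑ (suc (n ℕ.+ n)) sgn ≡ 1ℚ
∑-sgn-even zero    = ∑-0 sgn
∑-sgn-even (suc n) = trans (cong (λ k → ∑ (suc k) sgn) (ℕ.+-suc n n)) (trans (∑-sgn-suc _) (trans (cong (λ z → 1ℚ - z) (∑-sgn-odd n)) (-‿inverseʳ 1ℚ)))
∑-sgn-odd n = trans (∑-sgn-suc _) (trans (cong (λ z → 1ℚ - z) (trans (∑-sgn-even n) (sym ι-0))) (solve 1 (λ x → x :- con ℤ.0ℤ := x) refl 1ℚ))

∑-const : ∀ n c → ∑ n (λ _ → c) ≡ # n * c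
∑-const zero    c = trans (∑-0 _) (sym (trans (cong (_* c) ι-0) (zeroˡ c)))
∑-const (suc n) c = trans (∑-suc n _) (trans (cong (c +_) (∑-const n c)) (trans (solve 2 (λ c n → c :+ n :* c := (:# 1 :+ n) :* c) refl c (# n)) (cong (_* c) (sym (#-suc n)))))

bit-^ : ∀ {x} → x ≡ 1ℚ ⊎ x ≡ 0ℚ → ∀ n → x ^ suc n ≡ x
bit-^ {x} b zero = *-identityʳ x
bit-^ {x} b (suc n) = trans (cong (x *_) (bit-^ b n)) (sq b)
  where
  sq : x ≡ 1ℚ ⊎ x ≡ 0ℚ → x * x ≡ x
  sq (inj₁ refl) = *-identityˡ 1ℚ
  sq (inj₂ refl) = zeroˡ 0ℚ

*-^ : ∀ x y n → (x * y) ^ n ≡ x ^ n * y ^ n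
*-^ x y zero    = sym (*-identityˡ 1ℚ)
*-^ x y (suc n) = trans (cong (x * y *_) (*-^ x y n)) (solve 4 (λ x y p q → x :* y :* (p :* q) := x :* p :* (y :* q)) refl x y (x ^ n) (y ^ n))

-- The coefficient of Π in (2θ)ᵍ, and in (2θ)ᵍ Ωⁿ for n > 0 and m even.
excess : ℕ → ℚ → ℚ
excess zero    μ = # 0
excess (suc g) μ = (μ + # 1) ^ g + # 2 * (μ + # 1) * excess g μ

module EvenFormula (m : ℕ) where

  open EvenLevel m public

  W Π : ℕ → ℚ
  W a = - pt a
  Π = sgn

  M : ℚ
  M = # m + # 1

  private
    module Ω-powers = Powers evenSeed
    module W-powers = Powers oddSeed

    ∂-even : ∂ (λ _ → 1ℚ) ≡ # 2
    ∂-even = trans (cong (1ℚ +_) (*-identityˡ 1ℚ)) (trans (cong (λ z → z + z) (sym ι-1)) (solve 0 (:# 1 :+ :# 1 := :# 2) refl))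

    ∂-odd : ∂ (λ X → - X) ≡ # 2 * M
    ∂-odd = trans (cong (- (evenStart (# m) - # 2) +_) (*-identityˡ _)) (solve 1 (λ m → :- (:- m :- :# 2) :+ :- (:- m) := :# 2 :* (m :+ :# 1)) refl (# m))

    M≡ : M ≡ # (suc m)
    M≡ = trans (+-comm (# m) (# 1)) (sym (#-suc m))

    ∂-odd≢0 : ∂ (λ X → - X) ≢ 0ℚ
    ∂-odd≢0 e = #suc≢0 (m ℕ.+ suc (m ℕ.+ 0)) (trans (#-* 2 (suc m)) (trans (cong (# 2 *_) (sym M≡)) (trans (sym ∂-odd) e)))

    ∂-even≢0 : ∂ (λ _ → 1ℚ) ≢ 0ℚ
    ∂-even≢0 e = #suc≢0 1 (trans (sym ∂-even) e)

  Ω-family : ∀ n → (λ a → CentralFactorial.Boundary.family evenSeed (# 2) 1ℚ evenStart evenStart-poly n (# m) (pt a)) ≈ pow Ω (suc n)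
  Ω-family = Ω-powers.family≈pow ∂-even≢0

  W-family : ∀ n → (λ a → CentralFactorial.Boundary.family oddSeed (# 2) 1ℚ evenStart evenStart-poly n (# m) (pt a)) ≈ pow W (suc n)
  W-family = W-powers.family≈pow ∂-odd≢0

  -- J fixes Ω and negates W.
  Ω∙W : Ω ∙ W ≈ 𝟘
  Ω∙W c c≤m = *-cancel (#suc≢0 1) (trans (solve 1 (λ x → :# 2 :* x := x :- :- :# 1 :* x) refl x) (trans (cong (_- (- # 1) * x) x≡) (trans (-‿inverseʳ _) (sym (zeroʳ (# 2))))))
    where
    x = (Ω ∙ W) c
    x≡ : x ≡ (- # 1) * x
    x≡ = trans (∙-cong {f = Ω} {f′ = J ∙ Ω} (λ a a≤m → sym (trans (Ω-powers.J∙g₀ a a≤m) (*-identityˡ 1ℚ))) ≈-refl c c≤m)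
      (trans (∙-cong (∙-comm J Ω) ≈-refl c c≤m) (trans (∙-assoc Ω J W c c≤m) (trans (∙-cong ≈-refl W-powers.J∙g₀ c c≤m) (∙-· (- # 1) Ω W c c≤m))))

  E∙Π : E ∙ Π ≈ 𝟘
  E∙Π c c≤m = trans (E∙ Π c c≤m) (trans (cong₂ _+_ (b c) (*-zeroʳ (𝟙 (suc c ℕ.≤? m)) (sgn-cancel c))) (+-identityˡ 0ℚ))
    where
    b : ∀ c → below Π c ≡ 0ℚ
    b zero    = refl
    b (suc c) = sgn-cancel c

  y∙Π : y ∙ Π ≈ # 4 · Π
  y∙Π c c≤m = trans (y∙ Π c c≤m) (trans (cong (λ z → # 4 * Π c - z) (trans (sym (E∙ Π c c≤m)) (trans (E∙Π c c≤m) (sym ι-0)))) (solve 1 (λ x → x :- con ℤ.0ℤ := x) refl (# 4 * Π c)))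

  private
    -- The kernel of E is the line spanned by Π: at label 0 only the pair above contributes, so it
    -- vanishes, and the pair sums then vanish one after another.
    alternating : ∀ h → E ∙ h ≈ 𝟘 → ∀ c → c ≤ m → h c ≡ h 0 * Π c
    alternating h Eh zero    _   = sym (*-identityʳ (h 0))
    alternating h Eh (suc c) c<m = trans (trans (solve 2 (λ a b → b := a :+ b :- a) refl (h c) (h (suc c))) (cong (_- h c) (trans (cancels c c<m) (sym ι-0))))
      (trans (solve 1 (λ a → con ℤ.0ℤ :- a := :- a) refl (h c)) (trans (cong -_ (alternating h Eh c (ℕ.<⇒≤ c<m))) (solve 2 (λ a b → :- (a :* b) := a :* (:- b)) refl (h 0) (Π c))))
      where
      below≡0 : ∀ c → suc c ≤ m → below h c ≡ 0ℚ
      cancels : ∀ c → suc c ≤ m → h c + h (suc c) ≡ 0ℚ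
      below≡0 zero    _ = refl
      below≡0 (suc c) p = cancels c (ℕ.<⇒≤ p)
      cancels c p = trans (sym (above-yes h p)) (trans (sym (+-identityˡ _)) (trans (cong (_+ above h c) (sym (below≡0 c p))) (trans (sym (E∙ h c (ℕ.<⇒≤ p))) (Eh c (ℕ.<⇒≤ p)))))

  -- The kernel of E is an ideal and a line, so f acts on it by a scalar, which can be read off at
  -- label 0 because Π is 1 there.
  Π∙ : ∀ f → Π ∙ f ≈ (Π ∙ f) 0 · Π
  Π∙ f = alternating (Π ∙ f) (≈-trans (≈-sym (∙-assoc E Π f)) (≈-trans (∙-cong E∙Π ≈-refl) (𝟘-∙ f)))

  χ w : ℚ
  χ = (Π ∙ Ω) 0
  w = (Π ∙ W) 0

  χ-value : χ ≡ ∑ (suc m) sgn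
  χ-value = trans (ε-∙ Π Ω) (S-cong λ a _ → *-identityʳ (Π a))

  χ-even : ∀ k → m ≡ k ℕ.+ k → χ ≡ 1ℚ
  χ-even k e = trans χ-value (trans (cong (λ z → ∑ (suc z) sgn) e) (∑-sgn-odd k))

  χ-odd : ∀ k → m ≡ suc (k ℕ.+ k) → χ ≡ 0ℚ
  χ-odd k e = trans χ-value (trans (cong (λ z → ∑ (suc z) sgn) (trans e (sym (ℕ.+-suc k k)))) (∑-sgn-even (suc k)))

  χ-bit : χ ≡ 1ℚ ⊎ χ ≡ 0ℚ
  χ-bit with halve m
  ... | k , inj₁ e = inj₁ (χ-even k e)
  ... | k , inj₂ e = inj₂ (χ-odd k e)

  -- Multiplying `y∙g₀` for each seed by Π, on which y acts as 4, expresses χ and w through the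
  -- scalar j of J; eliminating j gives the relation.
  w-value : w ≡ M * (# 1 - χ)
  w-value = *-cancel (#suc≢0 3) (trans
    (trans 4w (trans (solve 2 (λ M j → :# 2 :* M :* (:# 1 :+ :- :# 1 :* j) := M :* (:# 4 :- :# 2 :* (:# 1 :+ :# 1 :* j))) refl M j) (cong (λ z → M * (# 4 - z)) (sym 4χ))))
    (solve 2 (λ M x → M :* (:# 4 :- :# 4 :* x) := :# 4 :* (M :* (:# 1 :- x))) refl M χ))
    where
    j = (Π ∙ J) 0
    move : ∀ f {d s} → y ∙ f ≈ d · (δ 0 ⊞ s · J) → # 4 * (Π ∙ f) 0 ≡ d * (# 1 + s * j)
    move f {d} {s} yf = begin
      # 4 * (Π ∙ f) 0                  ≡⟨ ·-∙ (# 4) Π f 0 z≤n ⟨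
      ((# 4 · Π) ∙ f) 0                ≡⟨ ∙-cong (≈-trans (≈-sym y∙Π) (∙-comm y Π)) ≈-refl 0 z≤n ⟩
      ((Π ∙ y) ∙ f) 0                  ≡⟨ ∙-assoc Π y f 0 z≤n ⟩
      (Π ∙ (y ∙ f)) 0                  ≡⟨ ∙-cong ≈-refl yf 0 z≤n ⟩
      (Π ∙ (d · (δ 0 ⊞ s · J))) 0      ≡⟨ ∙-· d Π _ 0 z≤n ⟩
      d * (Π ∙ (δ 0 ⊞ s · J)) 0        ≡⟨ cong (d *_) (trans (∙-⊞ Π (δ 0) (s · J) 0 z≤n) (cong₂ _+_ (trans (∙-identityʳ Π 0 z≤n) (sym ι-1)) (∙-· s Π J 0 z≤n))) ⟩
      d * (# 1 + s * j)                ∎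
      where open ≡-Reasoning
    4χ : # 4 * χ ≡ # 2 * (# 1 + # 1 * j)
    4χ = trans (move Ω Ω-powers.y∙g₀) (cong₂ (λ d s → d * (# 1 + s * j)) ∂-even (sym ι-1))
    4w : # 4 * w ≡ # 2 * M * (# 1 + (- # 1) * j)
    4w = trans (move W W-powers.y∙g₀) (cong (_* (# 1 + (- # 1) * j)) ∂-odd)

  Π∙Π : (Π ∙ Π) 0 ≡ M
  Π∙Π = trans (ε-∙ Π Π) (trans (S-cong λ a _ → sgn² a) (trans (∑-const (suc m) 1ℚ) (trans (*-identityʳ _) (sym M≡))))

  Θ : ℕ → ℚ
  Θ = # 2 · θ

  private
    -- The number of admissible i is m + 1 - c for c even and m - c for c odd. The alternation
    -- between the two is the component along Π.
    2θ : ∀ c → c ≤ m → # 2 * θ c ≡ M * 1ℚ + W c + Π c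
    2θ c c≤m with halve c
    ... | d , inj₁ refl = trans (cong (# 2 *_) (trans
      (S-cong λ i _ → 𝟙-cong
        (λ { (_ , _ , p , q) → double-≤′ p , ℕ.m+n≤o⇒m≤o∸n i (double-≤′ {i ℕ.+ d} {m} (≤-cast q (regroup i d) refl)) })
        (λ { (p , q) → ℕ.m≤m+n i c , ℕ.m≤m+n i c , double-mono p , ≤-cast (double-mono (ℕ.m≤o∸n⇒m+n≤o i d≤m q)) (sym (regroup i d)) refl })
        (tri? _ i i c) (d ℕ.≤? i ×-dec i ℕ.≤? m ℕ.∸ d))
      (trans (∑-interval (suc m) d (m ℕ.∸ d) (s≤s (ℕ.m∸n≤m m d)))
        (trans (cong #_ (trans (cong (ℕ._∸ d) (sym (ℕ.+-∸-assoc 1 d≤m))) (ℕ.∸-+-assoc (suc m) d d))) (trans (#-∸ {suc m} (ℕ.m≤n⇒m≤1+n c≤m)) (cong (_- # c) (#-suc m)))))))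
      (trans (solve 2 (λ m c → :# 2 :* (:# 1 :+ m :- c) := (m :+ :# 1) :* :# 1 :+ :- (:# 2 :* c :- m) :+ :# 1) refl (# m) (# c))
        (cong₂ (λ a b → M * a + W c + b) ι-1 (trans ι-1 (sym (sgn-double d)))))
      where d≤m = ℕ.≤-trans (ℕ.m≤m+n d d) c≤m
    ... | d , inj₂ refl = trans (cong (# 2 *_) (trans
      (S-cong λ i _ → 𝟙-cong
        (λ { (_ , _ , p , q) → double-< p , ℕ.m+n≤o⇒m≤o∸n i (≤-cast (double-< {i ℕ.+ d} {m} (≤-cast q (regroup-suc i d) refl)) (sym (ℕ.+-suc i d)) refl) })
        (λ { (p , q) → ℕ.m≤m+n i c , ℕ.m≤m+n i c , ℕ.≤-trans (s≤s (ℕ.+-monoʳ-≤ d (ℕ.n≤1+n d))) (double-mono p) ,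
          ≤-cast (ℕ.≤-trans (s≤s (ℕ.+-monoʳ-≤ (i ℕ.+ d) (ℕ.n≤1+n _))) (double-mono (≤-cast (ℕ.m≤o∸n⇒m+n≤o i d<m q) (ℕ.+-suc i d) refl))) (sym (regroup-suc i d)) refl })
        (tri? _ i i c) (suc d ℕ.≤? i ×-dec i ℕ.≤? m ℕ.∸ suc d))
      (trans (∑-interval (suc m) (suc d) (m ℕ.∸ suc d) (s≤s (ℕ.m∸n≤m m (suc d))))
        (trans (cong #_ (trans (ℕ.∸-+-assoc m (suc d) d) refl)) (#-∸ c≤m)))))
      (trans (solve 2 (λ m c → :# 2 :* (m :- c) := (m :+ :# 1) :* :# 1 :+ :- (:# 2 :* c :- m) :+ :- :# 1) refl (# m) (# c))
        (cong₂ (λ a b → M * a + W c + - b) ι-1 (trans ι-1 (sym (sgn-double d)))))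
      where d<m = ℕ.≤-trans (s≤s (ℕ.m≤m+n d d)) c≤m

    Θ∙ : ∀ f → Θ ∙ f ≈ (λ c → M * (Ω ∙ f) c + (W ∙ f) c + (Π ∙ f) c)
    Θ∙ f c c≤m = trans (∙-cong {f = Θ} {f′ = (M · Ω ⊞ W) ⊞ Π} 2θ ≈-refl c c≤m) (trans (⊞-∙ (M · Ω ⊞ W) Π f c c≤m)
      (cong (_+ (Π ∙ f) c) (trans (⊞-∙ (M · Ω) W f c c≤m) (cong (_+ (W ∙ f) c) (·-∙ M Ω f c c≤m)))))

    Π∙pow : ∀ f n → Π ∙ pow f n ≈ ((Π ∙ f) 0 ^ n) · Π
    Π∙pow f zero    c c≤m = trans (∙-identityʳ Π c c≤m) (sym (*-identityˡ _))
    Π∙pow f (suc n) = ≈-trans (∙-left-comm Π f (pow f n)) (≈-trans (∙-cong ≈-refl (Π∙pow f n)) (≈-trans (∙-· (κ ^ n) f Π)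
      (λ c c≤m → trans (cong (κ ^ n *_) (trans (∙-comm f Π c c≤m) (Π∙ f c c≤m))) (solve 3 (λ p k x → p :* (k :* x) := k :* p :* x) refl (κ ^ n) κ (Π c)))))
      where κ = (Π ∙ f) 0

    Θ∙Ω : ∀ k → Θ ∙ pow Ω (suc k) ≈ (λ c → M * pow Ω (suc (suc k)) c + χ * Π c)
    Θ∙Ω k c c≤m = trans (Θ∙ (pow Ω (suc k)) c c≤m) (trans (cong₂ (λ p q → M * pow Ω (suc (suc k)) c + p + q)
      (trans (sym (∙-assoc W Ω (pow Ω k) c c≤m)) (trans (∙-cong (≈-trans (∙-comm W Ω) Ω∙W) ≈-refl c c≤m) (trans (𝟘-∙ (pow Ω k) c c≤m) (sym ι-0))))
      (trans (Π∙pow Ω (suc k) c c≤m) (cong (_* Π c) (bit-^ χ-bit k))))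
      (solve 2 (λ x z → x :+ con ℤ.0ℤ :+ z := x :+ z) refl (M * pow Ω (suc (suc k)) c) (χ * Π c)))

    Θ∙W : ∀ k → Θ ∙ pow W (suc k) ≈ (λ c → pow W (suc (suc k)) c + (w ^ suc k) * Π c)
    Θ∙W k c c≤m = trans (Θ∙ (pow W (suc k)) c c≤m) (trans (cong₂ (λ p q → M * p + pow W (suc (suc k)) c + q)
      (trans (sym (∙-assoc Ω W (pow W k) c c≤m)) (trans (∙-cong Ω∙W ≈-refl c c≤m) (trans (𝟘-∙ (pow W k) c c≤m) (sym ι-0))))
      (Π∙pow W (suc k) c c≤m))
      (solve 3 (λ M x z → M :* con ℤ.0ℤ :+ x :+ z := x :+ z) refl M (pow W (suc (suc k)) c) ((w ^ suc k) * Π c)))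

    -- The three parts of Θ act by M χ, M (1 - χ) and M. The parity of m cancels in the sum, and
    -- this is why `excess` is a polynomial.
    Θ∙Π : Θ ∙ Π ≈ (# 2 * M) · Π
    Θ∙Π c c≤m = trans (Θ∙ Π c c≤m) (trans (cong₂ _+_ (cong₂ (λ p q → M * p + q)
        (trans (∙-comm Ω Π c c≤m) (Π∙ Ω c c≤m)) (trans (∙-comm W Π c c≤m) (trans (Π∙ W c c≤m) (cong (_* Π c) w-value)))) (trans (Π∙ Π c c≤m) (cong (_* Π c) Π∙Π)))
      (solve 3 (λ M x p → M :* (x :* p) :+ M :* (:# 1 :- x) :* p :+ M :* p := :# 2 :* M :* p) refl M χ (Π c)))

  d : ℕ → ℚ
  d g = excess g (# m)

  -- A single factor Ω annihilates W and acts on Π as χ. As χ is idempotent, it enters linearly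
  -- whatever the exponents are.
  Θᵍ∙Ωⁿ : ∀ g k → pow Θ g ∙ pow Ω (suc k) ≈ (λ c → M ^ g * pow Ω (suc (g ℕ.+ k)) c + χ * d g * Π c)
  Θᵍ∙Ωⁿ zero k c c≤m = trans (∙-identityˡ _ c c≤m) (trans (sym (*-identityˡ _)) (solve 3 (λ x k p → x := x :+ k :* :# 0 :* p) refl (1ℚ * pow Ω (suc k) c) χ (Π c)))
  Θᵍ∙Ωⁿ (suc g) k c c≤m = begin
    ((Θ ∙ pow Θ g) ∙ pow Ω (suc k)) c   ≡⟨ ∙-assoc Θ (pow Θ g) (pow Ω (suc k)) c c≤m ⟩
    (Θ ∙ (pow Θ g ∙ pow Ω (suc k))) c   ≡⟨ ∙-cong ≈-refl (Θᵍ∙Ωⁿ g k) c c≤m ⟩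
    (Θ ∙ ((M ^ g) · X ⊞ (χ * d g) · Π)) c  ≡⟨ ∙-⊞ Θ ((M ^ g) · X) ((χ * d g) · Π) c c≤m ⟩
    (Θ ∙ ((M ^ g) · X)) c + (Θ ∙ ((χ * d g) · Π)) c
      ≡⟨ cong₂ _+_ (trans (∙-· (M ^ g) Θ X c c≤m) (cong (M ^ g *_) (Θ∙Ω (g ℕ.+ k) c c≤m))) (trans (∙-· (χ * d g) Θ Π c c≤m) (cong (χ * d g *_) (Θ∙Π c c≤m))) ⟩
    M ^ g * (M * pow Ω (suc (suc (g ℕ.+ k))) c + χ * Π c) + χ * d g * (# 2 * M * Π c)
      ≡⟨ solve 6 (λ P M X x e p → P :* (M :* X :+ x :* p) :+ x :* e :* (:# 2 :* M :* p) := M :* P :* X :+ x :* (P :+ :# 2 :* M :* e) :* p) refl (M ^ g) M (pow Ω (suc (suc (g ℕ.+ k))) c) χ (d g) (Π c) ⟩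
    M * M ^ g * pow Ω (suc (suc (g ℕ.+ k))) c + χ * (M ^ g + # 2 * M * d g) * Π c ∎
    where
    open ≡-Reasoning
    X = pow Ω (suc (g ℕ.+ k))

  private
    -- χ and 1 - χ are complementary bits, so exactly one summand survives and both parities of m
    -- give the same value. This removes the parity from graphs without leaves.
    bits : ∀ g → M ^ suc g * χ + w ^ suc g ≡ M ^ suc g
    bits g = trans (cong (M ^ suc g * χ +_) (trans (cong (_^ suc g) w-value) (trans (*-^ M (# 1 - χ) (suc g)) (cong (M ^ suc g *_) (bit-^ ¬χ-bit g)))))
      (solve 2 (λ P x → P :* x :+ P :* (:# 1 :- x) := P) refl (M ^ suc g) χ)
      where
      ¬χ-bit : # 1 - χ ≡ 1ℚ ⊎ # 1 - χ ≡ 0ℚ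
      ¬χ-bit with χ-bit
      ... | inj₁ e = inj₂ (trans (cong (λ z → # 1 - z) (trans e (sym ι-1))) (-‿inverseʳ (# 1)))
      ... | inj₂ e = inj₁ (trans (cong (λ z → # 1 - z) (trans e (sym ι-0))) (trans (solve 0 (:# 1 :- con ℤ.0ℤ := :# 1) refl) ι-1))

  Θᵍ : ∀ g → pow Θ (suc g) ≈ (λ c → M ^ suc g * pow Ω (suc g) c + pow W (suc g) c + d (suc g) * Π c)
  Θᵍ zero c c≤m = trans (Θ∙ (δ 0) c c≤m) (trans (cong₂ _+_ (cong (λ z → z * pow Ω 1 c + pow W 1 c) (sym (*-identityʳ M))) (∙-identityʳ Π c c≤m))
    (cong (M ^ 1 * pow Ω 1 c + pow W 1 c +_) (trans (sym (*-identityˡ (Π c))) (cong (_* Π c) (sym (trans (cong (1ℚ +_) (trans (cong (# 2 * M *_) ι-0) (zeroʳ _))) (+-identityʳ 1ℚ)))))))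
  Θᵍ (suc g) c c≤m = begin
    (Θ ∙ pow Θ (suc g)) c  ≡⟨ ∙-cong ≈-refl (Θᵍ g) c c≤m ⟩
    (Θ ∙ (((M ^ suc g) · X ⊞ Y) ⊞ d (suc g) · Π)) c
      ≡⟨ trans (∙-⊞ Θ ((M ^ suc g) · X ⊞ Y) (d (suc g) · Π) c c≤m) (cong₂ _+_ (∙-⊞ Θ ((M ^ suc g) · X) Y c c≤m) refl) ⟩
    (Θ ∙ ((M ^ suc g) · X)) c + (Θ ∙ Y) c + (Θ ∙ (d (suc g) · Π)) c
      ≡⟨ cong₂ _+_ (cong₂ _+_ (trans (∙-· (M ^ suc g) Θ X c c≤m) (cong (M ^ suc g *_) (Θ∙Ω g c c≤m))) (Θ∙W g c c≤m)) (trans (∙-· (d (suc g)) Θ Π c c≤m) (cong (d (suc g) *_) (Θ∙Π c c≤m))) ⟩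
    M ^ suc g * (M * X′ + χ * Π c) + (Y′ + w ^ suc g * Π c) + d (suc g) * (# 2 * M * Π c)
      ≡⟨ solve 8 (λ P M X x p Y q e → P :* (M :* X :+ x :* p) :+ (Y :+ q :* p) :+ e :* (:# 2 :* M :* p) := M :* P :* X :+ Y :+ ((P :* x :+ q) :+ :# 2 :* M :* e) :* p) refl (M ^ suc g) M X′ χ (Π c) Y′ (w ^ suc g) (d (suc g)) ⟩
    M * M ^ suc g * X′ + Y′ + ((M ^ suc g * χ + w ^ suc g) + # 2 * M * d (suc g)) * Π c
      ≡⟨ cong (λ z → M * M ^ suc g * X′ + Y′ + (z + # 2 * M * d (suc g)) * Π c) (bits g) ⟩
    M * M ^ suc g * X′ + Y′ + d (suc (suc g)) * Π c ∎
    where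
    open ≡-Reasoning
    X = pow Ω (suc g)
    Y = pow W (suc g)
    X′ = pow Ω (suc (suc g)) c
    Y′ = pow W (suc (suc g)) c

½ : ℚ
½ = recip 1

½^*2^ : ∀ g → ½ ^ g * # 2 ^ g ≡ 1ℚ
½^*2^ zero    = *-identityˡ 1ℚ
½^*2^ (suc g) = trans (solve 4 (λ a b p q → a :* p :* (b :* q) := b :* a :* (p :* q)) refl ½ (# 2) (½ ^ g) (# 2 ^ g)) (trans (cong₂ _*_ (*-recip 1) (½^*2^ g)) (*-identityˡ 1ℚ))

poly-^ : ∀ {f} n → IsPoly f → IsPoly (λ x → f x ^ n)
poly-^ zero    p = poly-const 1ℚ
poly-^ (suc n) p = poly-* p (poly-^ n p)

excess-poly : ∀ g → IsPoly (excess g)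
excess-poly zero    = poly-const _
excess-poly (suc g) = poly-+ (poly-^ g μ+1) (poly-* (poly-* (poly-const _) μ+1) (excess-poly g))
  where μ+1 = poly-+ poly-id (poly-const (# 1))

module _ (m : ℕ) where
  open EvenFormula m

  θ≡½Θ : ∀ f g → ε (f ∙ pow θ g) ≡ ½ ^ g * ε (f ∙ pow Θ g)
  θ≡½Θ f g = sym (trans (cong (½ ^ g *_) (trans (∙-cong ≈-refl (pow-· (# 2) θ g) 0 z≤n) (∙-· (# 2 ^ g) f (pow θ g) 0 z≤n)))
    (trans (sym (*-assoc (½ ^ g) (# 2 ^ g) _)) (trans (cong (_* ε (f ∙ pow θ g)) (½^*2^ g)) (*-identityˡ _))))

evenCount-closed : ∀ g → PolyValue λ m → let open EvenFormula m in ε (pow Ω 0 ∙ pow θ g)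
evenCount-closed zero    = (λ _ → 1ℚ) , poly-const 1ℚ , λ m → EvenFormula.∙-identityˡ m (δ 0) 0 z≤n
evenCount-closed (suc g) =
  (λ μ → ½ ^ suc g * ((μ + # 1) ^ suc g * FΩ μ + FW μ + excess (suc g) μ * 1ℚ)) ,
  poly-* (poly-const _) (poly-+ (poly-+ (poly-* (poly-^ (suc g) (poly-+ poly-id (poly-const (# 1)))) (Even.family-poly g evenStart-poly)) (Odd.family-poly g evenStart-poly)) (poly-* (excess-poly (suc g)) (poly-const 1ℚ))) ,
  λ m → let open EvenFormula m in trans (θ≡½Θ m (δ 0) (suc g)) (cong (½ ^ suc g *_) (trans (∙-identityˡ (pow Θ (suc g)) 0 z≤n) (trans (Θᵍ g 0 z≤n)
    (cong₂ (λ p q → M ^ suc g * p + q + d (suc g) * 1ℚ)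
      (trans (sym (Ω-family g 0 z≤n)) (cong (Even.family g (# m)) pt-0))
      (trans (sym (W-family g 0 z≤n)) (cong (Odd.family g (# m)) pt-0))))))
  where
  module Even = CentralFactorial.Boundary evenSeed (# 2) 1ℚ evenStart evenStart-poly
  module Odd = CentralFactorial.Boundary oddSeed (# 2) 1ℚ evenStart evenStart-poly
  FΩ FW : ℚ → ℚ
  FΩ μ = Even.family g μ (evenStart μ)
  FW μ = Odd.family g μ (evenStart μ)

-- For k + 1 leaves, all dependence on the parity of m sits in χ. Its coefficient is a polynomial
-- that vanishes for g = 0.
evenCount-open : ∀ k g → Σ (ℚ → ℚ) λ f → IsPoly f ×
  (∀ m → let open EvenFormula m in ε (pow Ω (suc k) ∙ pow θ g) ≡ f (# m) + χ * (½ ^ g * excess g (# m)))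
evenCount-open k g =
  (λ μ → ½ ^ g * ((μ + # 1) ^ g * Even.family (g ℕ.+ k) μ (evenStart μ))) ,
  poly-* (poly-const _) (poly-* (poly-^ g (poly-+ poly-id (poly-const (# 1)))) (Even.family-poly (g ℕ.+ k) evenStart-poly)) ,
  λ m → let open EvenFormula m in trans (θ≡½Θ m (pow Ω (suc k)) g) (trans (cong (½ ^ g *_) (trans (∙-comm (pow Ω (suc k)) (pow Θ g) 0 z≤n) (trans (Θᵍ∙Ωⁿ g k 0 z≤n)
    (cong₂ (λ p q → M ^ g * p + q) (trans (sym (Ω-family (g ℕ.+ k) 0 z≤n)) (cong (Even.family (g ℕ.+ k) (# m)) pt-0)) (*-identityʳ (χ * d g))))))
    (solve 4 (λ h P x e → h :* (P :+ x :* e) := h :* P :+ x :* (h :* e)) refl (½ ^ g) _ χ (d g)))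
  where
  module Even = CentralFactorial.Boundary evenSeed (# 2) 1ℚ evenStart evenStart-poly

open import Data.Nat using (_%_)
open import Data.Fin using (Fin; zero; suc; _≟_; punchIn; inject₁; fromℕ; toℕ; fromℕ<)
import Data.Fin.Properties as Fin
open import Data.List using (_++_; foldr; concatMap; tabulate; length; allFin)
open import Data.Vec using (Vec; []; _∷_; lookup; map)
open import Data.Bool using (if_then_else_; Bool; true; false; T; _∧_)
open import Data.Empty using (⊥)
open import Function using (id)
open import Relation.Nullary.Decidable using (⌊_⌋)
open import Relation.Binary.PropositionalEquality using (subst₂)
import Algebra.Properties.CommutativeMonoid.Sum as MonoidSum
import Relation.Binary.Reasoning.Setoid as SetoidReasoning
open import Function.Definitions using (Injective)
open import Data.Integer using (-[1+_])
open import Data.Integer.Tactic.RingSolver using () renaming (solve-∀ to int-solve-∀)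
import Data.Bool.Properties as Bool
import Data.Vec.Properties as Vec
open import Data.List.Membership.Propositional using (_∈_; lose)
open import Data.List.Membership.Propositional.Properties using (∈-concatMap⁺; ∈-allFin; ∈-++⁺ˡ; ∈-++⁺ʳ)
open import Data.List.Relation.Unary.Any using (here; there)
open import Data.Sum.Function.Propositional using (_⊎-↔_)
open import Data.Unit using (tt)
open import Function.Bundles using (_↔_; mk↔ₛ′; Equivalence)
open import Function.Properties.Inverse using (↔-sym; ↔-trans)
import Data.Nat.DivMod as ℕ
import Data.Fin.Permutation as Perm

-- State sums

-- A conditional on an explicit decision, so that local lemmas can take the decision as an argument
-- and match on it.
choose : {X : Set} → Dec P → X → X → X
choose (yes _) a b = a
choose (no _)  a b = b

choose-yes : {X : Set} (d : Dec P) {a b : X} → P → choose d a b ≡ a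
choose-yes (yes _) p = refl
choose-yes (no ¬p) p = ⊥-elim (¬p p)

choose-no : {X : Set} (d : Dec P) {a b : X} → ¬ P → choose d a b ≡ b
choose-no (yes p) ¬p = ⊥-elim (¬p p)
choose-no (no _)  ¬p = refl

∑Vec : ℕ → ∀ n → (Vec ℕ n → ℚ) → ℚ
∑Vec M zero    f = f []
∑Vec M (suc n) f = ∑ M (λ i → ∑Vec M n (λ l → f (i ∷ l)))

∑Vec-cong : ∀ M n {f g : Vec ℕ n → ℚ} → (∀ l → (∀ e → lookup l e < M) → f l ≡ g l) → ∑Vec M n f ≡ ∑Vec M n g
∑Vec-cong M zero    h = h [] (λ ())
∑Vec-cong M (suc n) h = ∑-cong M λ i i<M → ∑Vec-cong M n λ l l<M → h (i ∷ l) λ { zero → i<M ; (suc e) → l<M e }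

module FinProduct (𝓜 : CommutativeMonoid 0ℓ 0ℓ) where
  open CommutativeMonoid 𝓜 renaming (refl to ≈-refl; sym to ≈-sym; trans to ≈-trans; reflexive to ≈-reflexive)
  open MonoidSum 𝓜 using (sum; sum-cong-≋; sum-remove; ∑-distrib-+; sum-replicate-zero)

  sel skip : Dec P → Carrier → Carrier
  sel  d a = choose d a ε
  skip d a = choose d ε a

  opaque
    ∏ : ∀ {n} → (Fin n → Carrier) → Carrier
    ∏ = sum

    ∏-empty : (f : Fin 0 → Carrier) → ∏ f ≡ ε
    ∏-empty f = refl

    ∏-suc : ∀ {n} (f : Fin (suc n) → Carrier) → ∏ f ≡ f zero ∙ ∏ (f ∘ suc)
    ∏-suc f = refl

    ∏-cong : ∀ {n} {f g : Fin n → Carrier} → (∀ i → f i ≈ g i) → ∏ f ≈ ∏ g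
    ∏-cong = sum-cong-≋

    ∏-∙ : ∀ {n} (f g : Fin n → Carrier) → ∏ (λ i → f i ∙ g i) ≈ ∏ f ∙ ∏ g
    ∏-∙ = ∑-distrib-+

    ∏-ε : ∀ {n} {f : Fin n → Carrier} → (∀ i → f i ≈ ε) → ∏ f ≈ ε
    ∏-ε {n} eq = ≈-trans (∏-cong eq) (sum-replicate-zero n)

    ∏-sel : ∀ {n} (i : Fin n) a → ∏ (λ j → sel (i ≟ j) a) ≈ a
    ∏-sel {suc n} i a = ≈-trans (sum-remove {i = i} (λ j → sel (i ≟ j) a)) (≈-trans
      (∙-cong (≈-reflexive (choose-yes (i ≟ i) refl)) (∏-ε λ k → ≈-reflexive (choose-no (i ≟ punchIn i k) (λ e → Fin.punchInᵢ≢i i k (sym e)))))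
      (identityʳ a))

  ∏-split : ∀ {n} (i : Fin n) f → ∏ f ≈ f i ∙ ∏ (λ j → skip (i ≟ j) (f j))
  ∏-split i f = ≈-trans (∏-cong λ j → factor j (i ≟ j)) (≈-trans (∏-∙ _ _) (∙-congʳ (∏-sel i (f i))))
    where
    factor : ∀ j (d : Dec (i ≡ j)) → f j ≈ sel d (f i) ∙ skip d (f j)
    factor j (yes refl) = ≈-sym (identityʳ _)
    factor j (no _)     = ≈-sym (identityˡ _)

  sel-cong : (d : Dec P) → ∀ {a b} → a ≈ b → sel d a ≈ sel d b
  sel-cong (yes _) p = p
  sel-cong (no _)  p = ≈-refl

  sel-∙ : (d : Dec P) → ∀ a b → sel d (a ∙ b) ≈ sel d a ∙ sel d b
  sel-∙ (yes _) a b = ≈-refl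
  sel-∙ (no _)  a b = ≈-sym (identityˡ ε)

module ℚ∏ = FinProduct (CommutativeRing.*-commutativeMonoid ℚ-ring)

-- What contracting a graph requires of the algebra: the fusion rules themselves do not appear, only
-- the effect of summing over the label of one edge.
record ContractionAlgebra : Set₁ where
  field
    commutativeMonoid : CommutativeMonoid 0ℓ 0ℓ
  open CommutativeMonoid commutativeMonoid public renaming (refl to ≈-refl; sym to ≈-sym; trans to ≈-trans; reflexive to ≈-reflexive)
  field
    η             : Carrier → ℚ
    η-cong        : ∀ {a b} → a ≈ b → η a ≡ η b
    η-ε           : η ε ≡ 1ℚ
    size          : ℕ
    b             : ℕ → Carrier
    θ             : Carrier
    contract      : ∀ x y → ∑ size (λ i → η (x ∙ b i) * η (y ∙ b i)) ≡ η (x ∙ y)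
    contract-loop : ∀ x → ∑ size (λ i → η (x ∙ (b i ∙ b i))) ≡ η (x ∙ θ)

-- A block is named by its representative; the second component counts the
-- independent cycles of each block.
Blocks : ℕ → Set
Blocks V = (Fin V → Fin V) × (Fin V → ℕ)

closeCycle : ∀ {V} → Fin V → Blocks V → Blocks V
closeCycle r (ρ , γ) = ρ , λ j → choose (r ≟ j) (suc (γ j)) (γ j)

-- The index s survives with an empty block and no cycles; it then contributes the factor η ε = 1,
-- and products can keep running over all of `Fin V`.
fuse : ∀ {V} → Fin V → Fin V → Blocks V → Blocks V
fuse r s (ρ , γ) = (λ v → choose (s ≟ ρ v) r (ρ v)) , λ j → choose (s ≟ j) 0 (choose (r ≟ j) (γ j ℕ.+ γ s) (γ j))

unite : ∀ {V} → Fin V × Fin V → Blocks V → Blocks V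
unite (p , q) (ρ , γ) = choose (ρ p ≟ ρ q) (closeCycle (ρ p) (ρ , γ)) (fuse (ρ p) (ρ q) (ρ , γ))

blocks : ∀ {V n} → (Fin n → Fin V × Fin V) → Blocks V
blocks {n = zero}  φ = id , λ _ → 0
blocks {n = suc n} φ = unite (φ zero) (blocks (φ ∘ suc))

module StateSum (𝓐 : ContractionAlgebra) {V : ℕ} where
  open ContractionAlgebra 𝓐
  open FinProduct commutativeMonoid
  open ℚ∏ using () renaming (∏ to ∏ℚ)
  open SetoidReasoning setoid

  θ^ : ℕ → Carrier
  θ^ zero    = ε
  θ^ (suc n) = θ ∙ θ^ n

  θ^-+ : ∀ m n → θ^ (m ℕ.+ n) ≈ θ^ m ∙ θ^ n
  θ^-+ zero    n = ≈-sym (identityˡ _)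
  θ^-+ (suc m) n = ≈-trans (∙-congˡ (θ^-+ m n)) (≈-sym (assoc θ (θ^ m) (θ^ n)))

  attach : Fin V × Fin V → Carrier → (Fin V → Carrier) → Fin V → Carrier
  attach (p , q) a x v = sel (p ≟ v) a ∙ (sel (q ≟ v) a ∙ x v)

  Z : ∀ {n} → (Fin n → Fin V × Fin V) → (Fin V → Carrier) → ℚ
  Z {zero}  φ x = ∏ℚ (λ v → η (x v))
  Z {suc n} φ x = ∑ size (λ i → Z (φ ∘ suc) (attach (φ zero) (b i) x))

  block : (Fin V → Fin V) → (Fin V → Carrier) → Fin V → Carrier
  block ρ x j = ∏ (λ v → sel (ρ v ≟ j) (x v))

  F : Blocks V → (Fin V → Carrier) → ℚ
  F (ρ , γ) x = ∏ℚ (λ j → η (θ^ (γ j) ∙ block ρ x j))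

  private
    block-sel : ∀ (ρ : Fin V → Fin V) p j a → ∏ (λ v → sel (ρ v ≟ j) (sel (p ≟ v) a)) ≈ sel (ρ p ≟ j) a
    block-sel ρ p j a = ≈-trans (∏-cong λ v → swap v (p ≟ v)) (∏-sel p (sel (ρ p ≟ j) a))
      where
      sel-ε : (d : Dec P) → sel d ε ≈ ε
      sel-ε (yes _) = ≈-refl
      sel-ε (no _)  = ≈-refl
      swap : ∀ v (d : Dec (p ≡ v)) → sel (ρ v ≟ j) (sel d a) ≈ sel d (sel (ρ p ≟ j) a)
      swap v (yes refl) = ≈-refl
      swap v (no _)     = sel-ε (ρ v ≟ j)

    block-attach : ∀ (ρ : Fin V → Fin V) p q a x j → block ρ (attach (p , q) a x) j ≈ sel (ρ p ≟ j) a ∙ (sel (ρ q ≟ j) a ∙ block ρ x j)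
    block-attach ρ p q a x j = begin
      ∏ (λ v → sel (ρ v ≟ j) (sel (p ≟ v) a ∙ (sel (q ≟ v) a ∙ x v)))
        ≈⟨ (∏-cong λ v → ≈-trans (sel-∙ (ρ v ≟ j) _ _) (∙-congˡ (sel-∙ (ρ v ≟ j) _ _))) ⟩
      ∏ (λ v → sel (ρ v ≟ j) (sel (p ≟ v) a) ∙ (sel (ρ v ≟ j) (sel (q ≟ v) a) ∙ sel (ρ v ≟ j) (x v)))
        ≈⟨ ≈-trans (∏-∙ _ _) (∙-congˡ (∏-∙ _ _)) ⟩
      ∏ (λ v → sel (ρ v ≟ j) (sel (p ≟ v) a)) ∙ (∏ (λ v → sel (ρ v ≟ j) (sel (q ≟ v) a)) ∙ block ρ x j)
        ≈⟨ ∙-cong (block-sel ρ p j a) (∙-congʳ (block-sel ρ q j a)) ⟩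
      sel (ρ p ≟ j) a ∙ (sel (ρ q ≟ j) a ∙ block ρ x j) ∎

    module _ (p q : Fin V) (ρ : Fin V → Fin V) (γ : Fin V → ℕ) (x : Fin V → Carrier) where
      c : Fin V → Carrier
      c j = θ^ (γ j) ∙ block ρ x j

      term : ℕ → Fin V → ℚ
      term i j = η (θ^ (γ j) ∙ block ρ (attach (p , q) (b i) x) j)

      swap-in : ∀ {j a a′} → a ≈ a′ → θ^ (γ j) ∙ (a ∙ block ρ x j) ≈ c j ∙ a′
      swap-in {j} {a} {a′} e = ≈-trans (∙-congˡ (comm a _)) (≈-trans (≈-sym (assoc _ _ a)) (∙-congˡ e))

      term≡ : ∀ i j → term i j ≡ η (c j ∙ (sel (ρ p ≟ j) (b i) ∙ sel (ρ q ≟ j) (b i)))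
      term≡ i j = η-cong (≈-trans (∙-congˡ (≈-trans (block-attach ρ p q (b i) x j) (≈-sym (assoc _ _ _)))) (swap-in ≈-refl))

      away : ∀ i {j} → ρ p ≢ j → ρ q ≢ j → term i j ≡ η (c j)
      away i {j} p≢ q≢ = trans (term≡ i j) (η-cong (≈-trans (∙-congˡ (≈-trans (∙-cong (≈-reflexive (choose-no (ρ p ≟ j) p≢)) (≈-reflexive (choose-no (ρ q ≟ j) q≢))) (identityˡ ε))) (identityʳ _)))

      skip-congℚ : (d : Dec P) → ∀ {a a′} → (¬ P → a ≡ a′) → ℚ∏.skip d a ≡ ℚ∏.skip d a′
      skip-congℚ (yes _) e = refl
      skip-congℚ (no ¬p) e = e ¬p

      contract-same : ρ p ≡ ρ q → ∑ size (λ i → ∏ℚ (term i)) ≡ F (closeCycle (ρ p) (ρ , γ)) x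
      contract-same e = trans (∑-cong size λ i _ → trans (ℚ∏.∏-split r (term i)) (cong₂ _*_ (at-r i) (ℚ∏.∏-cong λ j → skip-congℚ (r ≟ j) λ r≢j → away i r≢j (λ e′ → r≢j (trans e e′)))))
        (trans (∑-*ʳ size rest _) (trans (cong (_* rest) (contract-loop (c r)))
          (sym (trans (ℚ∏.∏-split r _) (cong₂ _*_
            (η-cong (≈-trans (∙-congʳ (≈-reflexive (cong θ^ (choose-yes (r ≟ r) refl)))) (≈-trans (assoc θ _ _) (comm θ (c r)))))
            (ℚ∏.∏-cong λ j → skip-congℚ (r ≟ j) λ r≢j → cong (λ g → η (θ^ g ∙ block ρ x j)) (choose-no (r ≟ j) r≢j)))))))
        where
        r = ρ p
        rest = ∏ℚ (λ j → ℚ∏.skip (r ≟ j) (η (c j)))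
        at-r : ∀ i → term i r ≡ η (c r ∙ (b i ∙ b i))
        at-r i = trans (term≡ i r) (η-cong (∙-congˡ (∙-cong (≈-reflexive (choose-yes (r ≟ r) refl)) (≈-reflexive (choose-yes (ρ q ≟ r) (sym e))))))

      contract-distinct : ρ p ≢ ρ q →
        ∑ size (λ i → ∏ℚ (term i)) ≡ F (fuse (ρ p) (ρ q) (ρ , γ)) x
      contract-distinct r≢s = trans (∑-cong size λ i _ → trans (split₂ (term i)) (cong₂ _*_ (at-r i) (cong₂ _*_ (at-s i) (rest-cong (term i) (away i)))))
        (trans (∑-cong size λ i _ → sym (*-assoc (η (c r ∙ b i)) (η (c s ∙ b i)) rest)) (trans (∑-*ʳ size rest _) (trans (cong (_* rest) (contract (c r) (c s)))
          (sym (trans (split₂ target) (trans (cong₂ _*_ target-r (cong₂ _*_ target-s (rest-cong target target-j))) (cong (η (c r ∙ c s) *_) (*-identityˡ rest))))))))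
        where
        r = ρ p
        s = ρ q
        ρ′ : Fin V → Fin V
        ρ′ v = choose (s ≟ ρ v) r (ρ v)
        γ′ : Fin V → ℕ
        γ′ j = choose (s ≟ j) 0 (choose (r ≟ j) (γ j ℕ.+ γ s) (γ j))
        target : Fin V → ℚ
        target j = η (θ^ (γ′ j) ∙ block ρ′ x j)
        rest = ∏ℚ (λ j → ℚ∏.skip (s ≟ j) (ℚ∏.skip (r ≟ j) (η (c j))))
        split₂ : ∀ (f : Fin V → ℚ) → ∏ℚ f ≡ f r * (f s * ∏ℚ (λ j → ℚ∏.skip (s ≟ j) (ℚ∏.skip (r ≟ j) (f j))))
        split₂ f = trans (ℚ∏.∏-split r f) (cong (f r *_) (trans (ℚ∏.∏-split s _) (cong (_* ∏ℚ (λ j → ℚ∏.skip (s ≟ j) (ℚ∏.skip (r ≟ j) (f j)))) (choose-no (r ≟ s) r≢s))))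
        rest-cong : ∀ (f : Fin V → ℚ) → (∀ {j} → r ≢ j → s ≢ j → f j ≡ η (c j)) → ∏ℚ (λ j → ℚ∏.skip (s ≟ j) (ℚ∏.skip (r ≟ j) (f j))) ≡ rest
        rest-cong f h = ℚ∏.∏-cong λ j → skip-congℚ (s ≟ j) λ s≢j → skip-congℚ (r ≟ j) λ r≢j → h r≢j s≢j
        at-r : ∀ i → term i r ≡ η (c r ∙ b i)
        at-r i = trans (term≡ i r) (η-cong (∙-congˡ (≈-trans (∙-cong (≈-reflexive (choose-yes (r ≟ r) refl)) (≈-reflexive (choose-no (s ≟ r) (λ e → r≢s (sym e))))) (identityʳ _))))
        at-s : ∀ i → term i s ≡ η (c s ∙ b i)
        at-s i = trans (term≡ i s) (η-cong (∙-congˡ (≈-trans (∙-cong (≈-reflexive (choose-no (r ≟ s) r≢s)) (≈-reflexive (choose-yes (s ≟ s) refl))) (identityˡ _))))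
        block-r : block ρ′ x r ≈ block ρ x r ∙ block ρ x s
        block-r = ≈-trans (∏-cong λ v → both v (s ≟ ρ v)) (∏-∙ _ _)
          where
          both : ∀ v (d : Dec (s ≡ ρ v)) → sel (choose d r (ρ v) ≟ r) (x v) ≈ sel (ρ v ≟ r) (x v) ∙ sel (ρ v ≟ s) (x v)
          both v (yes e) = ≈-trans (≈-reflexive (choose-yes (r ≟ r) refl)) (≈-sym (≈-trans (∙-cong (≈-reflexive (choose-no (ρ v ≟ r) (λ e′ → r≢s (sym (trans e e′))))) (≈-reflexive (choose-yes (ρ v ≟ s) (sym e)))) (identityˡ _)))
          both v (no s≢) = ≈-sym (≈-trans (∙-congˡ (≈-reflexive (choose-no (ρ v ≟ s) (λ e → s≢ (sym e))))) (identityʳ _))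
        block-s : block ρ′ x s ≈ ε
        block-s = ∏-ε λ v → none v (s ≟ ρ v)
          where
          none : ∀ v (d : Dec (s ≡ ρ v)) → sel (choose d r (ρ v) ≟ s) (x v) ≈ ε
          none v (yes e) = ≈-reflexive (choose-no (r ≟ s) r≢s)
          none v (no s≢) = ≈-reflexive (choose-no (ρ v ≟ s) (λ e → s≢ (sym e)))
        block-j : ∀ {j} → r ≢ j → s ≢ j → block ρ′ x j ≈ block ρ x j
        block-j {j} r≢j s≢j = ∏-cong λ v → same v (s ≟ ρ v)
          where
          same : ∀ v (d : Dec (s ≡ ρ v)) → sel (choose d r (ρ v) ≟ j) (x v) ≈ sel (ρ v ≟ j) (x v)
          same v (yes e) = ≈-trans (≈-reflexive (choose-no (r ≟ j) r≢j)) (≈-sym (≈-reflexive (choose-no (ρ v ≟ j) (λ e′ → s≢j (trans e e′)))))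
          same v (no _)  = ≈-refl
        target-r : target r ≡ η (c r ∙ c s)
        target-r = η-cong (begin
          θ^ (γ′ r) ∙ block ρ′ x r  ≈⟨ ∙-cong (≈-trans (≈-reflexive (cong θ^ (trans (choose-no (s ≟ r) (λ e → r≢s (sym e))) (choose-yes (r ≟ r) refl)))) (θ^-+ (γ r) (γ s))) block-r ⟩
          (θ^ (γ r) ∙ θ^ (γ s)) ∙ (block ρ x r ∙ block ρ x s)  ≈⟨ assoc _ _ _ ⟩
          θ^ (γ r) ∙ (θ^ (γ s) ∙ (block ρ x r ∙ block ρ x s))  ≈⟨ ∙-congˡ (≈-trans (≈-sym (assoc _ _ _)) (≈-trans (∙-congʳ (comm _ _)) (assoc _ _ _))) ⟩
          θ^ (γ r) ∙ (block ρ x r ∙ (θ^ (γ s) ∙ block ρ x s))  ≈⟨ assoc _ _ _ ⟨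
          c r ∙ c s ∎)
        target-s : target s ≡ 1ℚ
        target-s = trans (η-cong (≈-trans (∙-cong (≈-reflexive (cong θ^ (choose-yes (s ≟ s) refl))) block-s) (identityˡ ε))) η-ε
        target-j : ∀ {j} → r ≢ j → s ≢ j → target j ≡ η (c j)
        target-j {j} r≢j s≢j = η-cong (∙-cong (≈-reflexive (cong θ^ (trans (choose-no (s ≟ j) s≢j) (choose-no (r ≟ j) r≢j)))) (block-j r≢j s≢j))

      contract-edge : ∑ size (λ i → F (ρ , γ) (attach (p , q) (b i) x)) ≡ F (unite (p , q) (ρ , γ)) x
      contract-edge = go (ρ p ≟ ρ q)
        where
        go : (d : Dec (ρ p ≡ ρ q)) → ∑ size (λ i → ∏ℚ (term i)) ≡ F (choose d (closeCycle (ρ p) (ρ , γ)) (fuse (ρ p) (ρ q) (ρ , γ))) x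
        go (yes e) = contract-same e
        go (no r≢) = contract-distinct r≢

  -- Because x is arbitrary, the later edges can be contracted while the label of the first is
  -- already attached to its ends. What remains is the sum over that one label.
  Z≡F : ∀ {n} (φ : Fin n → Fin V × Fin V) x → Z φ x ≡ F (blocks φ) x
  Z≡F {zero} φ x = ℚ∏.∏-cong λ j → η-cong (≈-sym (≈-trans (identityˡ _) (≈-trans (∏-cong λ v → flip v j (v ≟ j) (j ≟ v)) (∏-sel j (x j)))))
    where
    flip : ∀ v j (d : Dec (v ≡ j)) (d′ : Dec (j ≡ v)) → sel d (x v) ≈ sel d′ (x j)
    flip v j (yes refl) (yes _) = ≈-refl
    flip v j (yes e)    (no ¬e) = ⊥-elim (¬e (sym e))
    flip v j (no ¬e)    (yes e) = ⊥-elim (¬e (sym e))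
    flip v j (no _)     (no _)  = ≈-refl
  Z≡F {suc n} φ x = trans (∑-cong size λ i _ → Z≡F (φ ∘ suc) (attach (φ zero) (b i) x))
    (contract-edge (proj₁ (φ zero)) (proj₂ (φ zero)) (proj₁ (blocks (φ ∘ suc))) (proj₂ (blocks (φ ∘ suc))) x)

  F-connected : ∀ ρ γ x r → (∀ v → ρ v ≡ r) → (∀ j → r ≢ j → γ j ≡ 0) → F (ρ , γ) x ≡ η (θ^ (γ r) ∙ ∏ x)
  F-connected ρ γ x r const γ≡0 = trans (ℚ∏.∏-split r _) (trans
    (cong₂ _*_ (η-cong (∙-congˡ (∏-cong λ v → ≈-reflexive (choose-yes (ρ v ≟ r) (const v))))) (ℚ∏.∏-ε λ j → one j (r ≟ j)))
    (*-identityʳ _))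
    where
    one : ∀ j (d : Dec (r ≡ j)) → ℚ∏.skip d (η (θ^ (γ j) ∙ block ρ x j)) ≡ 1ℚ
    one j (yes _)  = refl
    one j (no r≢j) = trans (η-cong (≈-trans (∙-cong (≈-reflexive (cong θ^ (γ≡0 j r≢j))) (∏-ε λ v → ≈-reflexive (choose-no (ρ v ≟ j) (λ e → r≢j (trans (sym (const v)) e))))) (identityˡ ε))) η-ε

  private
    attachAll : ∀ {n} → (Fin n → Fin V × Fin V) → Vec ℕ n → (Fin V → Carrier) → Fin V → Carrier
    attachAll φ []      x = x
    attachAll φ (i ∷ l) x = attachAll (φ ∘ suc) l (attach (φ zero) (b i) x)

    Z-unfold : ∀ {n} (φ : Fin n → Fin V × Fin V) x → Z φ x ≡ ∑Vec size n (λ l → ∏ℚ (λ v → η (attachAll φ l x v)))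
    Z-unfold {zero}  φ x = refl
    Z-unfold {suc n} φ x = ∑-cong size λ i _ → Z-unfold (φ ∘ suc) (attach (φ zero) (b i) x)

  mprod : {E : Set} → (E → Carrier) → List E → Carrier
  mprod g = foldr (λ e a → g e ∙ a) ε

  private
    mprod-++ : {E : Set} (g : E → Carrier) (xs ys : List E) → mprod g (xs ++ ys) ≈ mprod g xs ∙ mprod g ys
    mprod-++ g []       ys = ≈-sym (identityˡ _)
    mprod-++ g (e ∷ xs) ys = ≈-trans (∙-congˡ (mprod-++ g xs ys)) (≈-sym (assoc _ _ _))

    mprod-if : {E : Set} (g : E → Carrier) (d : Dec P) (e : E) → mprod g (if ⌊ d ⌋ then e ∷ [] else []) ≈ sel d (g e)
    mprod-if g (yes _) e = identityʳ (g e)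
    mprod-if g (no _)  e = ≈-refl

  module _ {nE : ℕ} (ends : Fin nE → Fin V × Fin V) where

    private
      G : Graph
      G = record { nV = V ; nE = nE ; ends = ends }

      near : Fin V → Fin nE → List (Fin nE)
      near v e = (if ⌊ proj₁ (ends e) ≟ v ⌋ then e ∷ [] else []) ++ (if ⌊ proj₂ (ends e) ≟ v ⌋ then e ∷ [] else [])

      attachAll≈ : ∀ {n} (f : Fin n → Fin nE) (l : Vec ℕ n) (g : Fin nE → Carrier) → (∀ i → g (f i) ≡ b (lookup l i)) → ∀ x v →
        attachAll (ends ∘ f) l x v ≈ mprod g (concatMap (near v) (tabulate f)) ∙ x v
      attachAll≈ f []      g eq x v = ≈-sym (identityˡ _)
      attachAll≈ f (i ∷ l) g eq x v = begin
        attachAll (ends ∘ f ∘ suc) l (attach (ends (f zero)) (b i) x) v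
          ≈⟨ attachAll≈ (f ∘ suc) l g (eq ∘ suc) _ v ⟩
        later ∙ (sel (p ≟ v) (b i) ∙ (sel (q ≟ v) (b i) ∙ x v))
          ≈⟨ ∙-congˡ (≈-sym (assoc _ _ _)) ⟩
        later ∙ ((sel (p ≟ v) (b i) ∙ sel (q ≟ v) (b i)) ∙ x v)
          ≈⟨ ∙-congˡ (∙-congʳ (∙-cong (≈-trans (sel-cong (p ≟ v) (≈-reflexive (sym (eq zero)))) (≈-sym (mprod-if g (p ≟ v) (f zero)))) (≈-trans (sel-cong (q ≟ v) (≈-reflexive (sym (eq zero)))) (≈-sym (mprod-if g (q ≟ v) (f zero)))))) ⟩
        later ∙ ((mprod g (if ⌊ p ≟ v ⌋ then f zero ∷ [] else []) ∙ mprod g (if ⌊ q ≟ v ⌋ then f zero ∷ [] else [])) ∙ x v)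
          ≈⟨ ∙-congˡ (∙-congʳ (≈-sym (mprod-++ g (if ⌊ p ≟ v ⌋ then f zero ∷ [] else []) _))) ⟩
        later ∙ (mprod g (near v (f zero)) ∙ x v)
          ≈⟨ ≈-trans (≈-sym (assoc _ _ _)) (∙-congʳ (comm _ _)) ⟩
        (mprod g (near v (f zero)) ∙ later) ∙ x v
          ≈⟨ ∙-congʳ (≈-sym (mprod-++ g (near v (f zero)) _)) ⟩
        mprod g (near v (f zero) ++ concatMap (near v) (tabulate (f ∘ suc))) ∙ x v ∎
        where
        p = proj₁ (ends (f zero))
        q = proj₂ (ends (f zero))
        later = mprod g (concatMap (near v) (tabulate (f ∘ suc)))

    -- The passage from edges to nodes: once all labels are attached, a node carries the product
    -- along its `incident` list, in which a loop occurs twice.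
    Z≡∑Vec : ∀ x → Z ends x ≡ ∑Vec size nE (λ l → ∏ℚ (λ v → η (mprod (λ e → b (lookup l e)) (incident G v) ∙ x v)))
    Z≡∑Vec x = trans (Z-unfold ends x) (∑Vec-cong size nE λ l _ → ℚ∏.∏-cong λ v → η-cong (attachAll≈ id l _ (λ _ → refl) x v))

-- Blocks and cycles

module _ {V : ℕ} where

  rep : Blocks V → Fin V → Fin V
  rep = proj₁

  cycles : Blocks V → Fin V → ℕ
  cycles = proj₂

  Cyclic : Blocks V → Set
  Cyclic B = Σ (Fin V) λ j → cycles B j ≢ 0

  unite-yes : ∀ {p q} B → rep B p ≡ rep B q → unite (p , q) B ≡ closeCycle (rep B p) B
  unite-yes {p} {q} B = choose-yes (rep B p ≟ rep B q)

  unite-elim : ∀ (C : Blocks V → Set) p q B → (rep B p ≡ rep B q → C (closeCycle (rep B p) B)) →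
    (rep B p ≢ rep B q → C (fuse (rep B p) (rep B q) B)) → C (unite (p , q) B)
  unite-elim C p q B f g with rep B p ≟ rep B q
  ... | yes e = f e
  ... | no ne = g ne

  fuse-r : ∀ r s B {v} → rep B v ≡ r → rep (fuse r s B) v ≡ r
  fuse-r r s B {v} e with s ≟ rep B v
  ... | yes _ = refl
  ... | no  _ = e

  fuse-s : ∀ r s B {v} → rep B v ≡ s → rep (fuse r s B) v ≡ r
  fuse-s r s B {v} e = choose-yes (s ≟ rep B v) (sym e)

  fuse-other : ∀ r s B {v} → rep B v ≢ s → rep (fuse r s B) v ≡ rep B v
  fuse-other r s B {v} ne = choose-no (s ≟ rep B v) (ne ∘ sym)

  unite-joins : ∀ p q B → rep (unite (p , q) B) p ≡ rep (unite (p , q) B) q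
  unite-joins p q B = unite-elim (λ B′ → rep B′ p ≡ rep B′ q) p q B id
    λ _ → trans (fuse-r _ _ B refl) (sym (fuse-s _ _ B refl))

  unite-preserves : ∀ p q B {u v} → rep B u ≡ rep B v → rep (unite (p , q) B) u ≡ rep (unite (p , q) B) v
  unite-preserves p q B {u} {v} e = unite-elim (λ B′ → rep B′ u ≡ rep B′ v) p q B (λ _ → e)
    λ _ → cong (λ z → choose (rep B q ≟ z) (rep B p) z) e

  Idempotent : Blocks V → Set
  Idempotent B = ∀ v → rep B (rep B v) ≡ rep B v

  blocks-idempotent : ∀ {n} (φ : Fin n → Fin V × Fin V) → Idempotent (blocks φ)
  blocks-idempotent {zero}  φ v = refl
  blocks-idempotent {suc n} φ = unite-elim Idempotent p q B (λ _ → idem) (λ _ v → fused v (s ≟ rep B v))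
    where
    p = proj₁ (φ zero)
    q = proj₂ (φ zero)
    B = blocks (φ ∘ suc)
    idem = blocks-idempotent (φ ∘ suc)
    r = rep B p
    s = rep B q
    fused : ∀ v (d : Dec (s ≡ rep B v)) → rep (fuse r s B) (choose d r (rep B v)) ≡ choose d r (rep B v)
    fused v (yes _) = fuse-r r s B (idem p)
    fused v (no ne) = trans (fuse-other r s B (λ e → ne (sym (trans (sym (idem v)) e)))) (idem v)

  blocks-edge : ∀ {n} (φ : Fin n → Fin V × Fin V) i → rep (blocks φ) (proj₁ (φ i)) ≡ rep (blocks φ) (proj₂ (φ i))
  blocks-edge φ zero    = unite-joins (proj₁ (φ zero)) (proj₂ (φ zero)) (blocks (φ ∘ suc))
  blocks-edge φ (suc i) = unite-preserves (proj₁ (φ zero)) (proj₂ (φ zero)) (blocks (φ ∘ suc)) (blocks-edge (φ ∘ suc) i)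

  -- Cycles are recorded at representatives only, so a connected graph has a single index with a
  -- possibly nonzero count.
  RootedCycles : Blocks V → Set
  RootedCycles B = ∀ j → rep B j ≢ j → cycles B j ≡ 0

  blocks-rooted : ∀ {n} (φ : Fin n → Fin V × Fin V) → RootedCycles (blocks φ)
  blocks-rooted {zero}  φ j _ = refl
  blocks-rooted {suc n} φ = unite-elim RootedCycles p q B
    (λ _ j ne → trans (choose-no (r ≟ j) (λ e → ne (subst (λ z → rep B z ≡ z) e (idem p)))) (rooted j ne))
    (λ _ j ne → fused j ne (s ≟ j) (r ≟ j))
    where
    p = proj₁ (φ zero)
    q = proj₂ (φ zero)
    B = blocks (φ ∘ suc)
    idem = blocks-idempotent (φ ∘ suc)
    rooted = blocks-rooted (φ ∘ suc)
    r = rep B p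
    s = rep B q
    fused : ∀ j → rep (fuse r s B) j ≢ j → (d : Dec (s ≡ j)) (d′ : Dec (r ≡ j)) → choose d 0 (choose d′ (cycles B j ℕ.+ cycles B s) (cycles B j)) ≡ 0
    fused j ne (yes _) _        = refl
    fused j ne (no s≢) (yes refl) = ⊥-elim (ne (fuse-r r s B (idem p)))
    fused j ne (no s≢) (no _)   = rooted j (λ e → ne (trans (fuse-other r s B (λ e′ → s≢ (trans (sym e′) e))) e))

  closeCycle-cyclic : ∀ r B → Cyclic (closeCycle r B)
  closeCycle-cyclic r B = r , λ e → suc≢0 (trans (sym (choose-yes (r ≟ r) refl)) e)
    where
    suc≢0 : ∀ {n} → suc n ≢ 0
    suc≢0 ()

  unite-cyclic : ∀ p q B → Cyclic B → Cyclic (unite (p , q) B)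
  unite-cyclic p q B (j , ne) = unite-elim Cyclic p q B (λ _ → closeCycle-cyclic _ B) fused
    where
    r = rep B p
    s = rep B q
    fused : r ≢ s → Cyclic (fuse r s B)
    fused r≢s with s ≟ j
    ... | yes refl = r , λ e → ne (ℕ.m+n≡0⇒n≡0 (cycles B r) (trans (sym (trans (choose-no (s ≟ r) (r≢s ∘ sym)) (choose-yes (r ≟ r) refl))) e))
    ... | no s≢j = j , λ e → ne (other (r ≟ j) (trans (sym (choose-no (s ≟ j) s≢j)) e))
      where
      other : (d : Dec (r ≡ j)) → choose d (cycles B j ℕ.+ cycles B s) (cycles B j) ≡ 0 → cycles B j ≡ 0
      other (yes _) e = ℕ.m+n≡0⇒m≡0 (cycles B j) e
      other (no _)  e = e

module _ {X : Set} where

  private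
    all-equal : ∀ {k} (f : Fin (suc k) → X) → (∀ j → f (inject₁ j) ≡ f (suc j)) → f zero ≡ f (fromℕ k)
    all-equal {zero}  f h = refl
    all-equal {suc k} f h = trans (h zero) (all-equal (f ∘ suc) (h ∘ suc))

    before : ∀ {k} (f : Fin (suc k) → X) (i : Fin k) → (∀ j → j ≢ i → f (inject₁ j) ≡ f (suc j)) → f zero ≡ f (inject₁ i)
    before f zero    h = refl
    before f (suc i) h = trans (h zero (λ ())) (before (f ∘ suc) i (λ j ne → h (suc j) (ne ∘ Fin.suc-injective)))

    after : ∀ {k} (f : Fin (suc k) → X) (i : Fin k) → (∀ j → j ≢ i → f (inject₁ j) ≡ f (suc j)) → f (suc i) ≡ f (fromℕ k)
    after f zero    h = all-equal (f ∘ suc) (λ j → h (suc j) (λ ()))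
    after f (suc i) h = after (f ∘ suc) i (λ j ne → h (suc j) (ne ∘ Fin.suc-injective))

  -- Going round the closed sequence the other way leads from one end of step i to the other without
  -- using that step.
  around : ∀ {k} (f : Fin (suc k) → X) (i : Fin k) → f (fromℕ k) ≡ f zero → (∀ j → j ≢ i → f (inject₁ j) ≡ f (suc j)) → f (inject₁ i) ≡ f (suc i)
  around f i closed h = trans (sym (before f i h)) (trans (sym closed) (sym (after f i h)))

module _ (G : Graph) where
  open Graph G

  module _ {X : Set} (f : Fin nV → X) where

    joins-equal : ∀ {e u v} → f (proj₁ (ends e)) ≡ f (proj₂ (ends e)) → Joins G e u v → f u ≡ f v
    joins-equal eq (inj₁ e) = trans (cong (f ∘ proj₁) (sym e)) (trans eq (cong (f ∘ proj₂) e))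
    joins-equal eq (inj₂ e) = trans (cong (f ∘ proj₂) (sym e)) (trans (sym eq) (cong (f ∘ proj₁) e))

    joins-equal⁻¹ : ∀ {e u v} → Joins G e u v → f u ≡ f v → f (proj₁ (ends e)) ≡ f (proj₂ (ends e))
    joins-equal⁻¹ (inj₁ e) eq = trans (cong (f ∘ proj₁) e) (trans eq (cong (f ∘ proj₂) (sym e)))
    joins-equal⁻¹ (inj₂ e) eq = trans (cong (f ∘ proj₁) e) (trans (sym eq) (cong (f ∘ proj₂) (sym e)))

    reach-equal : (∀ e → f (proj₁ (ends e)) ≡ f (proj₂ (ends e))) → ∀ {u v} → Reach G u v → f u ≡ f v
    reach-equal eq here         = refl
    reach-equal eq (step e j r) = trans (joins-equal (eq e) j) (reach-equal eq r)

  -- The edge of a cycle that is united last joins two nodes of the same block.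
  cycle⇒cyclic : (c : Cycle G) → ∀ {n} (ψ : Fin n → Fin nE) → (∀ i → Σ (Fin n) λ a → ψ a ≡ Cycle.es c i) → Cyclic (blocks (ends ∘ ψ))
  cycle⇒cyclic c {zero}  ψ covers with proj₁ (covers zero)
  ... | ()
  cycle⇒cyclic c {suc n} ψ covers with Fin.any? (λ i → ψ zero ≟ Cycle.es c i)
  ... | no ¬on = unite-cyclic p q B (cycle⇒cyclic c (ψ ∘ suc) covers′)
    where
    p = proj₁ (ends (ψ zero))
    q = proj₂ (ends (ψ zero))
    B = blocks (ends ∘ ψ ∘ suc)
    covers′ : ∀ i → Σ (Fin n) λ a → ψ (suc a) ≡ Cycle.es c i
    covers′ i with covers i
    ... | zero  , e = ⊥-elim (¬on (i , e))
    ... | suc a , e = a , e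
  ... | yes (i , ψ0≡) = subst Cyclic (sym (unite-yes B same)) (closeCycle-cyclic _ B)
    where
    open Cycle c
    B = blocks (ends ∘ ψ ∘ suc)
    others : ∀ j → j ≢ i → rep B (vs (inject₁ j)) ≡ rep B (vs (suc j))
    others j j≢i with covers j
    ... | zero  , e = ⊥-elim (j≢i (es-inj (trans (sym e) ψ0≡)))
    ... | suc a , e = joins-equal (rep B) (subst (λ z → rep B (proj₁ (ends z)) ≡ rep B (proj₂ (ends z))) e (blocks-edge (ends ∘ ψ ∘ suc) a)) (joins j)
    same : rep B (proj₁ (ends (ψ zero))) ≡ rep B (proj₂ (ends (ψ zero)))
    same = joins-equal⁻¹ (rep B) (subst (λ z → Joins G z _ _) (sym ψ0≡) (joins i)) (around (rep B ∘ vs) i (cong (rep B) closed) others)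

  data Walk (S : Fin nE → Set) : Fin nV → Fin nV → Set where
    []   : ∀ {v} → Walk S v v
    cons : ∀ {u w v} e → S e → Joins G e u w → Walk S w v → Walk S u v

  _++ʷ_ : ∀ {S u v w} → Walk S u v → Walk S v w → Walk S u w
  []             ++ʷ τ = τ
  cons e s j π   ++ʷ τ = cons e s j (π ++ʷ τ)

  widen : ∀ {S S′ : Fin nE → Set} {u v} → (∀ {e} → S e → S′ e) → Walk S u v → Walk S′ u v
  widen f []             = []
  widen f (cons e s j π) = cons e (f s) j (widen f π)

  Image : ∀ {n} → (Fin n → Fin nE) → Fin nE → Set
  Image {n} ψ e = Σ (Fin n) λ i → ψ i ≡ e

  -- Blocks are the components formed by the edges united so far: an edge that fuses two of them
  -- links a walk inside one to a walk inside the other.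
  blocks-walk : ∀ {n} (ψ : Fin n → Fin nE) {u v} → rep (blocks (ends ∘ ψ)) u ≡ rep (blocks (ends ∘ ψ)) v → Walk (Image ψ) u v
  blocks-walk {zero}  ψ refl = []
  blocks-walk {suc n} ψ {u} {v} = unite-elim (λ B′ → rep B′ u ≡ rep B′ v → Walk (Image ψ) u v) p q B (λ _ → old) (λ _ → fused (s ≟ rep B u) (s ≟ rep B v))
    where
    p = proj₁ (ends (ψ zero))
    q = proj₂ (ends (ψ zero))
    B = blocks (ends ∘ ψ ∘ suc)
    r = rep B p
    s = rep B q
    old : ∀ {u v} → rep B u ≡ rep B v → Walk (Image ψ) u v
    old e = widen (λ { (i , eq) → suc i , eq }) (blocks-walk (ψ ∘ suc) e)
    fused : (d : Dec (s ≡ rep B u)) (d′ : Dec (s ≡ rep B v)) → choose d r (rep B u) ≡ choose d′ r (rep B v) → Walk (Image ψ) u v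
    fused (yes a) (yes b) _ = old (trans (sym a) b)
    fused (yes a) (no _)  e = old (sym a) ++ʷ cons (ψ zero) (zero , refl) (inj₂ refl) (old e)
    fused (no _)  (yes b) e = old e ++ʷ cons (ψ zero) (zero , refl) (inj₁ refl) (old b)
    fused (no _)  (no _)  e = old e

  module _ (S : Fin nE → Set) where

    infix 4 _∉_
    -- Walks without repeated nodes. Freshness of the first node refers to the rest of the path,
    -- hence the mutual definition with `_∉_`.
    data Path : Fin nV → Fin nV → Set
    _∉_ : ∀ {u v} → Fin nV → Path u v → Set

    data Path where
      []   : ∀ {v} → Path v v
      cons : ∀ {u w v} e → S e → Joins G e u w → (π : Path w v) → u ∉ π → Path u v

    x ∉ ([] {v})             = x ≢ v
    x ∉ (cons {u} e s j π _) = x ≢ u × x ∉ π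

    locate : ∀ x {u v} (π : Path u v) → x ∉ π ⊎ Path x v
    locate x ([] {v}) with x ≟ v
    ... | yes refl = inj₂ []
    ... | no  x≢v  = inj₁ x≢v
    locate x (cons {u} e s j π u∉) with x ≟ u
    ... | yes refl = inj₂ (cons e s j π u∉)
    ... | no  x≢u with locate x π
    ...   | inj₁ x∉ = inj₁ (x≢u , x∉)
    ...   | inj₂ τ  = inj₂ τ

    erase-loops : ∀ {u v} → Walk S u v → Path u v
    erase-loops [] = []
    erase-loops (cons {u} e s j π) with locate u (erase-loops π)
    ... | inj₁ u∉ = cons e s j (erase-loops π) u∉
    ... | inj₂ τ  = τ

    len : ∀ {u v} → Path u v → ℕ
    len []               = 0
    len (cons e s j π _) = suc (len π)

    node : ∀ {u v} (π : Path u v) → Fin (suc (len π)) → Fin nV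
    node {u} π                zero    = u
    node (cons e s j π _) (suc i) = node π i

    edge : ∀ {u v} (π : Path u v) → Fin (len π) → Fin nE
    edge (cons e s j π _) zero    = e
    edge (cons e s j π _) (suc i) = edge π i

    node-last : ∀ {u v} (π : Path u v) → node π (fromℕ (len π)) ≡ v
    node-last []               = refl
    node-last (cons e s j π _) = node-last π

    edge-joins : ∀ {u v} (π : Path u v) i → Joins G (edge π i) (node π (inject₁ i)) (node π (suc i))
    edge-joins (cons e s j π _) zero    = j
    edge-joins (cons e s j π _) (suc i) = edge-joins π i

    edge∈S : ∀ {u v} (π : Path u v) i → S (edge π i)
    edge∈S (cons e s j π _) zero    = s
    edge∈S (cons e s j π _) (suc i) = edge∈S π i

    ∉⇒≢ : ∀ {x u v} (π : Path u v) → x ∉ π → ∀ i → x ≢ node π i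
    ∉⇒≢ []               x∉       zero    = x∉
    ∉⇒≢ (cons e s j π _) (x≢ , _) zero    = x≢
    ∉⇒≢ (cons e s j π _) (_ , x∉) (suc i) = ∉⇒≢ π x∉ i

    node-injective : ∀ {u v} (π : Path u v) → Injective _≡_ _≡_ (node π)
    node-injective π                 {zero}  {zero}  e = refl
    node-injective (cons _ _ _ π u∉) {zero}  {suc j} e = ⊥-elim (∉⇒≢ π u∉ j e)
    node-injective (cons _ _ _ π u∉) {suc i} {zero}  e = ⊥-elim (∉⇒≢ π u∉ i (sym e))
    node-injective (cons _ _ _ π u∉) {suc i} {suc j} e = cong suc (node-injective π e)

    joins-end : ∀ {e u w a b} → Joins G e u w → Joins G e a b → u ≡ a ⊎ u ≡ b
    joins-end (inj₁ e) (inj₁ e′) = inj₁ (cong proj₁ (trans (sym e) e′))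
    joins-end (inj₁ e) (inj₂ e′) = inj₂ (cong proj₁ (trans (sym e) e′))
    joins-end (inj₂ e) (inj₁ e′) = inj₂ (cong proj₂ (trans (sym e) e′))
    joins-end (inj₂ e) (inj₂ e′) = inj₁ (cong proj₂ (trans (sym e) e′))

    -- If the edge occurred again later, its end u would be a node of the rest of the path.
    first-edge-new : ∀ {u w v e} → Joins G e u w → (π : Path w v) → u ∉ π → ∀ i → e ≢ edge π i
    first-edge-new j π u∉ i refl with joins-end j (edge-joins π i)
    ... | inj₁ e = ∉⇒≢ π u∉ (inject₁ i) e
    ... | inj₂ e = ∉⇒≢ π u∉ (suc i) e

    edge-injective : ∀ {u v} (π : Path u v) → Injective _≡_ _≡_ (edge π)
    edge-injective (cons _ _ _ π _)  {zero}  {zero}  e = refl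
    edge-injective (cons _ _ j π u∉) {zero}  {suc i} e = ⊥-elim (first-edge-new j π u∉ i e)
    edge-injective (cons _ _ j π u∉) {suc i} {zero}  e = ⊥-elim (first-edge-new j π u∉ i (sym e))
    edge-injective (cons _ _ _ π _)  {suc i} {suc k} e = cong suc (edge-injective π e)

    -- The closing edge lies outside S and so differs from every edge of the path. A path of length
    -- zero yields a loop.
    close-path : ∀ e → ¬ S e → ∀ {p q} → Joins G e p q → Path q p → Cycle G
    close-path e e∉S {p} {q} j π = record
      { k = len π ; es = es ; vs = vs ; closed = node-last π ; joins = joins ; es-inj = es-inj ; vs-inj = vs-inj }
      where
      es : Fin (suc (len π)) → Fin nE
      es zero    = e
      es (suc i) = edge π i
      vs : Fin (suc (suc (len π))) → Fin nV
      vs zero    = p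
      vs (suc i) = node π i
      joins : ∀ i → Joins G (es i) (vs (inject₁ i)) (vs (suc i))
      joins zero    = j
      joins (suc i) = edge-joins π i
      es-inj : Injective _≡_ _≡_ es
      es-inj {zero}  {zero}  _  = refl
      es-inj {zero}  {suc i} eq = ⊥-elim (e∉S (subst S (sym eq) (edge∈S π i)))
      es-inj {suc i} {zero}  eq = ⊥-elim (e∉S (subst S eq (edge∈S π i)))
      es-inj {suc i} {suc k} eq = cong suc (edge-injective π eq)
      not-last : ∀ i → p ≢ node π (inject₁ i)
      not-last i eq = Fin.fromℕ≢inject₁ {i = i} (node-injective π {fromℕ (len π)} {inject₁ i} (trans (node-last π) eq))
      vs-inj : Injective _≡_ _≡_ (λ i → vs (inject₁ i))
      vs-inj {zero}  {zero}  _  = refl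
      vs-inj {zero}  {suc i} eq = ⊥-elim (not-last i eq)
      vs-inj {suc i} {zero}  eq = ⊥-elim (not-last i (sym eq))
      vs-inj {suc i} {suc k} eq = cong suc (Fin.inject₁-injective (node-injective π eq))

  -- An edge with both ends in one block would close up a path through edges united before.
  -- Injectivity of ψ keeps that edge itself off the path.
  acyclic⇒no-cycles : ¬ Cycle G → ∀ {n} (ψ : Fin n → Fin nE) → Injective _≡_ _≡_ ψ → ∀ j → cycles (blocks (ends ∘ ψ)) j ≡ 0
  acyclic⇒no-cycles acyclic {zero}  ψ ψ-inj j = refl
  acyclic⇒no-cycles acyclic {suc n} ψ ψ-inj = unite-elim (λ B′ → ∀ j → cycles B′ j ≡ 0) p q B
    (λ e → ⊥-elim (acyclic (close-path (Image (ψ ∘ suc)) (ψ zero) (λ { (i , eq) → 0≢suc (ψ-inj eq) }) (inj₁ refl)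
      (erase-loops (Image (ψ ∘ suc)) (blocks-walk (ψ ∘ suc) (sym e))))))
    (λ _ j → fused j (s ≟ j) (r ≟ j))
    where
    p = proj₁ (ends (ψ zero))
    q = proj₂ (ends (ψ zero))
    B = blocks (ends ∘ ψ ∘ suc)
    r = rep B p
    s = rep B q
    none = acyclic⇒no-cycles acyclic (ψ ∘ suc) (Fin.suc-injective ∘ ψ-inj)
    0≢suc : ∀ {i : Fin n} → suc i ≢ zero
    0≢suc ()
    fused : ∀ j (d : Dec (s ≡ j)) (d′ : Dec (r ≡ j)) → choose d 0 (choose d′ (cycles B j ℕ.+ cycles B s) (cycles B j)) ≡ 0
    fused j (yes _) _       = refl
    fused j (no _)  (yes _) = trans (cong (ℕ._+ cycles B s) (none j)) (none s)
    fused j (no _)  (no _)  = none j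

  module _ (connected : Connected G) (root : Fin nV) where

    private
      B = blocks ends

    base : Fin nV
    base = rep B root

    genus : ℕ
    genus = cycles B base

    rep-base : ∀ v → rep B v ≡ base
    rep-base v = reach-equal (rep B) (blocks-edge ends) (connected v root)

    cycles-elsewhere : ∀ j → base ≢ j → cycles B j ≡ 0
    cycles-elsewhere j ne = blocks-rooted ends j (λ e → ne (trans (sym (rep-base j)) e))

    genus-acyclic : ¬ Cycle G → genus ≡ 0
    genus-acyclic acyclic = acyclic⇒no-cycles acyclic id id base

    genus-cyclic : Cycle G → genus ≢ 0
    genus-cyclic c with cycle⇒cyclic c id (λ i → Cycle.es c i , refl)
    ... | j , ne with base ≟ j
    ...   | yes refl = ne
    ...   | no  ne′  = ⊥-elim (ne (cycles-elsewhere j ne′))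

-- Lattice points

sumℕ : ℕ → (ℕ → ℕ) → ℕ
sumℕ zero    k = 0
sumℕ (suc n) k = k 0 ℕ.+ sumℕ n (k ∘ suc)

private
  Σ-Fin : (S : ℕ → Set) (k : ℕ → ℕ) → (∀ i → S i ↔ Fin (k i)) → ∀ M → Σ (Fin M) (S ∘ toℕ) ↔ Fin (sumℕ M k)
  Σ-Fin S k bij zero    = mk↔ₛ′ (λ { (() , _) }) (λ ()) (λ ()) (λ { (() , _) })
  Σ-Fin S k bij (suc M) = ↔-trans split (↔-trans (bij 0 ⊎-↔ Σ-Fin (S ∘ suc) (k ∘ suc) (bij ∘ suc) M) (↔-sym Fin.+↔⊎))
    where
    split : Σ (Fin (suc M)) (S ∘ toℕ) ↔ (S 0 ⊎ Σ (Fin M) (S ∘ suc ∘ toℕ))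
    split = mk↔ₛ′ (λ { (zero , x) → inj₁ x ; (suc i , x) → inj₂ (i , x) }) (λ { (inj₁ x) → zero , x ; (inj₂ (i , x)) → suc i , x })
      (λ { (inj₁ x) → refl ; (inj₂ (i , x)) → refl }) (λ { (zero , x) → refl ; (suc i , x) → refl })

countVec : ℕ → ∀ n → (Vec ℤ n → Bool) → ℕ
countVec M zero    P = if P [] then 1 else 0
countVec M (suc n) P = sumℕ M (λ i → countVec M n (λ v → P (ℤ.+ i ∷ v)))

InRange : ℕ → ℤ → Set
InRange M z = Σ ℕ λ i → i < M × z ≡ ℤ.+ i

countVec-↔ : ∀ M n (P : Vec ℤ n → Bool) → (∀ w → T (P w) → ∀ e → InRange M (lookup w e)) → Σ (Vec ℤ n) (T ∘ P) ↔ Fin (countVec M n P)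
countVec-↔ M zero P bounded with P [] in eq
... | true  = mk↔ₛ′ (λ _ → zero) (λ _ → [] , subst T (sym eq) tt) (λ { zero → refl }) (λ { ([] , p) → cong ([] ,_) (Bool.T-irrelevant _ p) })
... | false = mk↔ₛ′ (λ { ([] , p) → ⊥-elim (subst T eq p) }) (λ ()) (λ ()) (λ { ([] , p) → ⊥-elim (subst T eq p) })
countVec-↔ M (suc n) P bounded = ↔-trans (mk↔ₛ′ to from to-from from-to)
  (Σ-Fin (λ i → Σ (Vec ℤ n) (λ v → T (P (ℤ.+ i ∷ v)))) _ (λ i → countVec-↔ M n (λ v → P (ℤ.+ i ∷ v)) (λ w p e → bounded (ℤ.+ i ∷ w) p (suc e))) M)
  where
  Split : Set
  Split = Σ (Fin M) λ i → Σ (Vec ℤ n) λ v → T (P (ℤ.+ toℕ i ∷ v))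
  entry : ∀ {z} → ((i , i<M , _) : InRange M z) → z ≡ ℤ.+ toℕ (fromℕ< i<M)
  entry (i , i<M , e) = trans e (cong ℤ.+_ (sym (Fin.toℕ-fromℕ< i<M)))
  to : Σ (Vec ℤ (suc n)) (T ∘ P) → Split
  to (z ∷ v , p) = let b = bounded (z ∷ v) p zero in fromℕ< (proj₁ (proj₂ b)) , v , subst (λ y → T (P (y ∷ v))) (entry b) p
  from : Split → Σ (Vec ℤ (suc n)) (T ∘ P)
  from (i , v , p) = ℤ.+ toℕ i ∷ v , p
  split-≡ : ∀ {i i′ v p p′} → i ≡ i′ → _≡_ {A = Split} (i , v , p) (i′ , v , p′)
  split-≡ {i} {v = v} {p} {p′} refl = cong (λ z → i , v , z) (Bool.T-irrelevant p p′)
  to-from : ∀ x → to (from x) ≡ x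
  to-from (i , v , p) = split-≡ (Fin.toℕ-injective (ℤ.+-injective (sym (entry (bounded (ℤ.+ toℕ i ∷ v) p zero)))))
  vec-≡ : ∀ {w w′ p p′} → w ≡ w′ → _≡_ {A = Σ (Vec ℤ (suc n)) (T ∘ P)} (w , p) (w′ , p′)
  vec-≡ {w} {p = p} {p′} refl = cong (w ,_) (Bool.T-irrelevant p p′)
  from-to : ∀ x → from (to x) ≡ x
  from-to (z ∷ v , p) = vec-≡ (cong (_∷ v) (sym (entry (bounded (z ∷ v) p zero))))

⟦_⟧ : Bool → ℚ
⟦ true ⟧  = 1ℚ
⟦ false ⟧ = 0ℚ

⟦⟧-∧ : ∀ x y → ⟦ x ∧ y ⟧ ≡ ⟦ x ⟧ * ⟦ y ⟧
⟦⟧-∧ true  y = sym (*-identityˡ _)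
⟦⟧-∧ false y = sym (zeroˡ _)

⟦⟧-T : ∀ {x} → T x → ⟦ x ⟧ ≡ 1ℚ
⟦⟧-T {true} _ = refl

⟦⟧-𝟙 : ∀ {P : Set} x (d : Dec P) → (T x → P) → (P → T x) → ⟦ x ⟧ ≡ 𝟙 d
⟦⟧-𝟙 true  d f g = sym (𝟙-yes d (f tt))
⟦⟧-𝟙 false d f g = sym (𝟙-no d g)

#sumℕ : ∀ M k → # (sumℕ M k) ≡ ∑ M (λ i → # (k i))
#sumℕ zero    k = trans ι-0 (sym (∑-0 _))
#sumℕ (suc M) k = trans (#-+ (k 0) _) (trans (cong (# (k 0) +_) (#sumℕ M (k ∘ suc))) (sym (∑-suc M _)))

#countVec : ∀ M n P → # (countVec M n P) ≡ ∑Vec M n (λ l → ⟦ P (map ℤ.+_ l) ⟧)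
#countVec M zero P with P []
... | true  = ι-1
... | false = ι-0
#countVec M (suc n) P = trans (#sumℕ M _) (∑-cong M λ i _ → #countVec M n (λ v → P (ℤ.+ i ∷ v)))

⟦allᵇ⟧ : ∀ {n} {A : Set} (p : A → Bool) (f : Fin n → A) → ⟦ allᵇ p (tabulate f) ⟧ ≡ ℚ∏.∏ (λ i → ⟦ p (f i) ⟧)
⟦allᵇ⟧ {zero}  p f = sym (ℚ∏.∏-empty _)
⟦allᵇ⟧ {suc n} p f = trans (⟦⟧-∧ (p (f zero)) _) (trans (cong (⟦ p (f zero) ⟧ *_) (⟦allᵇ⟧ p (f ∘ suc))) (sym (ℚ∏.∏-suc _)))

T-∧⁻ : ∀ {x y} → T (x ∧ y) → T x × T y
T-∧⁻ = Equivalence.to Bool.T-∧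

T-∧⁺ : ∀ {x y} → T x → T y → T (x ∧ y)
T-∧⁺ p q = Equivalence.from Bool.T-∧ (p , q)

allᵇ-∈ : ∀ {A : Set} (p : A → Bool) {xs x} → T (allᵇ p xs) → x ∈ xs → T (p x)
allᵇ-∈ p ok (here refl) = proj₁ (T-∧⁻ ok)
allᵇ-∈ p ok (there x∈)  = allᵇ-∈ p (proj₂ (T-∧⁻ ok)) x∈

-- Nonnegativity is not among the inequalities of a node: it comes from adding the triangle
-- inequalities of b and c, which gives 0 ≤ 2a. The one of a and the bound on the sum give 2a ≤ t.
triangle-range : ∀ {a b c : ℤ} {t} → a ℤ.≤ b ℤ.+ c → b ℤ.≤ a ℤ.+ c → c ℤ.≤ a ℤ.+ b → a ℤ.+ b ℤ.+ c ℤ.≤ ℤ.+ t → Σ ℕ λ i → a ≡ ℤ.+ i × i ℕ.+ i ≤ t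
triangle-range {a} {b} {c} {t} p q r s = nonneg a 0≤2a 2a≤t
  where
  swap : ∀ a b c → (a ℤ.+ c) ℤ.+ (a ℤ.+ b) ℤ.+ ℤ.- (b ℤ.+ c) ≡ a ℤ.+ a
  swap = int-solve-∀
  0≤2a : ℤ.0ℤ ℤ.≤ a ℤ.+ a
  0≤2a = subst₂ ℤ._≤_ (ℤ.+-inverseʳ (b ℤ.+ c)) (swap a b c) (ℤ.+-monoˡ-≤ (ℤ.- (b ℤ.+ c)) (ℤ.+-mono-≤ q r))
  2a≤t : a ℤ.+ a ℤ.≤ ℤ.+ t
  2a≤t = ℤ.≤-trans (ℤ.+-monoʳ-≤ a p) (subst (ℤ._≤ ℤ.+ t) (ℤ.+-assoc a b c) s)
  nonneg : ∀ a → ℤ.0ℤ ℤ.≤ a ℤ.+ a → a ℤ.+ a ℤ.≤ ℤ.+ t → Σ ℕ λ i → a ≡ ℤ.+ i × i ℕ.+ i ≤ t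
  nonneg (ℤ.+ i) _ le = i , refl , ℤ.drop‿+≤+ le
  nonneg -[1+ i ] () _

module LatticeCount (G : Graph) (is13 : Is13Graph G) (t m : ℕ) (2m≤t : m ℕ.+ m ≤ t) (t≤2m+1 : t ≤ suc (m ℕ.+ m)) where

  open Graph G
  open FusionAlgebra t m 2m≤t t≤2m+1

  𝓐 : ContractionAlgebra
  𝓐 = record
    { commutativeMonoid = commutativeMonoid ; η = ε ; η-cong = λ p → p 0 z≤n ; η-ε = refl
    ; size = suc m ; b = δ ; θ = θ ; contract = contract ; contract-loop = contract-loop }

  open StateSum 𝓐 {nV} using (Z; Z≡∑Vec; mprod)

  leaf? : ∀ v → Dec (degree G v ≡ 1)
  leaf? v = degree G v ℕ.≟ 1

  -- A leaf imposes no condition, and ε (eₐ Ω) = 1 for every label a. An internal node gets the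
  -- unit, since ε of the product of its three labels is already N.
  x : Fin nV → ℕ → ℚ
  x v = choose (leaf? v) Ω (δ 0)

  private
    half≤m : ∀ {i} → i ℕ.+ i ≤ t → i < suc m
    half≤m {i} le with i ℕ.≤? m
    ... | yes i≤m = s≤s i≤m
    ... | no  i≰m = ⊥-elim (ℕ.<-irrefl refl (ℕ.≤-trans (≤-cast (ℕ.+-mono-≤ (ℕ.≰⇒> i≰m) (ℕ.≰⇒> i≰m)) (cong suc (ℕ.+-suc m m)) refl) (ℕ.≤-trans le t≤2m+1)))

    nodeTest : Vec ℤ nE → List (Fin nE) → Bool
    nodeTest w (a ∷ b ∷ c ∷ []) = (lookup w a ℤ.≤ᵇ lookup w b ℤ.+ lookup w c) ∧ (lookup w b ℤ.≤ᵇ lookup w a ℤ.+ lookup w c) ∧ (lookup w c ℤ.≤ᵇ lookup w a ℤ.+ lookup w b)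
      ∧ (lookup w a ℤ.+ lookup w b ℤ.+ lookup w c ℤ.≤ᵇ ℤ.+ t)
    nodeTest w _ = true

    nodeOK≡ : ∀ w v → nodeOKᵇ G t w v ≡ nodeTest w (incident G v)
    nodeOK≡ w v with incident G v
    ... | []                = refl
    ... | _ ∷ []            = refl
    ... | _ ∷ _ ∷ []        = refl
    ... | _ ∷ _ ∷ _ ∷ []    = refl
    ... | _ ∷ _ ∷ _ ∷ _ ∷ _ = refl

    nodeTest-range : ∀ w xs → length xs ≡ 3 → T (nodeTest w xs) → ∀ {e} → e ∈ xs → InRange (suc m) (lookup w e)
    nodeTest-range w (a ∷ b ∷ c ∷ []) _ ok = λ
      { (here refl) → range (triangle-range (ℤ.≤ᵇ⇒≤ p) (ℤ.≤ᵇ⇒≤ q) (ℤ.≤ᵇ⇒≤ r) (ℤ.≤ᵇ⇒≤ s))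
      ; (there (here refl)) → range (triangle-range (ℤ.≤ᵇ⇒≤ q) (ℤ.≤ᵇ⇒≤ p) (subst (lookup w c ℤ.≤_) (ℤ.+-comm (lookup w a) (lookup w b)) (ℤ.≤ᵇ⇒≤ r)) (subst (λ z → z ℤ.+ lookup w c ℤ.≤ ℤ.+ t) (ℤ.+-comm (lookup w a) (lookup w b)) (ℤ.≤ᵇ⇒≤ s)))
      ; (there (there (here refl))) → range (triangle-range (ℤ.≤ᵇ⇒≤ r) (subst (lookup w a ℤ.≤_) (ℤ.+-comm (lookup w b) (lookup w c)) (ℤ.≤ᵇ⇒≤ p)) (subst (lookup w b ℤ.≤_) (ℤ.+-comm (lookup w a) (lookup w c)) (ℤ.≤ᵇ⇒≤ q)) (subst (ℤ._≤ ℤ.+ t) (rotate (lookup w a) (lookup w b) (lookup w c)) (ℤ.≤ᵇ⇒≤ s))) }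
      where
      conj = T-∧⁻ {lookup w a ℤ.≤ᵇ lookup w b ℤ.+ lookup w c} ok
      p = proj₁ conj
      conj₂ = T-∧⁻ {lookup w b ℤ.≤ᵇ lookup w a ℤ.+ lookup w c} (proj₂ conj)
      q = proj₁ conj₂
      conj₃ = T-∧⁻ {lookup w c ℤ.≤ᵇ lookup w a ℤ.+ lookup w b} (proj₂ conj₂)
      r = proj₁ conj₃
      s = proj₂ conj₃
      rotate : ∀ a b c → a ℤ.+ b ℤ.+ c ≡ c ℤ.+ a ℤ.+ b
      rotate = int-solve-∀
      range : ∀ {z} → (Σ ℕ λ i → z ≡ ℤ.+ i × i ℕ.+ i ≤ t) → InRange (suc m) z
      range (i , e , le) = i , half≤m le , e

    singleton : ∀ {A : Set} (xs : List A) {e} → length xs ≡ 1 → e ∈ xs → xs ≡ e ∷ []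
    singleton (_ ∷ []) _ (here refl) = refl

    ∈-incident₁ : ∀ e → e ∈ incident G (proj₁ (ends e))
    ∈-incident₁ e = ∈-concatMap⁺ _ (lose (∈-allFin e) (∈-++⁺ˡ (selected (proj₁ (ends e) ≟ proj₁ (ends e)) refl)))
      where
      selected : ∀ {P : Set} (d : Dec P) → P → e ∈ (if ⌊ d ⌋ then e ∷ [] else [])
      selected (yes _) _ = here refl
      selected (no ¬p) p = ⊥-elim (¬p p)

    ∈-incident₂ : ∀ e → e ∈ incident G (proj₂ (ends e))
    ∈-incident₂ e = ∈-concatMap⁺ _ (lose (∈-allFin e) (∈-++⁺ʳ (if ⌊ proj₁ (ends e) ≟ proj₂ (ends e) ⌋ then e ∷ [] else []) (selected (proj₂ (ends e) ≟ proj₂ (ends e)) refl)))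
      where
      selected : ∀ {P : Set} (d : Dec P) → P → e ∈ (if ⌊ d ⌋ then e ∷ [] else [])
      selected (yes _) _ = here refl
      selected (no ¬p) p = ⊥-elim (¬p p)

    bounded : ∀ w → T (inTPᵇ G t w) → ∀ e → InRange (suc m) (lookup w e)
    bounded w ok e with is13 (proj₁ (ends e)) | is13 (proj₂ (ends e))
    ... | inj₂ deg₃ | _ = nodeTest-range w _ deg₃ (subst T (nodeOK≡ w _) (allᵇ-∈ (nodeOKᵇ G t w) (proj₁ (T-∧⁻ ok)) (∈-allFin (proj₁ (ends e))))) (∈-incident₁ e)
    ... | inj₁ _ | inj₂ deg₃ = nodeTest-range w _ deg₃ (subst T (nodeOK≡ w _) (allᵇ-∈ (nodeOKᵇ G t w) (proj₁ (T-∧⁻ ok)) (∈-allFin (proj₂ (ends e))))) (∈-incident₂ e)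
    -- Both ends are leaves whose only edge is e, so e is a component by itself and its explicit
    -- bounds are in force.
    ... | inj₁ deg₁ | inj₁ deg₁′ = nonneg (lookup w e) (ℤ.≤ᵇ⇒≤ (proj₁ (T-∧⁻ {ℤ.0ℤ ℤ.≤ᵇ lookup w e} edge-ok))) (ℤ.≤ᵇ⇒≤ (proj₂ (T-∧⁻ {ℤ.0ℤ ℤ.≤ᵇ lookup w e} edge-ok)))
      where
      ≟-refl : ⌊ e ≟ e ⌋ ≡ true
      ≟-refl with e ≟ e
      ... | yes _ = refl
      ... | no ne = ⊥-elim (ne refl)
      isolated : isolatedᵇ G e ≡ true
      isolated = trans (cong₂ (λ xs ys → allᵇ (λ e′ → ⌊ e′ ≟ e ⌋) (xs ++ ys)) (singleton _ deg₁ (∈-incident₁ e)) (singleton _ deg₁′ (∈-incident₂ e))) (cong (λ z → z ∧ z ∧ true) ≟-refl)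
      edge-ok : T ((ℤ.0ℤ ℤ.≤ᵇ lookup w e) ∧ (lookup w e ℤ.+ lookup w e ℤ.≤ᵇ ℤ.+ t))
      edge-ok = subst (λ z → T (if z then (ℤ.0ℤ ℤ.≤ᵇ lookup w e) ∧ (lookup w e ℤ.+ lookup w e ℤ.≤ᵇ ℤ.+ t) else true)) isolated (allᵇ-∈ (edgeOKᵇ G t w) (proj₂ (T-∧⁻ ok)) (∈-allFin e))
      nonneg : ∀ z → ℤ.0ℤ ℤ.≤ z → z ℤ.+ z ℤ.≤ ℤ.+ t → InRange (suc m) z
      nonneg (ℤ.+ i) _ le = i , half≤m (ℤ.drop‿+≤+ le) , refl
      nonneg -[1+ i ] () _

  L : ℕ
  L = countVec (suc m) nE (inTPᵇ G t)

  L-count : EhrhartCount G t L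
  L-count = countVec-↔ (suc m) nE (inTPᵇ G t) bounded

  private
    -- Labels from 0 to m satisfy the bounds of an isolated edge because 2m ≤ t, so such an edge has
    -- weight 1 and the state sum consists of node factors.
    edge-one : ∀ l → (∀ e → lookup l e < suc m) → ∀ e → ⟦ edgeOKᵇ G t (map ℤ.+_ l) e ⟧ ≡ 1ℚ
    edge-one l l≤m e with isolatedᵇ G e
    ... | false = refl
    ... | true  = trans (cong (λ z → ⟦ (ℤ.0ℤ ℤ.≤ᵇ z) ∧ (z ℤ.+ z ℤ.≤ᵇ ℤ.+ t) ⟧) (Vec.lookup-map e ℤ.+_ l)) (⟦⟧-T {(0 ℕ.≤ᵇ i) ∧ (i ℕ.+ i ℕ.≤ᵇ t)} (T-∧⁺ {0 ℕ.≤ᵇ i} (ℕ.≤⇒≤ᵇ {0} {i} z≤n) (ℕ.≤⇒≤ᵇ (ℕ.≤-trans (ℕ.+-mono-≤ i≤m i≤m) 2m≤t))))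
      where
      i = lookup l e
      i≤m = ℕ.≤-pred (l≤m e)

    tri-bool : ∀ a b c → ⟦ (a ℕ.≤ᵇ b ℕ.+ c) ∧ (b ℕ.≤ᵇ a ℕ.+ c) ∧ (c ℕ.≤ᵇ a ℕ.+ b) ∧ (a ℕ.+ b ℕ.+ c ℕ.≤ᵇ t) ⟧ ≡ N a b c
    tri-bool a b c = ⟦⟧-𝟙 _ (tri? t a b c)
      (λ ok → let (p , ok′) = T-∧⁻ {a ℕ.≤ᵇ b ℕ.+ c} ok ; (q , ok″) = T-∧⁻ {b ℕ.≤ᵇ a ℕ.+ c} ok′ ; (r , s) = T-∧⁻ {c ℕ.≤ᵇ a ℕ.+ b} ok″ in
        ℕ.≤ᵇ⇒≤ _ _ p , ℕ.≤ᵇ⇒≤ _ _ q , ℕ.≤ᵇ⇒≤ _ _ r , ℕ.≤ᵇ⇒≤ _ _ s)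
      (λ { (p , q , r , s) → T-∧⁺ (ℕ.≤⇒≤ᵇ p) (T-∧⁺ (ℕ.≤⇒≤ᵇ q) (T-∧⁺ (ℕ.≤⇒≤ᵇ r) (ℕ.≤⇒≤ᵇ s))) })

    node-weight : ∀ l → (∀ e → lookup l e < suc m) → ∀ v → ⟦ nodeOKᵇ G t (map ℤ.+_ l) v ⟧ ≡ ε (mprod (λ e → δ (lookup l e)) (incident G v) ∙ x v)
    node-weight l l≤m v = trans (cong ⟦_⟧ (nodeOK≡ (map ℤ.+_ l) v)) (weight (incident G v) (leaf? v) (is13 v))
      where
      le : ∀ e → lookup l e ≤ m
      le e = ℕ.≤-pred (l≤m e)
      weight : ∀ xs (d : Dec (length xs ≡ 1)) → length xs ≡ 1 ⊎ length xs ≡ 3 → ⟦ nodeTest (map ℤ.+_ l) xs ⟧ ≡ ε (mprod (λ e → δ (lookup l e)) xs ∙ choose d Ω (δ 0))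
      weight (e ∷ []) (yes _) _ = sym (trans (≈-trans (∙-comm (δ (lookup l e) ∙ δ 0) Ω) (∙-cong ≈-refl (∙-identityʳ (δ (lookup l e)))) 0 z≤n) (ε-∙δ Ω (le e)))
      weight (e ∷ []) (no ¬1) _ = ⊥-elim (¬1 refl)
      weight (a ∷ b ∷ c ∷ []) (no _) _ = trans
        (trans (cong₂ (λ { (A , B) C → ⟦ (A ℤ.≤ᵇ B ℤ.+ C) ∧ (B ℤ.≤ᵇ A ℤ.+ C) ∧ (C ℤ.≤ᵇ A ℤ.+ B) ∧ (A ℤ.+ B ℤ.+ C ℤ.≤ᵇ ℤ.+ t) ⟧ }) (cong₂ _,_ (Vec.lookup-map a ℤ.+_ l) (Vec.lookup-map b ℤ.+_ l)) (Vec.lookup-map c ℤ.+_ l))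
          (tri-bool (lookup l a) (lookup l b) (lookup l c)))
        (sym (trans (≈-trans (∙-identityʳ _) (≈-trans (∙-cong ≈-refl (∙-cong ≈-refl (∙-identityʳ _))) (≈-sym (∙-assoc (δ (lookup l a)) (δ (lookup l b)) (δ (lookup l c))))) 0 z≤n)
          (trans (ε-∙δ _ (le c)) (δ∙δ (lookup l c) (le a) (le b)))))
      weight []                    _ (inj₁ ())
      weight []                    _ (inj₂ ())
      weight (_ ∷ _ ∷ [])          _ (inj₁ ())
      weight (_ ∷ _ ∷ [])          _ (inj₂ ())
      weight (_ ∷ _ ∷ _ ∷ _ ∷ _)   _ (inj₁ ())
      weight (_ ∷ _ ∷ _ ∷ _ ∷ _)   _ (inj₂ ())
      weight (_ ∷ _ ∷ _ ∷ [])      (yes ()) _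

  #L≡Z : # L ≡ Z ends x
  #L≡Z = trans (#countVec (suc m) nE (inTPᵇ G t)) (trans
    (∑Vec-cong (suc m) nE λ l l≤m → trans (⟦⟧-∧ (allᵇ (nodeOKᵇ G t (map ℤ.+_ l)) (allFin nV)) _)
      (trans (cong₂ _*_ (trans (⟦allᵇ⟧ (nodeOKᵇ G t (map ℤ.+_ l)) id) (ℚ∏.∏-cong (node-weight l l≤m))) (trans (⟦allᵇ⟧ (edgeOKᵇ G t (map ℤ.+_ l)) id) (ℚ∏.∏-ε (edge-one l l≤m)))) (*-identityʳ _)))
    (sym (Z≡∑Vec ends x)))

-- Identity theorem for polynomials

private
  synthetic-division : ∀ r a p → Σ Poly λ q → length q ≡ length p × (∀ x → evalPoly (a ∷ p) x ≡ evalPoly (a ∷ p) r + (x - r) * evalPoly q x)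
  synthetic-division r a [] = [] , refl , λ x → trans (proj₂ (poly-const a) x) (trans (solve 2 (λ a y → a := a :+ y :* con ℤ.0ℤ) refl a (x - r))
    (cong₂ (λ u v → u + (x - r) * v) (sym (proj₂ (poly-const a) r)) ι-0))
  synthetic-division r a (b ∷ p) with synthetic-division r b p
  ... | q , len , eq = evalPoly (b ∷ p) r ∷ q , cong suc len , λ x → begin
    evalPoly (a ∷ b ∷ p) x                                ≡⟨ evalPoly-∷ a (b ∷ p) x ⟩
    a + x * evalPoly (b ∷ p) x                            ≡⟨ cong (λ z → a + x * z) (eq x) ⟩
    a + x * (evalPoly (b ∷ p) r + (x - r) * evalPoly q x) ≡⟨ solve 5 (λ a x r v w → a :+ x :* (v :+ (x :- r) :* w) := a :+ r :* v :+ (x :- r) :* (v :+ x :* w)) refl a x r (evalPoly (b ∷ p) r) (evalPoly q x) ⟩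
    a + r * evalPoly (b ∷ p) r + (x - r) * (evalPoly (b ∷ p) r + x * evalPoly q x) ≡⟨ cong₂ (λ u v → u + (x - r) * v) (evalPoly-∷ a (b ∷ p) r) (evalPoly-∷ _ q x) ⟨
    evalPoly (a ∷ b ∷ p) r + (x - r) * evalPoly (evalPoly (b ∷ p) r ∷ q) x ∎
    where open ≡-Reasoning

  difference≢0 : ∀ c k → # (c ℕ.+ suc k) - # c ≢ 0ℚ
  difference≢0 c k e = #suc≢0 k (trans (trans (solve 2 (λ c k → k := c :+ k :- c) refl (# c) (# (suc k))) (cong (_- # c) (sym (#-+ c (suc k))))) e)

  root-factor : ∀ r a p q → (∀ x → evalPoly (a ∷ p) x ≡ evalPoly (a ∷ p) r + (x - r) * evalPoly q x) → evalPoly (a ∷ p) r ≡ 0ℚ → ∀ x → evalPoly (a ∷ p) x ≡ (x - r) * evalPoly q x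
  root-factor r a p q eq root x = trans (eq x) (trans (cong (_+ (x - r) * evalPoly q x) root) (+-identityˡ _))

  -- Dividing by the root c shortens the coefficient list, and the remaining terms of the
  -- progression are roots of the quotient.
  vanishing : ∀ d n p → length p ≡ n → ∀ c → (∀ s → evalPoly p (# (c ℕ.+ s ℕ.* suc d)) ≡ 0ℚ) → ∀ x → evalPoly p x ≡ 0ℚ
  vanishing d n       []      len c roots x = refl
  vanishing d (suc n) (a ∷ p) len c roots with synthetic-division (# c) a p
  ... | q , q-len , eq = λ x → trans (factored x) (trans (cong ((x - # c) *_) (q≡0 x)) (zeroʳ _))
    where
    factored = root-factor (# c) a p q eq (trans (cong (evalPoly (a ∷ p) ∘ #_) (sym (ℕ.+-identityʳ c))) (roots 0))
    q≡0 : ∀ x → evalPoly q x ≡ 0ℚ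
    q≡0 = vanishing d n q (trans q-len (ℕ.suc-injective len)) (c ℕ.+ suc d) λ s →
      let y = c ℕ.+ suc d ℕ.+ s ℕ.* suc d ; y≡ = ℕ.+-assoc c (suc d) (s ℕ.* suc d) in
      *-cancel (subst (λ z → # z - # c ≢ 0ℚ) (sym y≡) (difference≢0 c (d ℕ.+ s ℕ.* suc d)))
        (trans (sym (factored (# y))) (trans (cong (evalPoly (a ∷ p) ∘ #_) y≡) (trans (roots (suc s)) (sym (zeroʳ _)))))

  -- The alternative is decided by testing c, c + 1 and so on: every root found shortens the list,
  -- so the search ends.
  zero-or-nonzero : ∀ n p → length p ≡ n → ∀ c → (∀ x → evalPoly p x ≡ 0ℚ) ⊎ (Σ ℕ λ k → evalPoly p (# (c ℕ.+ k)) ≢ 0ℚ)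
  zero-or-nonzero n       []      len c = inj₁ λ x → refl
  zero-or-nonzero (suc n) (a ∷ p) len c with evalPoly (a ∷ p) (# c) ℚ.≟ 0ℚ
  ... | no  ne = inj₂ (0 , λ e → ne (trans (cong (evalPoly (a ∷ p) ∘ #_) (sym (ℕ.+-identityʳ c))) e))
  ... | yes root with synthetic-division (# c) a p
  ...   | q , q-len , eq with zero-or-nonzero n q (trans q-len (ℕ.suc-injective len)) (suc c)
  ...     | inj₁ q≡0 = inj₁ λ x → trans (root-factor (# c) a p q eq root x) (trans (cong ((x - # c) *_) (q≡0 x)) (zeroʳ _))
  ...     | inj₂ (k , ne) = inj₂ (suc k , λ e → ne (*-cancel (difference≢0 c k)
            (trans (trans (cong (λ z → (# (c ℕ.+ suc k) - # c) * evalPoly q (# z)) (sym (ℕ.+-suc c k))) (sym (root-factor (# c) a p q eq root (# (c ℕ.+ suc k))))) (trans e (sym (zeroʳ _))))))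

poly-difference : ∀ {f g} → IsPoly f → IsPoly g → IsPoly (λ x → f x - g x)
poly-difference fp gp = poly-+ fp (poly-neg gp)

identity-theorem : ∀ d c {f g} → IsPoly f → IsPoly g → (∀ s → f (# (c ℕ.+ s ℕ.* suc d)) ≡ g (# (c ℕ.+ s ℕ.* suc d))) → ∀ x → f x ≡ g x
identity-theorem d c {f} {g} fp gp agree x = trans (solve 2 (λ a b → a := a :- b :+ b) refl (f x) (g x)) (trans
  (cong (_+ g x) (trans (sym (proj₂ diff x)) (vanishing d _ (proj₁ diff) refl c (λ s → trans (proj₂ diff _) (trans (cong (_- g (# (c ℕ.+ s ℕ.* suc d))) (agree s)) (-‿inverseʳ _))) x)))
  (+-identityˡ (g x)))
  where diff = poly-difference fp gp

equal-or-distinct : ∀ {f g} → IsPoly f → IsPoly g → (∀ x → f x ≡ g x) ⊎ (Σ ℚ λ x → f x ≢ g x)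
equal-or-distinct {f} {g} fp gp with zero-or-nonzero _ (proj₁ (poly-difference fp gp)) refl 0
... | inj₁ z = inj₁ λ x → trans (solve 2 (λ a b → a := a :- b :+ b) refl (f x) (g x)) (trans (cong (_+ g x) (trans (sym (proj₂ (poly-difference fp gp) x)) (z x))) (+-identityˡ (g x)))
... | inj₂ (k , ne) = inj₂ (# k , λ e → ne (trans (proj₂ (poly-difference fp gp) (# k)) (trans (cong (_- g (# k)) e) (-‿inverseʳ (g (# k))))))

-- Quasi-polynomials

record Value (G : Graph) (t : ℕ) (q : ℚ) : Set where
  constructor value
  field
    count     : ℕ
    bijection : EhrhartCount G t count
    equal     : # count ≡ q

value-unique : ∀ {G t q q′} → Value G t q → Value G t q′ → q ≡ q′
value-unique (value k b e) (value k′ b′ e′) = trans (sym e) (trans (cong #_ (Perm.↔⇒≡ (↔-trans (↔-sym b) b′))) e′)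

module _ (G : Graph) where

  quasi-poly : ∀ β (f : Fin (suc β) → ℚ → ℚ) → (∀ r → IsPoly (f r)) → (∀ r s → Value G (toℕ r ℕ.+ s ℕ.* suc β) (f r (# (toℕ r ℕ.+ s ℕ.* suc β)))) → HasQuasiPolyPeriod G (suc β)
  quasi-poly β f fp values = (λ r → proj₁ (fp r)) , λ t →
    let r = fromℕ< (ℕ.m%n<n t (suc β))
        t≡ : toℕ r ℕ.+ t ℕ./ suc β ℕ.* suc β ≡ t
        t≡ = trans (cong (ℕ._+ t ℕ./ suc β ℕ.* suc β) (Fin.toℕ-fromℕ< (ℕ.m%n<n t (suc β)))) (sym (ℕ.m≡m%n+[m/n]*n t (suc β)))
    in extract t r (subst (λ z → Value G z (f r (# z))) t≡ (values r (t ℕ./ suc β)))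
    where
    extract : ∀ t r → Value G t (f r (# t)) → Σ ℕ λ k → EhrhartCount G t k × evalPoly (proj₁ (fp r)) (ℕtoℚ t) ≡ ℕtoℚ k
    extract t r (value k b e) = k , b , trans (proj₂ (fp r) (ℕtoℚ t)) (trans (cong (f r) (ℕtoℚ≡ι t)) (trans (sym e) (sym (ℕtoℚ≡ι k))))

  -- Candidate periods are refuted through this one constituent, which governs all multiples of the
  -- candidate at once.
  residue-zero : ∀ β → HasQuasiPolyPeriod G (suc β) → Σ (ℚ → ℚ) λ f → IsPoly f × (∀ t → t % suc β ≡ 0 → Value G t (f (# t)))
  residue-zero β (p , values) = evalPoly (p zero) , (p zero , λ _ → refl) , λ t t%≡0 →
    let (k , b , e) = values t
        index : fromℕ< (ℕ.m%n<n t (suc β)) ≡ zero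
        index = Fin.toℕ-injective (trans (Fin.toℕ-fromℕ< (ℕ.m%n<n t (suc β))) t%≡0)
    in value k b (sym (trans (cong₂ (λ i x → evalPoly (p i) x) (sym index) (sym (ℕtoℚ≡ι t))) (trans e (ℕtoℚ≡ι k))))

  private
    halfOdd : ℚ → ℚ
    halfOdd x = ½ * (x - # 1)

    ½-double : ∀ m → ½ * # (m ℕ.+ m) ≡ # m
    ½-double m = trans (cong (½ *_) (#-+ m m)) (trans (solve 2 (λ h m → h :* (m :+ m) := :# 2 :* h :* m) refl ½ (# m)) (trans (cong (_* # m) (*-recip 1)) (*-identityˡ (# m))))

    halfOdd-double : ∀ m → halfOdd (# (suc (m ℕ.+ m))) ≡ # m
    halfOdd-double m = trans (cong (½ *_) (trans (cong (_- # 1) (#-suc (m ℕ.+ m))) (solve 1 (λ x → :# 1 :+ x :- :# 1 := x) refl (# (m ℕ.+ m))))) (½-double m)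

    *2 : ∀ s → s ℕ.* 2 ≡ s ℕ.+ s
    *2 = nat-solve-∀

  no-zero-period : ¬ HasQuasiPolyPeriod G 0
  no-zero-period ()

  -- The period is 1 or 2 according to whether the two constituents agree.
  module _ {f h : ℚ → ℚ} (fp : IsPoly f) (hp : IsPoly h) (even : ∀ m → Value G (m ℕ.+ m) (f (# m))) (odd : ∀ m → Value G (suc (m ℕ.+ m)) (h (# m))) where

    private
      P₀ P₁ : ℚ → ℚ
      P₀ x = f (½ * x)
      P₁ x = h (halfOdd x)

      P₀-poly : IsPoly P₀
      P₀-poly = poly-∘ fp (poly-* (poly-const ½) poly-id)

      P₁-poly : IsPoly P₁
      P₁-poly = poly-∘ hp (poly-* (poly-const ½) (poly-+ poly-id (poly-const _)))

      value₀ : ∀ m → Value G (m ℕ.+ m) (P₀ (# (m ℕ.+ m)))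
      value₀ m = subst (Value G (m ℕ.+ m)) (cong f (sym (½-double m))) (even m)

      value₁ : ∀ m → Value G (suc (m ℕ.+ m)) (P₁ (# (suc (m ℕ.+ m))))
      value₁ m = subst (Value G (suc (m ℕ.+ m))) (cong h (sym (halfOdd-double m))) (odd m)

      period-2 : HasQuasiPolyPeriod G 2
      period-2 = quasi-poly 1 (λ { zero → P₀ ; (suc _) → P₁ }) (λ { zero → P₀-poly ; (suc _) → P₁-poly })
        λ { zero s → subst (λ z → Value G z (P₀ (# z))) (sym (*2 s)) (value₀ s) ; (suc zero) s → subst (λ z → Value G (suc z) (P₁ (# (suc z)))) (sym (*2 s)) (value₁ s) }

    two-constituents : Σ ℕ λ α → Period G α × α ≤ 2
    two-constituents = [ one , (λ { (x , ne) → two x ne }) ]′ (equal-or-distinct P₀-poly P₁-poly)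
      where
      one : (∀ x → P₀ x ≡ P₁ x) → Σ ℕ λ α → Period G α × α ≤ 2
      one same = 1 , (quasi-poly 0 (λ _ → P₀) (λ _ → P₀-poly) (λ { zero s → subst (λ z → Value G z (P₀ (# z))) (sym (ℕ.*-identityʳ s)) (all s (halve s)) }) , λ { zero _ → no-zero-period ; (suc _) (s≤s ()) }) , s≤s z≤n
        where
        all : ∀ t → (Σ ℕ λ m → t ≡ m ℕ.+ m ⊎ t ≡ suc (m ℕ.+ m)) → Value G t (P₀ (# t))
        all t (m , inj₁ refl) = value₀ m
        all t (m , inj₂ refl) = subst (Value G t) (sym (same (# t))) (value₁ m)
      not-one : ∀ x → P₀ x ≢ P₁ x → (Σ (ℚ → ℚ) λ f → IsPoly f × (∀ t → t % 1 ≡ 0 → Value G t (f (# t)))) → ⊥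
      not-one x ne (p , pp , values) = ne (trans
        (sym (identity-theorem 1 0 pp P₀-poly (λ s → value-unique (values (s ℕ.* 2) (ℕ.n%1≡0 (s ℕ.* 2))) (subst (λ z → Value G z (P₀ (# z))) (sym (*2 s)) (value₀ s))) x))
        (identity-theorem 1 1 pp P₁-poly (λ s → value-unique (values (suc (s ℕ.* 2)) (ℕ.n%1≡0 (suc (s ℕ.* 2)))) (subst (λ z → Value G (suc z) (P₁ (# (suc z)))) (sym (*2 s)) (value₁ s))) x))
      two : ∀ x → P₀ x ≢ P₁ x → Σ ℕ λ α → Period G α × α ≤ 2
      two x ne = 2 , (period-2 , λ { zero _ → no-zero-period ; (suc zero) _ → not-one x ne ∘ residue-zero 0 ; (suc (suc _)) (s≤s (s≤s ())) }) , ℕ.≤-refl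

  module _ {f e h : ℚ → ℚ} (fp : IsPoly f) (ep : IsPoly e) (hp : IsPoly h) (e≢0 : e (# 0) ≢ 0ℚ)
    (even₀ : ∀ s → Value G (s ℕ.+ s ℕ.+ (s ℕ.+ s)) (f (# (s ℕ.+ s)) + e (# (s ℕ.+ s))))
    (even₂ : ∀ s → Value G (suc (s ℕ.+ s) ℕ.+ suc (s ℕ.+ s)) (f (# (suc (s ℕ.+ s)))))
    (odd : ∀ m → Value G (suc (m ℕ.+ m)) (h (# m))) where

    private
      A B O : ℚ → ℚ
      A x = f (½ * x) + e (½ * x)
      B x = f (½ * x)
      O x = h (halfOdd x)

      half-poly : IsPoly (λ x → ½ * x)
      half-poly = poly-* (poly-const ½) poly-id

      B-poly : IsPoly B
      B-poly = poly-∘ fp half-poly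

      A-poly : IsPoly A
      A-poly = poly-+ B-poly (poly-∘ ep half-poly)

      O-poly : IsPoly O
      O-poly = poly-∘ hp (poly-* (poly-const ½) (poly-+ poly-id (poly-const _)))

      valueA : ∀ s → let m = s ℕ.+ s in Value G (m ℕ.+ m) (A (# (m ℕ.+ m)))
      valueA s = let m = s ℕ.+ s in subst (Value G (m ℕ.+ m)) (cong (λ z → f z + e z) (sym (½-double m))) (even₀ s)

      valueB : ∀ s → let m = suc (s ℕ.+ s) in Value G (m ℕ.+ m) (B (# (m ℕ.+ m)))
      valueB s = let m = suc (s ℕ.+ s) in subst (Value G (m ℕ.+ m)) (cong f (sym (½-double m))) (even₂ s)

      valueO : ∀ m → Value G (suc (m ℕ.+ m)) (O (# (suc (m ℕ.+ m))))
      valueO m = subst (Value G (suc (m ℕ.+ m))) (cong h (sym (halfOdd-double m))) (odd m)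

      t₀ : ∀ s → s ℕ.+ s ℕ.+ (s ℕ.+ s) ≡ s ℕ.* 4
      t₀ = nat-solve-∀
      t₁ : ∀ s → suc (s ℕ.+ s ℕ.+ (s ℕ.+ s)) ≡ 1 ℕ.+ s ℕ.* 4
      t₁ s = cong suc (t₀ s)
      t₂ : ∀ s → suc (s ℕ.+ s) ℕ.+ suc (s ℕ.+ s) ≡ 2 ℕ.+ s ℕ.* 4
      t₂ = nat-solve-∀
      t₃ : ∀ s → suc (suc (s ℕ.+ s) ℕ.+ suc (s ℕ.+ s)) ≡ 3 ℕ.+ s ℕ.* 4
      t₃ s = cong suc (t₂ s)

      constituent : Fin 4 → ℚ → ℚ
      constituent zero                = A
      constituent (suc (suc zero))    = B
      constituent _                   = O

      period-4 : HasQuasiPolyPeriod G 4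
      period-4 = quasi-poly 3 constituent
        (λ { zero → A-poly ; (suc zero) → O-poly ; (suc (suc zero)) → B-poly ; (suc (suc (suc _))) → O-poly })
        (λ { zero s → subst (λ z → Value G z (A (# z))) (t₀ s) (valueA s)
           ; (suc zero) s → subst (λ z → Value G z (O (# z))) (t₁ s) (valueO (s ℕ.+ s))
           ; (suc (suc zero)) s → subst (λ z → Value G z (B (# z))) (t₂ s) (valueB s)
           ; (suc (suc (suc zero))) s → subst (λ z → Value G z (O (# z))) (t₃ s) (valueO (suc (s ℕ.+ s))) })

      t₀′ : ∀ s → let k = s ℕ.+ s ℕ.+ s in k ℕ.+ k ℕ.+ (k ℕ.+ k) ≡ 0 ℕ.+ s ℕ.* 12
      t₀′ = nat-solve-∀
      t₂′ : ∀ s → let k = suc (s ℕ.+ s ℕ.+ s) in suc (k ℕ.+ k) ℕ.+ suc (k ℕ.+ k) ≡ 6 ℕ.+ s ℕ.* 12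
      t₂′ = nat-solve-∀

      -- Periods 1, 2 and 3 divide 6, so their constituent of residue 0 would have to
      -- agree with A on the multiples of 12 and with B on 6 + 12 ℕ.
      ¬period : ∀ β → (∀ s → (s ℕ.* 6) % suc β ≡ 0) → ¬ HasQuasiPolyPeriod G (suc β)
      ¬period β 6s%≡0 = refute ∘ residue-zero β
        where
        refute : (Σ (ℚ → ℚ) λ f → IsPoly f × (∀ t → t % suc β ≡ 0 → Value G t (f (# t)))) → ⊥
        refute (p , pp , values) = e≢0 (trans (trans (cong e (solve 1 (λ h → :# 0 := h :* :# 0) refl ½)) (solve 2 (λ a b → b := a :+ b :- a) refl (B (# 0)) (e (½ * # 0)))) (trans (cong (_- B (# 0)) (trans (sym (p≡A (# 0))) (p≡B (# 0)))) (-‿inverseʳ _)))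
          where
          p≡A : ∀ x → p x ≡ A x
          p≡A = identity-theorem 11 0 pp A-poly λ s → value-unique (values (s ℕ.* 12) (trans (cong (_% suc β) (12≡ s)) (6s%≡0 (s ℕ.+ s)))) (subst (λ z → Value G z (A (# z))) (t₀′ s) (valueA (s ℕ.+ s ℕ.+ s)))
            where
            12≡ : ∀ s → s ℕ.* 12 ≡ (s ℕ.+ s) ℕ.* 6
            12≡ = nat-solve-∀
          p≡B : ∀ x → p x ≡ B x
          p≡B = identity-theorem 11 6 pp B-poly λ s → value-unique (values (6 ℕ.+ s ℕ.* 12) (trans (cong (_% suc β) (12≡ s)) (6s%≡0 (suc (s ℕ.+ s))))) (subst (λ z → Value G z (B (# z))) (t₂′ s) (valueB (suc (s ℕ.+ s ℕ.+ s))))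
            where
            12≡ : ∀ s → 6 ℕ.+ s ℕ.* 12 ≡ suc (s ℕ.+ s) ℕ.* 6
            12≡ = nat-solve-∀

    three-constituents : Period G 4
    three-constituents = period-4 , λ
      { zero _ → no-zero-period
      ; (suc zero) _ → ¬period 0 (λ s → ℕ.n%1≡0 (s ℕ.* 6))
      ; (suc (suc zero)) _ → ¬period 1 (λ s → trans (cong (_% 2) (sym (ℕ.*-assoc s 3 2))) (ℕ.m*n%n≡0 (s ℕ.* 3) 2))
      ; (suc (suc (suc zero))) _ → ¬period 2 (λ s → trans (cong (_% 3) (sym (ℕ.*-assoc s 2 3))) (ℕ.m*n%n≡0 (s ℕ.* 2) 3))
      ; (suc (suc (suc (suc _)))) (s≤s (s≤s (s≤s (s≤s ())))) }

-- At 0 the recursion reads x ↦ 1 + 2x, so the value is 2 to the power g + 1, minus 1. Only that it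
-- is positive matters.
excess-at-0 : ∀ g → Σ ℕ λ k → excess (suc g) (# 0) ≡ # (suc k)
excess-at-0 g = let (k , e) = nat g in k ℕ.+ k , trans (cong₂ _+_ (one^ g) (cong (# 2 * (# 0 + # 1) *_) e)) (trans (solve 1 (λ k → :# 1 :+ :# 2 :* (:# 0 :+ :# 1) :* k := :# 1 :+ (k :+ k)) refl (# k)) (trans (cong (# 1 +_) (sym (#-+ k k))) (sym (#-suc (k ℕ.+ k)))))
  where
  one^ : ∀ g → (# 0 + # 1) ^ g ≡ # 1
  one^ zero    = sym ι-1
  one^ (suc g) = trans (cong ((# 0 + # 1) *_) (one^ g)) (solve 0 ((:# 0 :+ :# 1) :* :# 1 := :# 1) refl)
  nat : ∀ g → Σ ℕ λ k → excess g (# 0) ≡ # k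
  nat zero    = 0 , refl
  nat (suc g) = let (k , e) = excess-at-0 g in suc k , e

½^≢0 : ∀ g → ½ ^ g ≢ 0ℚ
½^≢0 g e = 1ℚ≢0ℚ (trans (sym (½^*2^ g)) (trans (cong (_* # 2 ^ g) e) (zeroˡ _)))

-- Leaves, cycle rank and the period

countFin : ∀ {n} {P : Fin n → Set} → (∀ v → Dec (P v)) → ℕ
countFin {zero}  P? = 0
countFin {suc n} P? = choose (P? zero) 1 0 ℕ.+ countFin (P? ∘ suc)

countFin-none : ∀ {n} {P : Fin n → Set} (P? : ∀ v → Dec (P v)) → (∀ v → ¬ P v) → countFin P? ≡ 0
countFin-none {zero}  P? none = refl
countFin-none {suc n} P? none = cong₂ ℕ._+_ (choose-no (P? zero) (none zero)) (countFin-none (P? ∘ suc) (none ∘ suc))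

countFin-zero : ∀ {n} {P : Fin n → Set} (P? : ∀ v → Dec (P v)) → countFin P? ≡ 0 → ∀ v → ¬ P v
countFin-zero P? e zero    p = 1≢0 (trans (sym (choose-yes (P? zero) p)) (ℕ.m+n≡0⇒m≡0 _ e))
  where
  1≢0 : 1 ≢ 0
  1≢0 ()
countFin-zero P? e (suc v) p = countFin-zero (P? ∘ suc) (ℕ.m+n≡0⇒n≡0 _ e) v p

module _ (G : Graph) (is13 : Is13Graph G) (connected : Connected G) where
  open Graph G

  leaves : ℕ
  leaves = countFin (λ v → degree G v ℕ.≟ 1)

  leaves-cubic : Cubic G → leaves ≡ 0
  leaves-cubic cubic = countFin-none _ λ v e → 3≢1 (trans (sym (cubic v)) e)
    where
    3≢1 : 3 ≢ 1
    3≢1 ()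

  leaves-noncubic : ¬ Cubic G → leaves ≢ 0
  leaves-noncubic ¬cubic e = ¬cubic λ v → [ (λ deg₁ → ⊥-elim (countFin-zero _ e v deg₁)) , id ]′ (is13 v)

  module _ (t m : ℕ) (2m≤t : m ℕ.+ m ≤ t) (t≤2m+1 : t ≤ suc (m ℕ.+ m)) where
    open FusionAlgebra t m 2m≤t t≤2m+1
    open LatticeCount G is13 t m 2m≤t t≤2m+1 using (𝓐; L; L-count; #L≡Z; x)
    open StateSum 𝓐 {nV} using (Z≡F; F-connected; θ^)
    open FinProduct commutativeMonoid using (∏; ∏-suc; ∏-empty)

    private
      ∏-choose : ∀ {n} {P : Fin n → Set} (P? : ∀ v → Dec (P v)) a → ∏ (λ v → choose (P? v) a (δ 0)) ≈ pow a (countFin P?)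
      ∏-choose {zero}  P? a = λ c _ → cong (λ z → z c) (∏-empty _)
      ∏-choose {suc n} P? a = ≈-trans (λ c _ → cong (λ z → z c) (∏-suc _)) (≈-trans (∙-cong ≈-refl (∏-choose (P? ∘ suc) a)) (head (P? zero)))
        where
        head : ∀ {Q : Set} (d : Dec Q) → choose d a (δ 0) ∙ pow a (countFin (P? ∘ suc)) ≈ pow a (choose d 1 0 ℕ.+ countFin (P? ∘ suc))
        head (yes _) = ≈-refl
        head (no _)  = ∙-identityˡ _

      θ^≈pow : ∀ g → θ^ g ≈ pow θ g
      θ^≈pow zero    = ≈-refl
      θ^≈pow (suc g) = ∙-cong ≈-refl (θ^≈pow g)

    lattice-value : (root : Fin nV) → Value G t (ε (pow Ω leaves ∙ pow θ (genus G connected root)))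
    lattice-value root = value L L-count (trans #L≡Z (trans (Z≡F ends x) (trans
      (F-connected (rep (blocks ends)) (cycles (blocks ends)) x (base G connected root) (rep-base G connected root) (cycles-elsewhere G connected root))
      (≈-trans (∙-cong (θ^≈pow (genus G connected root)) (∏-choose _ Ω)) (∙-comm _ _) 0 z≤n))))

    -- The graph without nodes is vacuously connected and cubic, but offers no root at which a cycle
    -- rank could be read off; its state sum is an empty product.
    lattice-value-empty : nV ≡ 0 → Value G t 1ℚ
    lattice-value-empty e = value L L-count (trans #L≡Z (trans (Z≡F ends x) (no-nodes e _)))
      where
      no-nodes : ∀ {n} → n ≡ 0 → (f : Fin n → ℚ) → ℚ∏.∏ f ≡ 1ℚ
      no-nodes refl f = ℚ∏.∏-empty f

  private
    evenTerm oddTerm : ℕ → ℕ → ℕ → ℚ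
    evenTerm n g m = let open EvenFormula m in ε (pow Ω n ∙ pow θ g)
    oddTerm  n g m = let open OddLevel m in ε (pow Ω n ∙ pow θ g)

    module _ (root : Fin nV) where

      g : ℕ
      g = genus G connected root

      even : ∀ m → Value G (m ℕ.+ m) (evenTerm leaves g m)
      even m = lattice-value (m ℕ.+ m) m ℕ.≤-refl (ℕ.n≤1+n _) root

      odd : ∀ m → Value G (suc (m ℕ.+ m)) (oddTerm leaves g m)
      odd m = lattice-value (suc (m ℕ.+ m)) m (ℕ.n≤1+n _) ℕ.≤-refl root

      two : PolyValue (evenTerm leaves g) → PolyValue (oddTerm leaves g) → Σ ℕ λ α → Period G α × α ≤ 2
      two (f , fp , f-eq) (h , hp , h-eq) = two-constituents G fp hp
        (λ m → subst (Value G (m ℕ.+ m)) (f-eq m) (even m)) (λ m → subst (Value G (suc (m ℕ.+ m))) (h-eq m) (odd m))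

      tree-term : ∀ n → PolyValue (evenTerm n 0)
      tree-term zero    = evenCount-closed 0
      tree-term (suc k) = let (f , fp , eq) = evenCount-open k 0 in f , fp , λ m → trans (eq m) (no-excess (f (# m)) (EvenFormula.χ m) (½ ^ 0))
        where
        no-excess : ∀ x c h → x + c * (h * # 0) ≡ x
        no-excess = solve 3 (λ x c h → x :+ c :* (h :* :# 0) := x) refl

      small : leaves ≡ 0 ⊎ g ≡ 0 → Σ ℕ λ α → Period G α × α ≤ 2
      small (inj₁ n≡0) = two (subst (λ n → PolyValue (evenTerm n g)) (sym n≡0) (evenCount-closed g)) (oddCount leaves g)
      small (inj₂ g≡0) = two (subst (λ g → PolyValue (evenTerm leaves g)) (sym g≡0) (tree-term leaves)) (oddCount leaves g)

      extra : ℕ → ℚ → ℚ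
      extra g μ = ½ ^ g * excess g μ

      extra≢0 : ∀ g → extra (suc g) (# 0) ≢ 0ℚ
      extra≢0 g z = let (k , eq) = excess-at-0 g in #suc≢0 k (trans (sym eq) (*-cancel (½^≢0 (suc g)) (trans z (sym (zeroʳ _)))))

      -- χ is 1 for m even and 0 for m odd, so t ≡ 0 and t ≡ 2 modulo 4 see the polynomials f +
      -- `extra g` and f.
      three : ∀ g′ → g ≡ suc g′ → (Σ (ℚ → ℚ) λ f → IsPoly f × (∀ m → evenTerm leaves g m ≡ f (# m) + EvenFormula.χ m * extra g (# m))) → PolyValue (oddTerm leaves g) → Period G 4
      three g′ g≡ (f , fp , f-eq) (h , hp , h-eq) = three-constituents G {f} {extra g} {h} fp (poly-* (poly-const _) (excess-poly g)) hp
        (subst (λ z → extra z (# 0) ≢ 0ℚ) (sym g≡) (extra≢0 g′))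
        (λ s → let m = s ℕ.+ s in subst (Value G (m ℕ.+ m)) (trans (f-eq m) (cong (f (# m) +_) (trans (cong (_* extra g (# m)) (EvenFormula.χ-even m s refl)) (*-identityˡ _)))) (even m))
        (λ s → let m = suc (s ℕ.+ s) in subst (Value G (m ℕ.+ m)) (trans (f-eq m) (trans (cong (f (# m) +_) (trans (cong (_* extra g (# m)) (EvenFormula.χ-odd m s refl)) (zeroˡ _))) (+-identityʳ _))) (even m))
        (λ m → subst (Value G (suc (m ℕ.+ m))) (h-eq m) (odd m))

      large : ∀ n g′ → leaves ≡ n → g ≡ g′ → leaves ≢ 0 → g ≢ 0 → Period G 4
      large zero    _        n≡ _  n≢0 _   = ⊥-elim (n≢0 n≡)
      large (suc k) zero     _  g≡ _   g≢0 = ⊥-elim (g≢0 g≡)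
      large (suc k) (suc g′) n≡ g≡ _   _   = three g′ g≡
        (subst (λ n → Σ (ℚ → ℚ) λ f → IsPoly f × (∀ m → evenTerm n g m ≡ f (# m) + EvenFormula.χ m * extra g (# m))) (sym n≡) (evenCount-open k g))
        (oddCount leaves g)

    nodes : ∀ n → n ≡ 0 ⊎ Fin n
    nodes zero    = inj₁ refl
    nodes (suc _) = inj₂ zero

    no-node : ∀ {n} → n ≡ 0 → ¬ Fin n
    no-node refl ()

    empty : nV ≡ 0 → Σ ℕ λ α → Period G α × α ≤ 2
    empty e = two-constituents G (poly-const 1ℚ) (poly-const 1ℚ) (λ m → lattice-value-empty (m ℕ.+ m) m ℕ.≤-refl (ℕ.n≤1+n _) e) (λ m → lattice-value-empty (suc (m ℕ.+ m)) m (ℕ.n≤1+n _) ℕ.≤-refl e)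

  tree-or-cubic : IsTree G ⊎ Cubic G → Σ ℕ (λ α → Period G α × α ≤ 2)
  tree-or-cubic hyp = [ empty , (λ root → small root ([ (λ tree → inj₂ (genus-acyclic G connected root (proj₂ tree))) , (λ cubic → inj₁ (leaves-cubic cubic)) ]′ hyp)) ]′ (nodes nV)

  neither-tree-nor-cubic : ¬ IsTree G × ¬ Cubic G → Period G 4
  neither-tree-nor-cubic (¬tree , ¬cubic) = [ (λ e → ⊥-elim (¬cubic λ v → ⊥-elim (no-node e v))) ,
    (λ root → large root leaves (genus G connected root) refl refl (leaves-noncubic ¬cubic) λ g≡0 → ¬tree (connected , λ c → genus-cyclic G connected root c g≡0)) ]′ (nodes nV)

theorem2 : (G : Graph) → Is13Graph G → Connected G →
    ((IsTree G ⊎ Cubic G) → Σ ℕ (λ α → Period G α × α ≤ 2)) ×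
    ((¬ IsTree G × ¬ Cubic G) → Period G 4)
theorem2 G is13 connected = tree-or-cubic G is13 connected , neither-tree-nor-cubic G is13 connected
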